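{- Let $q$ range over prime powers with $q\equiv 1\pmod 4$, and let $r=r(q)$ be a positive integer with $r\to\infty$ and $r/q^{1/4}\to 0$ as $q\to\infty$. Let $N_r$ denote the number of subsets $S\subseteq\mathbb{F}_q$ with $|S|=r$ such that the induced subgraph $P_q[S]$ of the Paley graph is even. Then $$N_r=(1+o(1))\,2^{1-r}\binom{q}{r}\quad\text{as } q\to\infty.$$
   Context: For $q\equiv 1\pmod 4$ a prime power, the Paley graph $P_q$ has vertex set $\mathbb{F}_q$, with $x,y$ adjacent iff $x-y$ is a nonzero square in $\mathbb{F}_q$. An induced subgraph is even if every vertex has even degree in it. -}

module Defs where

open import Data.Nat using (ℕ; zero; suc; _%_; _≤_)
open import Data.Bool using (Bool; true; false; _∧_; not; if_then_else_)
open import Data.Fin using (Fin)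
open import Data.Fin.Properties using (_≟_)
open import Data.Fin.Subset using (Subset; _∈_)
open import Data.Vec using (Vec; []; _∷_; lookup)
open import Data.List using (List; []; _∷_; map; _++_; length; filter; allFin)
open import Data.Bool.ListAction using (any; all)
open import Data.Bool using (_∨_) renaming (_≟_ to _≟ᵇ_)
open import Data.Nat using () renaming (_%_ to _%ⁿ_; _≡ᵇ_ to _==ⁿ_)
open import Data.Fin.Subset using (∣_∣)
open import Data.Product using (Σ; _×_; ∃-syntax)
open import Relation.Nullary using (¬_; does)
open import Relation.Binary.PropositionalEquality using (_≡_)
open import Algebra.Core using (Op₁; Op₂)
open import Algebra.Structures using (IsCommutativeRing)

-- A finite field of order q, with carrier Fin q (every finite field of
-- order q is isomorphic to one of these; the Paley graph only depends on
-- the field up to isomorphism).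
record FiniteField (q : ℕ) : Set where
  field
    _+_ _*_ : Op₂ (Fin q)
    -_      : Op₁ (Fin q)
    0# 1#   : Fin q
    isCommutativeRing : IsCommutativeRing _≡_ _+_ _*_ -_ 0# 1#
    0≢1     : ¬ (0# ≡ 1#)
    inverse : ∀ x → ¬ (x ≡ 0#) → ∃[ y ] (x * y ≡ 1#)

-- q is an admissible Paley order: a finite field of order q exists
-- (i.e. q is a prime power) and q ≡ 1 (mod 4).
PaleyOrder : ℕ → Set
PaleyOrder q = (q % 4 ≡ 1) × FiniteField q

allSubsets : ∀ n → List (Subset n)
allSubsets zero = [] ∷ []
allSubsets (suc n) = map (true ∷_) (allSubsets n) ++ map (false ∷_) (allSubsets n)

module Paley {q : ℕ} (F : FiniteField q) where
  open FiniteField F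

  _==_ : Fin q → Fin q → Bool
  x == y = does (x ≟ y)

  isNonzeroSquare : Fin q → Bool
  isNonzeroSquare x = not (x == 0#) ∧ any (λ y → (y * y) == x) (allFin q)

  adj : Fin q → Fin q → Bool
  adj x y = isNonzeroSquare (x + (- y))

  degIn : Subset q → Fin q → ℕ
  degIn S v = length (filter (λ u → lookup S u ∧ not (u == v) ∧ adj u v ≟ᵇ true) (allFin q))

  isEven : Subset q → Bool
  isEven S = all (λ v → not (lookup S v) ∨ (degIn S v %ⁿ 2 ==ⁿ 0)) (allFin q)

  N : ℕ → ℕ
  N r = length (filter (λ S → ((∣ S ∣ ==ⁿ r) ∧ isEven S) ≟ᵇ true) (allSubsets q))

{-# OPTIONS --safe #-}
module Submission where

-- Write σ(u,v) = -1 if u and v are adjacent and 1 otherwise.  Expanding ∏_{v ∈ S} (1 + (-1)^deg(v)) gives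
--   2^r N_r = Σ_{|S| = r} Σ_{T ⊆ S} w(S,T),   w(S,T) = ∏_{u ∈ S} ∏_{v ∈ T} σ(u,v) = w(S, S ∖ T).
-- T = ∅ and T = S contribute 2 (q choose r), so only 1 ≤ |T| ≤ r/2 has to be shown negligible.  For a fixed such T
-- the sum over S ⊇ T is, up to sign, the coefficient of z^(r-|T|) in (1 + z)^a (1 - z)^b, where a and b count the
-- x ∉ T at which f(x) = ∏_{t ∈ T} (x - t) has either quadratic character.  If a and b are nearly equal, this
-- coefficient is smaller than the binomial coefficient (a + b choose r - |T|) by a factor 8^(r-|T|), which beats the
-- 2^r choices of T ⊆ S because r → ∞.
--
-- The bounds a, b ≤ 17q/32 come from Stepanov's method.  With g = f^((q-1)/2), counting coefficients yields a nonzero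
-- Σ_j (r_j + s_j g) X^(jq) vanishing to order M at each x with g(x) = c, so that M times the number of such x is at
-- most its degree.  Orders of vanishing are read off in 𝔽_q⟦Z⟧ at X = x + f(x) Z, where f(x + f(x) Z) / f(x) has
-- coefficients of low degree in x, so no derivatives are needed.

open import Defs
open import Algebra.Bundles using (CommutativeMonoid; CommutativeRing)
import Algebra.Morphism.Construct.Identity as Identity
open import Algebra.Morphism.Structures using (IsRingHomomorphism)
open import Data.Empty using (⊥)
open import Data.Fin using (Fin; zero; suc; combine; finToFun; fromℕ<; funToFin; remQuot; splitAt; toℕ; _↑ˡ_; _↑ʳ_)
open import Data.Fin.Permutation using (Permutation; permutation)
open import Data.Fin.Properties as Fin using (_≟_; any?; combine-remQuot; finToFun-funToFin; funToFin-finToFin; join-splitAt; pigeonhole; remQuot-combine; toℕ-fromℕ<; toℕ<n; <⇒≢)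
open import Data.List using (List; []; _∷_; _++_; allFin; filter; length; map; tabulate)
open import Data.List.Properties using (filter-++; length-++; length-map; length-tabulate)
open import Data.List.Relation.Unary.All as All using (All; []; _∷_)
import Data.List.Relation.Unary.All.Properties as All
open import Data.List.Relation.Unary.AllPairs using ([]; _∷_)
open import Data.List.Relation.Unary.Unique.Propositional using (Unique)
import Data.List.Relation.Unary.Unique.Propositional.Properties as Unique
open import Data.Nat as ℕ using (ℕ; zero; suc; z≤n; s≤s; _≡ᵇ_)
open import Data.Nat.Properties as ℕₚ using ()
open import Data.Nat.Solver using (module +-*-Solver)
open import Data.Product using (_×_; _,_; ∃-syntax; proj₁; proj₂)
open import Data.Sum using (_⊎_; inj₁; inj₂)
open import Data.Vec.Functional using () renaming (_∷_ to _▹_)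
open import Function using (_∘_; id)
open import Level using (0ℓ)
import Relation.Binary.PropositionalEquality as ≡
open import Relation.Nullary using (Dec; yes; no; ¬?; contradiction)
open import Relation.Nullary.Decidable using (dec-false; dec-true; decidable-stable)

-- The coefficient bound tolerates a fixed proportion of imbalance. Each matched pair of factors
-- gives `1 - z²`, whose powers have small coefficients, in even degrees only; each unmatched factor
-- is charged as eight factors `1 + z`. This works for 7a ≤ 8b and 7b ≤ 8a, and 7 · 17 < 8 · 15
-- makes 17/32 a sufficient target. In Stepanov's method the huge powers X^(jq) must stay cheap. On
-- X = x + f(x) Z one has X^q = x modulo Z^q, so they add only degree j to the equations, and the
-- slope f(x) clears the denominators x - t. With d = |T|, A coefficients in each r_j and s_j, and J
-- values of j, there are about M A equations, as A is large against M d, but 2 A J unknowns: two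
-- polynomials per j halve the cost, so J / M may be just above 1/2. The other obstacle is that the
-- auxiliary polynomial must not cancel to zero. A relation r + s g = 0 modulo X^q is squared; f g²
-- = f^q becomes the constant f(0), and a simple root of f gives the two sides orders of vanishing
-- of different parity. The degrees compared must be below q, with A of order d². Hence d² must be
-- small against q, which r⁴ < q ensures once r is large.

-- Formal power series over a commutative ring.

module PowerSeries {c ℓ} (R : CommutativeRing c ℓ) where
  open CommutativeRing R hiding (zero)
  open import Relation.Binary.Reasoning.Setoid setoid
  open import Algebra.Properties.CommutativeSemigroup +-commutativeSemigroup using (x∙yz≈y∙xz; interchange)

  Series : Set c
  Series = ℕ → Carrier

  infix 4 _≋_
  infixl 6 _⊕_
  infixl 7 _⊛_

  _≋_ : Series → Series → Set ℓ
  f ≋ g = ∀ k → f k ≈ g k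

  tail : Series → Series
  tail f k = f (suc k)

  -- The product is the Cauchy product, by recursion on f = f 0 + Z · `tail f` instead of a finite
  -- sum.
  _⊕_ _⊛_ : Series → Series → Series
  (f ⊕ g) k = f k + g k
  (f ⊛ g) zero    = f 0 * g 0
  (f ⊛ g) (suc k) = f 0 * g (suc k) + (tail f ⊛ g) k

  ⊖_ : Series → Series
  (⊖ f) k = - f k

  const : Carrier → Series
  const a zero    = a
  const a (suc k) = 0#

  Z : Series
  Z zero          = 0#
  Z (suc zero)    = 1#
  Z (suc (suc k)) = 0#

  ⊛-cong : ∀ {f f′ g g′} → f ≋ f′ → g ≋ g′ → f ⊛ g ≋ f′ ⊛ g′
  ⊛-cong p q zero    = *-cong (p 0) (q 0)
  ⊛-cong p q (suc k) = +-cong (*-cong (p 0) (q (suc k))) (⊛-cong (λ i → p (suc i)) q k)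

  ⊛-zeroˡ : ∀ g → (λ _ → 0#) ⊛ g ≋ (λ _ → 0#)
  ⊛-zeroˡ g zero    = zeroˡ _
  ⊛-zeroˡ g (suc k) = trans (+-cong (zeroˡ _) (⊛-zeroˡ g k)) (+-identityˡ _)

  const-⊛ : ∀ a g k → (const a ⊛ g) k ≈ a * g k
  const-⊛ a g zero    = refl
  const-⊛ a g (suc k) = trans (+-congˡ (⊛-zeroˡ g k)) (+-identityʳ _)

  scale-⊛ : ∀ a f g k → ((λ i → a * f i) ⊛ g) k ≈ a * (f ⊛ g) k
  scale-⊛ a f g zero    = *-assoc _ _ _
  scale-⊛ a f g (suc k) = begin
    a * f 0 * g (suc k) + ((λ i → a * f (suc i)) ⊛ g) k ≈⟨ +-cong (*-assoc _ _ _) (scale-⊛ a (tail f) g k) ⟩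
    a * (f 0 * g (suc k)) + a * (tail f ⊛ g) k          ≈⟨ distribˡ _ _ _ ⟨
    a * (f ⊛ g) (suc k)                                 ∎

  ⊛-distribʳ : ∀ h f g → (f ⊕ g) ⊛ h ≋ (f ⊛ h) ⊕ (g ⊛ h)
  ⊛-distribʳ h f g zero    = distribʳ _ _ _
  ⊛-distribʳ h f g (suc k) =
    trans (+-cong (distribʳ _ _ _) (⊛-distribʳ h (tail f) (tail g) k)) (interchange _ _ _ _)

  ⊛-assoc : ∀ f g h → (f ⊛ g) ⊛ h ≋ f ⊛ (g ⊛ h)
  ⊛-assoc f g h zero    = *-assoc _ _ _
  ⊛-assoc f g h (suc k) = begin
    f 0 * g 0 * h (suc k) + (tail (f ⊛ g) ⊛ h) k
      ≈⟨ +-cong (*-assoc _ _ _) (⊛-distribʳ h (λ i → f 0 * tail g i) (tail f ⊛ g) k) ⟩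
    f 0 * (g 0 * h (suc k)) + (((λ i → f 0 * tail g i) ⊛ h) k + ((tail f ⊛ g) ⊛ h) k)
      ≈⟨ +-congˡ (+-cong (scale-⊛ (f 0) (tail g) h k) (⊛-assoc (tail f) g h k)) ⟩
    f 0 * (g 0 * h (suc k)) + (f 0 * (tail g ⊛ h) k + (tail f ⊛ (g ⊛ h)) k)
      ≈⟨ +-assoc _ _ _ ⟨
    f 0 * (g 0 * h (suc k)) + f 0 * (tail g ⊛ h) k + (tail f ⊛ (g ⊛ h)) k
      ≈⟨ +-congʳ (distribˡ _ _ _) ⟨
    (f ⊛ (g ⊛ h)) (suc k) ∎

  -- The definition of the product peels off only the left factor; commutativity also needs the
  -- right one peeled.
  ⊛-unfoldʳ : ∀ f g k → (f ⊛ g) (suc k) ≈ f (suc k) * g 0 + (f ⊛ tail g) k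
  ⊛-unfoldʳ f g zero    = +-comm _ _
  ⊛-unfoldʳ f g (suc k) = trans (+-congˡ (⊛-unfoldʳ (tail f) g k)) (x∙yz≈y∙xz _ _ _)

  ⊛-comm : ∀ f g → f ⊛ g ≋ g ⊛ f
  ⊛-comm f g zero    = *-comm _ _
  ⊛-comm f g (suc k) = trans (+-cong (*-comm _ _) (⊛-comm (tail f) g k)) (sym (⊛-unfoldʳ g f k))

  ⊛-identityˡ : ∀ g → const 1# ⊛ g ≋ g
  ⊛-identityˡ g k = trans (const-⊛ 1# g k) (*-identityˡ _)

  const-0 : const 0# ≋ (λ _ → 0#)
  const-0 zero    = refl
  const-0 (suc k) = refl

  seriesRing : CommutativeRing c ℓ
  seriesRing = record
    { Carrier = Series ; _≈_ = _≋_ ; _+_ = _⊕_ ; _*_ = _⊛_ ; -_ = ⊖_ ; 0# = λ _ → 0# ; 1# = const 1#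
    ; isCommutativeRing = record
      { isRing = record
        { +-isAbelianGroup = record
          { isGroup = record
            { isMonoid = record
              { isSemigroup = record
                { isMagma = record
                  { isEquivalence = record
                    { refl = λ k → refl ; sym = λ p k → sym (p k) ; trans = λ p q k → trans (p k) (q k) }
                  ; ∙-cong = λ p q k → +-cong (p k) (q k) }
                ; assoc = λ f g h k → +-assoc _ _ _ }
              ; identity = (λ f k → +-identityˡ _) , (λ f k → +-identityʳ _) }
            ; inverse = (λ f k → -‿inverseˡ _) , (λ f k → -‿inverseʳ _)
            ; ⁻¹-cong = λ p k → -‿cong (p k) }
          ; comm = λ f g k → +-comm _ _ }
        ; *-cong = ⊛-cong
        ; *-assoc = ⊛-assoc
        ; *-identity = ⊛-identityˡ , λ g k → trans (⊛-comm g (const 1#) k) (⊛-identityˡ g k)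
        ; distrib = (λ h f g k → trans (⊛-comm h (f ⊕ g) k)
                       (trans (⊛-distribʳ h f g k) (+-cong (⊛-comm f h k) (⊛-comm g h k))))
                  , ⊛-distribʳ }
      ; *-comm = ⊛-comm } }

  tailZ : tail Z ≋ const 1#
  tailZ zero    = refl
  tailZ (suc k) = refl

  Z-⊛-suc : ∀ g k → (Z ⊛ g) (suc k) ≈ g k
  Z-⊛-suc g k = begin
    0# * g (suc k) + (tail Z ⊛ g) k ≈⟨ +-cong (zeroˡ _) (⊛-cong tailZ (λ _ → refl) k) ⟩
    0# + (const 1# ⊛ g) k           ≈⟨ +-identityˡ _ ⟩
    (const 1# ⊛ g) k                ≈⟨ ⊛-identityˡ g k ⟩
    g k                             ∎

  line : Carrier → Carrier → Series
  line a b = const a ⊕ const b ⊛ Z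

  line-⊛-zero : ∀ a b g → (line a b ⊛ g) 0 ≈ a * g 0
  line-⊛-zero a b g = *-congʳ (trans (+-congˡ (zeroʳ _)) (+-identityʳ _))

  line-⊛-suc : ∀ a b g k → (line a b ⊛ g) (suc k) ≈ a * g (suc k) + b * g k
  line-⊛-suc a b g k = begin
    (line a b ⊛ g) (suc k)                             ≈⟨ ⊛-distribʳ g (const a) (const b ⊛ Z) (suc k) ⟩
    (const a ⊛ g) (suc k) + ((const b ⊛ Z) ⊛ g) (suc k) ≈⟨ +-cong (const-⊛ a g (suc k)) (⊛-assoc (const b) Z g (suc k)) ⟩
    a * g (suc k) + (const b ⊛ (Z ⊛ g)) (suc k)        ≈⟨ +-congˡ (const-⊛ b (Z ⊛ g) (suc k)) ⟩
    a * g (suc k) + b * (Z ⊛ g) (suc k)                ≈⟨ +-congˡ (*-congˡ (Z-⊛-suc g k)) ⟩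
    a * g (suc k) + b * g k                            ∎

  infix 4 _≋[_]_

  -- Congruence modulo Z^m; congruence to zero expresses vanishing to order m.
  _≋[_]_ : Series → ℕ → Series → Set ℓ
  f ≋[ m ] g = ∀ k → k ℕ.< m → f k ≈ g k

  ⊛-cong-mod : ∀ {m f f′ g g′} → f ≋[ m ] f′ → g ≋[ m ] g′ → f ⊛ g ≋[ m ] f′ ⊛ g′
  ⊛-cong-mod p q zero    k<m = *-cong (p 0 k<m) (q 0 k<m)
  ⊛-cong-mod {suc m} p q (suc k) (s≤s k<m) =
    +-cong (*-cong (p 0 (s≤s z≤n)) (q (suc k) (s≤s k<m)))
           (⊛-cong-mod {m} (λ i i<m → p (suc i) (s≤s i<m)) (λ i i<m → q i (ℕₚ.m<n⇒m<1+n i<m)) k k<m)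

-- Polynomial functions with degree bounds.

module Polynomial {k ℓk r ℓr} (K : CommutativeRing k ℓk) (R : CommutativeRing r ℓr)
  (ι : CommutativeRing.Carrier K → CommutativeRing.Carrier R)
  (hom : IsRingHomomorphism (CommutativeRing.rawRing K) (CommutativeRing.rawRing R) ι) where

  private module K = CommutativeRing K
  open CommutativeRing R hiding (zero)
  open IsRingHomomorphism hom
  open import Relation.Binary.Reasoning.Setoid setoid
  open import Algebra.Solver.Ring.NaturalCoefficients.Default commutativeSemiring using (solve; _:=_; _:+_; _:*_)
  open import Algebra.Properties.Ring ring using (-‿distribˡ-*; -‿distribʳ-*; -0#≈0#; -‿+-comm)
  open import Algebra.Properties.Semiring.Exp semiring using (_^_)

  ev : ∀ {n} → (Fin n → K.Carrier) → Carrier → Carrier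
  ev {zero}  c u = 0#
  ev {suc n} c u = ι (c zero) + u * ev (c ∘ suc) u

  ev-congʳ : ∀ {n} (c : Fin n → K.Carrier) {u v} → u ≈ v → ev c u ≈ ev c v
  ev-congʳ {zero}  c u≈v = refl
  ev-congʳ {suc n} c u≈v = +-congˡ (*-cong u≈v (ev-congʳ (c ∘ suc) u≈v))

  ev-congˡ : ∀ {n} {c d : Fin n → K.Carrier} → (∀ i → c i K.≈ d i) → ∀ u → ev c u ≈ ev d u
  ev-congˡ {zero}  c≈d u = refl
  ev-congˡ {suc n} c≈d u = +-cong (⟦⟧-cong (c≈d zero)) (*-congˡ (ev-congˡ (c≈d ∘ suc) u))

  ev-0 : ∀ {n} {c : Fin n → K.Carrier} → (∀ i → c i K.≈ K.0#) → ∀ u → ev c u ≈ 0#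
  ev-0 {zero}  c≈0 u = refl
  ev-0 {suc n} c≈0 u = begin
    _ ≈⟨ +-cong (trans (⟦⟧-cong (c≈0 zero)) 0#-homo) (*-congˡ (ev-0 (c≈0 ∘ suc) u)) ⟩
    0# + u * 0# ≈⟨ trans (+-identityˡ _) (zeroʳ u) ⟩
    0# ∎

  ev-+ : ∀ {n} (c d : Fin n → K.Carrier) u → ev (λ i → c i K.+ d i) u ≈ ev c u + ev d u
  ev-+ {zero}  c d u = sym (+-identityˡ _)
  ev-+ {suc n} c d u = begin
    _ ≈⟨ +-cong (+-homo _ _) (*-congˡ (ev-+ (c ∘ suc) (d ∘ suc) u)) ⟩
    _ ≈⟨ solve 5 (λ a b u x y → (a :+ b) :+ u :* (x :+ y) := (a :+ u :* x) :+ (b :+ u :* y)) refl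
           _ _ u _ _ ⟩
    ev c u + ev d u ∎

  ev-* : ∀ {n} a (c : Fin n → K.Carrier) u → ev (λ i → a K.* c i) u ≈ ι a * ev c u
  ev-* {zero}  a c u = sym (zeroʳ _)
  ev-* {suc n} a c u = begin
    _ ≈⟨ +-cong (*-homo _ _) (*-congˡ (ev-* a (c ∘ suc) u)) ⟩
    _ ≈⟨ solve 4 (λ a b u x → a :* b :+ u :* (a :* x) := a :* (b :+ u :* x)) refl _ _ u _ ⟩
    ι a * ev c u ∎

  ev-neg : ∀ {n} (c : Fin n → K.Carrier) u → ev (λ i → K.- c i) u ≈ - ev c u
  ev-neg {zero}  c u = sym -0#≈0#
  ev-neg {suc n} c u = begin
    _ ≈⟨ +-cong (-‿homo _) (trans (*-congˡ (ev-neg (c ∘ suc) u)) (sym (-‿distribʳ-* _ _))) ⟩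
    _ ≈⟨ -‿+-comm _ _ ⟩
    - ev c u ∎

  pad : ∀ {m n} → m ℕ.≤ n → (Fin m → K.Carrier) → Fin n → K.Carrier
  pad z≤n       c i       = K.0#
  pad (s≤s m≤n) c zero    = c zero
  pad (s≤s m≤n) c (suc i) = pad m≤n (c ∘ suc) i

  ev-pad : ∀ {m n} (m≤n : m ℕ.≤ n) c u → ev c u ≈ ev (pad m≤n c) u
  ev-pad {n = n} z≤n c u = sym (ev-0 {n} {pad z≤n c} (λ _ → K.refl) u)
  ev-pad (s≤s m≤n) c u = +-congˡ (*-congˡ (ev-pad m≤n (c ∘ suc) u))

  -- Degree at most n is a property of a function on the algebra `R`, witnessed by coefficients in
  -- `K`, so degree bounds can be composed along with the functions.
  Poly : ℕ → (Carrier → Carrier) → Set _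
  Poly n φ = ∃[ c ] ∀ u → φ u ≈ ev {suc n} c u

  poly-cong : ∀ {n φ ψ} → (∀ u → φ u ≈ ψ u) → Poly n φ → Poly n ψ
  poly-cong φ≈ψ (c , p) = c , λ u → trans (sym (φ≈ψ u)) (p u)

  poly-≤ : ∀ {m n φ} → m ℕ.≤ n → Poly m φ → Poly n φ
  poly-≤ m≤n (c , p) = pad (s≤s m≤n) c , λ u → trans (p u) (ev-pad (s≤s m≤n) c u)

  -- The true bound is n - 1; giving away one avoids a separate case for the empty coefficient
  -- vector.
  poly-ev : ∀ {n} (c : Fin n → K.Carrier) → Poly n (ev c)
  poly-ev c = pad (ℕₚ.n≤1+n _) c , ev-pad (ℕₚ.n≤1+n _) c

  poly-const : ∀ {n} a → Poly n (λ _ → ι a)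
  poly-const a = poly-≤ z≤n ((λ _ → a) , λ u → sym (trans (+-congˡ (zeroʳ u)) (+-identityʳ _)))

  poly-0 : ∀ {n} → Poly n (λ _ → 0#)
  poly-0 = poly-cong (λ _ → 0#-homo) (poly-const K.0#)

  poly-1 : ∀ {n} → Poly n (λ _ → 1#)
  poly-1 = poly-cong (λ _ → 1#-homo) (poly-const K.1#)

  poly-+ : ∀ {n φ ψ} → Poly n φ → Poly n ψ → Poly n (λ u → φ u + ψ u)
  poly-+ (c , p) (d , q) = (λ i → c i K.+ d i) , λ u → trans (+-cong (p u) (q u)) (sym (ev-+ c d u))

  poly-neg : ∀ {n φ} → Poly n φ → Poly n (λ u → - φ u)
  poly-neg (c , p) = (λ i → K.- c i) , λ u → trans (-‿cong (p u)) (sym (ev-neg c u))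

  poly-scale : ∀ {n φ} a → Poly n φ → Poly n (λ u → ι a * φ u)
  poly-scale a (c , p) = (λ i → a K.* c i) , λ u → trans (*-congˡ (p u)) (sym (ev-* a c u))

  poly-shift : ∀ {n φ} → Poly n φ → Poly (suc n) (λ u → u * φ u)
  poly-shift (c , p) = K.0# ▹ c , λ u → begin
    _ ≈⟨ *-congˡ (p u) ⟩
    u * ev c u ≈⟨ sym (trans (+-congʳ 0#-homo) (+-identityˡ _)) ⟩
    _ ∎

  poly-id : Poly 1 (λ u → u)
  poly-id = poly-cong (λ u → *-identityʳ u) (poly-shift poly-1)

  poly-* : ∀ {m n φ ψ} → Poly m φ → Poly n ψ → Poly (m ℕ.+ n) (λ u → φ u * ψ u)
  poly-* {m} {n} {φ} {ψ} (c , p) q = poly-cong (λ u → *-congʳ (sym (p u))) (go m c)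
    where
    go : ∀ m (c : Fin (suc m) → K.Carrier) → Poly (m ℕ.+ n) (λ u → ev c u * ψ u)
    go zero    c = poly-cong (λ u → *-congʳ (sym (trans (+-congˡ (zeroʳ u)) (+-identityʳ _)))) (poly-scale (c zero) q)
    go (suc m) c = poly-cong
      (λ u → solve 4 (λ a u e p → a :* p :+ u :* (e :* p) := (a :+ u :* e) :* p) refl _ u _ _)
      (poly-+ (poly-≤ (ℕₚ.m≤n+m n (suc m)) (poly-scale (c zero) q)) (poly-shift (go m (c ∘ suc))))

  poly-^ : ∀ {m φ} n → Poly m φ → Poly (n ℕ.* m) (λ u → φ u ^ n)
  poly-^ zero    p = poly-1
  poly-^ (suc n) p = poly-* p (poly-^ n p)

  poly-∘ : ∀ {m n φ ψ} → Poly n φ → Poly m ψ → Poly (n ℕ.* m) (λ u → φ (ψ u))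
  poly-∘ {m} {n} {φ} {ψ} (c , p) q = poly-cong (λ u → sym (p (ψ u))) (go n c)
    where
    go : ∀ n (c : Fin (suc n) → K.Carrier) → Poly (n ℕ.* m) (λ u → ev c (ψ u))
    go zero    c = poly-cong (λ u → sym (trans (+-congˡ (zeroʳ (ψ u))) (+-identityʳ _))) (poly-const (c zero))
    go (suc n) c = poly-+ (poly-const (c zero)) (poly-* q (go n (c ∘ suc)))

  poly-linear : ∀ a → Poly 1 (λ u → u - ι a)
  poly-linear a = poly-+ poly-id (poly-neg (poly-const a))

  poly-translate : ∀ {n} a (c : Fin n → K.Carrier) → Poly n (λ u → ev c (u + ι a))
  poly-translate a c = poly-≤ (ℕₚ.≤-reflexive (ℕₚ.*-identityʳ _)) (poly-∘ (poly-ev c) (poly-+ poly-id (poly-const a)))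

  horner-step : ∀ a u x q ρ → a + u * ((u - x) * q + ρ) ≈ (u - x) * (ρ + u * q) + (a + x * ρ)
  horner-step a u x q ρ = sym (begin
    (u - x) * (ρ + u * q) + (a + x * ρ)
      ≈⟨ solve 6 (λ u x y q ρ a → (u :+ y) :* (ρ :+ u :* q) :+ (a :+ x :* ρ)
           := (a :+ u :* ((u :+ y) :* q :+ ρ)) :+ (x :+ y) :* ρ) refl u x (- x) q ρ a ⟩
    a + u * ((u - x) * q + ρ) + (x - x) * ρ
      ≈⟨ +-congˡ (trans (*-congʳ (-‿inverseʳ x)) (zeroˡ ρ)) ⟩
    a + u * ((u - x) * q + ρ) + 0#
      ≈⟨ +-identityʳ _ ⟩
    a + u * ((u - x) * q + ρ) ∎)

  divide : ∀ {n} x (c : Fin (suc n) → K.Carrier) →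
    ∃[ q ] ∃[ ρ ] ∀ u → ev c u ≈ (u - ι x) * ev {n} q u + ι ρ
  divide {zero}  x c = (λ ()) , c zero , λ u →
    trans (+-congˡ (zeroʳ u)) (trans (+-comm _ _) (+-congʳ (sym (zeroʳ _))))
  divide {suc n} x c = ρ ▹ q , c zero K.+ x K.* ρ , λ u → begin
      ι (c zero) + u * ev (c ∘ suc) u                      ≈⟨ +-congˡ (*-congˡ (eq u)) ⟩
      ι (c zero) + u * ((u - ι x) * ev q u + ι ρ)          ≈⟨ horner-step _ u _ _ _ ⟩
      (u - ι x) * (ι ρ + u * ev q u) + (ι (c zero) + ι x * ι ρ)
        ≈⟨ +-congˡ (trans (+-homo _ _) (+-congˡ (*-homo _ _))) ⟨
      (u - ι x) * ev (ρ ▹ q) u + ι (c zero K.+ x K.* ρ)    ∎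
    where
    q = proj₁ (divide x (c ∘ suc))
    ρ = proj₁ (proj₂ (divide x (c ∘ suc)))
    eq = proj₂ (proj₂ (divide x (c ∘ suc)))

  -- The leading terms cancel. The bound one below the exponent is what brings the polynomial in
  -- `frobenius` below degree q.
  poly-^-translate : ∀ a n → Poly n (λ u → (u + ι a) ^ suc n - u ^ suc n)
  poly-^-translate a zero = poly-cong (λ u → sym (begin
    (u + ι a) * 1# - u * 1#  ≈⟨ +-cong (*-identityʳ _) (-‿cong (*-identityʳ u)) ⟩
    u + ι a - u              ≈⟨ +-congʳ (+-comm u (ι a)) ⟩
    ι a + u - u              ≈⟨ +-assoc _ _ _ ⟩
    ι a + (u - u)            ≈⟨ +-congˡ (-‿inverseʳ u) ⟩
    ι a + 0#                 ≈⟨ +-identityʳ _ ⟩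
    ι a                      ∎)) (poly-const a)
  poly-^-translate a (suc n) = poly-cong (λ u → step u (ι a) _ _)
    (poly-+ (poly-* (poly-+ poly-id (poly-const a)) (poly-^-translate a n))
      (poly-scale a (poly-≤ (ℕₚ.≤-reflexive (ℕₚ.*-identityʳ (suc n))) (poly-^ (suc n) poly-id))))
    where
    step : ∀ u a x y → (u + a) * (x - y) + a * y ≈ (u + a) * x - u * y
    step u a x y = begin
      (u + a) * (x - y) + a * y
        ≈⟨ solve 5 (λ u a x y z → (u :+ a) :* (x :+ z) :+ a :* y := (u :+ a) :* x :+ u :* z :+ a :* (y :+ z)) refl u a x y (- y) ⟩
      (u + a) * x + u * - y + a * (y - y)
        ≈⟨ +-cong (+-congˡ (sym (-‿distribʳ-* u y))) (trans (*-congˡ (-‿inverseʳ y)) (zeroʳ a)) ⟩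
      (u + a) * x - u * y + 0#
        ≈⟨ +-identityʳ _ ⟩
      (u + a) * x - u * y ∎

  fromRoots : List K.Carrier → Carrier → Carrier
  fromRoots []       u = 1#
  fromRoots (a ∷ as) u = (u - ι a) * fromRoots as u

  poly-fromRoots : ∀ as → Poly (length as) (fromRoots as)
  poly-fromRoots []       = poly-1
  poly-fromRoots (a ∷ as) = poly-* (poly-linear a) (poly-fromRoots as)

  -- Σⱼ (rⱼ(u) + sⱼ(u) g) vʲ
  form : ∀ {J A} → (r s : Fin J → Fin A → K.Carrier) → (u g v : Carrier) → Carrier
  form {zero}  r s u g v = 0#
  form {suc J} r s u g v = (ev (r zero) u + ev (s zero) u * g) + v * form (r ∘ suc) (s ∘ suc) u g v

  form-- : ∀ {J A} (r s r′ s′ : Fin J → Fin A → K.Carrier) u g v →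
    form (λ j i → r j i K.- r′ j i) (λ j i → s j i K.- s′ j i) u g v ≈ form r s u g v - form r′ s′ u g v
  form-- {zero}  r s r′ s′ u g v = sym (-‿inverseʳ 0#)
  form-- {suc J} r s r′ s′ u g v = begin
    _ ≈⟨ +-cong (+-cong (ev-- (r zero) (r′ zero)) (*-congʳ (ev-- (s zero) (s′ zero)))) (*-congˡ (form-- (r ∘ suc) (s ∘ suc) (r′ ∘ suc) (s′ ∘ suc) u g v)) ⟩
    _ ≈⟨ solve 8 (λ a a′ b b′ g v f f′ → (a :+ a′) :+ (b :+ b′) :* g :+ v :* (f :+ f′)
           := ((a :+ b :* g) :+ v :* f) :+ ((a′ :+ b′ :* g) :+ v :* f′)) refl _ _ _ _ g v _ _ ⟩
    _ ≈⟨ +-congˡ (trans (sym (+-cong (trans (sym (-‿+-comm _ _)) (+-congˡ (-‿distribˡ-* _ _))) (-‿distribʳ-* _ _))) (-‿+-comm _ _)) ⟩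
    _ ∎
    where
    ev-- : ∀ {n} (c d : Fin n → K.Carrier) → ev (λ i → c i K.- d i) u ≈ ev c u - ev d u
    ev-- c d = trans (ev-+ c (λ i → K.- d i) u) (+-congˡ (ev-neg d u))

  poly-form : ∀ {J A m e} (r s : Fin J → Fin A → K.Carrier) {g v} → Poly e g → Poly m v →
    Poly (J ℕ.* m ℕ.+ (A ℕ.+ e)) (λ u → form r s u (g u) (v u))
  poly-form {zero}  r s pg pv = poly-0
  poly-form {suc J} {A} {m} {e} r s pg pv = poly-+
    (poly-≤ (ℕₚ.m≤n+m (A ℕ.+ e) (m ℕ.+ J ℕ.* m))
      (poly-+ (poly-≤ (ℕₚ.m≤m+n A e) (poly-ev (r zero))) (poly-* (poly-ev (s zero)) pg)))
    (poly-≤ (ℕₚ.≤-reflexive (≡.sym (ℕₚ.+-assoc m (J ℕ.* m) (A ℕ.+ e))))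
      (poly-* pv (poly-form (r ∘ suc) (s ∘ suc) pg pv)))

  -- For g = f^((q-1)/2) the term `f * (g * g)` is f^q, so multiplying r + s g by f (r - s g)
  -- replaces g by a power that Frobenius can reduce.
  difference-of-squares : ∀ r s f g → r * r * f - f * (g * g) * (s * s) ≈ (r + s * g) * (f * (r - s * g))
  difference-of-squares r s f g = sym (begin
    (r + s * g) * (f * (r - s * g))
      ≈⟨ solve 4 (λ r f y m → (r :+ y) :* (f :* (r :+ m)) := r :* r :* f :+ y :* f :* m :+ r :* f :* (y :+ m)) refl r f (s * g) (- (s * g)) ⟩
    r * r * f + s * g * f * - (s * g) + r * f * (s * g - s * g)
      ≈⟨ +-cong (+-congˡ (sym (-‿distribʳ-* _ _))) (trans (*-congˡ (-‿inverseʳ _)) (zeroʳ _)) ⟩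
    r * r * f - s * g * f * (s * g) + 0#
      ≈⟨ +-identityʳ _ ⟩
    r * r * f - s * g * f * (s * g)
      ≈⟨ +-congˡ (-‿cong (solve 3 (λ s g f → s :* g :* f :* (s :* g) := f :* (g :* g) :* (s :* s)) refl s g f)) ⟩
    r * r * f - f * (g * g) * (s * s) ∎)

open ≡ using (_≡_; _≢_; refl)

module RingTheory {c ℓ} (R : CommutativeRing c ℓ) where
  open CommutativeRing R public
  open import Algebra.Properties.CommutativeSemiring.Exp commutativeSemiring public
  open import Algebra.Properties.Ring ring public

-- Polynomials over the finite field and their zeros with multiplicity.

module Field {q} (F : FiniteField q) where
  open FiniteField F using (0≢1; inverse)

  𝔽 : CommutativeRing 0ℓ 0ℓ
  𝔽 = record { isCommutativeRing = FiniteField.isCommutativeRing F }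

  open RingTheory 𝔽 hiding (zero; refl; sym; trans) public
  open PowerSeries 𝔽 public
  open import Algebra.Solver.Ring.NaturalCoefficients.Default commutativeSemiring using (solve; _:=_; _:+_; _:*_)

  module 𝕊 = RingTheory seriesRing

  const-+ : ∀ a b → const (a + b) ≋ const a ⊕ const b
  const-+ a b zero    = refl
  const-+ a b (suc k) = ≡.sym (+-identityˡ 0#)

  const-neg : ∀ a → const (- a) ≋ ⊖ const a
  const-neg a zero    = refl
  const-neg a (suc k) = ≡.sym -0#≈0#

  const-* : ∀ a b → const (a * b) ≋ const a ⊛ const b
  const-* a b zero    = refl
  const-* a b (suc k) = ≡.sym (≡.trans (const-⊛ a (const b) (suc k)) (zeroʳ a))

  const-isRingHomomorphism : IsRingHomomorphism rawRing (CommutativeRing.rawRing seriesRing) const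
  const-isRingHomomorphism = record
    { isSemiringHomomorphism = record
      { isNearSemiringHomomorphism = record
        { +-isMonoidHomomorphism = record
          { isMagmaHomomorphism = record
            { isRelHomomorphism = record { cong = λ { refl _ → refl } }
            ; homo = const-+ }
          ; ε-homo = const-0 }
        ; *-homo = const-* }
      ; 1#-homo = λ _ → refl }
    ; -‿homo = const-neg }

  const-^ : ∀ a n → const (a ^ n) ≋ const a 𝕊.^ n
  const-^ a zero    k = refl
  const-^ a (suc n) k = ≡.trans (const-* a (a ^ n) k) (⊛-cong (λ _ → refl) (const-^ a n) k)

  -- A function on the finite field does not determine its polynomial. `P` evaluates at power
  -- series, where the argument `Z` recovers all coefficients; `Q` evaluates in the field and only
  -- serves to bound degrees in x.
  module P = Polynomial 𝔽 seriesRing const const-isRingHomomorphism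
  module Q = Polynomial 𝔽 𝔽 id (Identity.isRingHomomorphism rawRing refl)

  *-cancelˡ-0 : ∀ {x y} → x ≢ 0# → x * y ≡ 0# → y ≡ 0#
  *-cancelˡ-0 {x} {y} x≢0 xy≡0 = let (z , xz≡1) = inverse x x≢0 in begin
    y            ≡⟨ *-identityˡ y ⟨
    1# * y       ≡⟨ ≡.cong (_* y) xz≡1 ⟨
    x * z * y    ≡⟨ solve 3 (λ x y z → x :* z :* y := z :* (x :* y)) refl x y z ⟩
    z * (x * y)  ≡⟨ ≡.cong (z *_) xy≡0 ⟩
    z * 0#       ≡⟨ zeroʳ z ⟩
    0#           ∎
    where open ≡.≡-Reasoning

  *-≢0 : ∀ {x y} → x ≢ 0# → y ≢ 0# → x * y ≢ 0#
  *-≢0 x≢0 y≢0 xy≡0 = y≢0 (*-cancelˡ-0 x≢0 xy≡0)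

  square≡0 : ∀ {x} → x * x ≡ 0# → x ≡ 0#
  square≡0 {x} xx≡0 with x ≟ 0#
  ... | yes x≡0 = x≡0
  ... | no  x≢0 = *-cancelˡ-0 x≢0 xx≡0

  x-y≡0⇒x≡y : ∀ x y → x - y ≡ 0# → x ≡ y
  x-y≡0⇒x≡y x y p = begin
    x              ≡⟨ +-identityʳ x ⟨
    x + 0#         ≡⟨ ≡.cong (x +_) (-‿inverseˡ y) ⟨
    x + (- y + y)  ≡⟨ +-assoc _ _ _ ⟨
    x - y + y      ≡⟨ ≡.cong (_+ y) p ⟩
    0# + y         ≡⟨ +-identityˡ y ⟩
    y              ∎
    where open ≡.≡-Reasoning

  -≢0 : ∀ {x y} → x ≢ y → x - y ≢ 0#
  -≢0 x≢y x-y≡0 = x≢y (x-y≡0⇒x≡y _ _ x-y≡0)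

  line-- : ∀ a b x → line a b 𝕊.- const x ≋ line (a - x) b
  line-- a b x k = begin
    const a k + (const b ⊛ Z) k - const x k       ≡⟨ xy∙z≈xz∙y _ _ _ ⟩
    const a k - const x k + (const b ⊛ Z) k       ≡⟨ ≡.cong (λ e → const a k + e + (const b ⊛ Z) k) (const-neg x k) ⟨
    const a k + const (- x) k + (const b ⊛ Z) k   ≡⟨ ≡.cong (_+ (const b ⊛ Z) k) (const-+ a (- x) k) ⟨
    line (a - x) b k                              ∎
    where
    open ≡.≡-Reasoning
    open import Algebra.Properties.CommutativeSemigroup +-commutativeSemigroup using (xy∙z≈xz∙y)

  0ₛ : Series
  0ₛ _ = 0#

  ev-Z-0 : ∀ {n} (c : Fin (suc n) → Fin q) → P.ev c Z 0 ≡ c zero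
  ev-Z-0 c = ≡.trans (≡.cong (c zero +_) (zeroˡ _)) (+-identityʳ _)

  ev-Z-suc : ∀ {n} (c : Fin (suc n) → Fin q) k → P.ev c Z (suc k) ≡ P.ev (c ∘ suc) Z k
  ev-Z-suc c k = ≡.trans (+-identityˡ _) (Z-⊛-suc _ k)

  coefficients-0 : ∀ {n} (c : Fin n → Fin q) → P.ev c Z ≋[ n ] 0ₛ → ∀ i → c i ≡ 0#
  coefficients-0 c z zero    = ≡.trans (≡.sym (ev-Z-0 c)) (z 0 (s≤s z≤n))
  coefficients-0 c z (suc i) =
    coefficients-0 (c ∘ suc) (λ k k<n → ≡.trans (≡.sym (ev-Z-suc c k)) (z (suc k) (s≤s k<n))) i

  -- `Z` is a generic point: the coefficients of the series φ(Z) are those of the polynomial, so n +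
  -- 1 zeros among them leave nothing.
  poly-vanish : ∀ {n φ} → P.Poly n φ → φ Z ≋[ suc n ] 0ₛ → ∀ u → φ u ≋ 0ₛ
  poly-vanish (c , p) z u k = ≡.trans (p u k)
    (P.ev-0 (coefficients-0 c λ i i≤n → ≡.trans (≡.sym (p Z i)) (z i i≤n)) u k)

  ev-head : ∀ {n} (c : Fin n → Fin q) {u v} → u 0 ≡ v 0 → P.ev c u 0 ≡ P.ev c v 0
  ev-head {zero}  c u₀≡v₀ = refl
  ev-head {suc n} c u₀≡v₀ = ≡.cong (c zero +_) (≡.cong₂ _*_ u₀≡v₀ (ev-head (c ∘ suc) u₀≡v₀))

  line-head : ∀ a b → line a b 0 ≡ a
  line-head a b = ≡.trans (≡.cong (a +_) (zeroʳ b)) (+-identityʳ a)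

  cancel-unit : ∀ {m a b g} → a ≢ 0# → line a b ⊛ g ≋[ m ] 0ₛ → g ≋[ m ] 0ₛ
  cancel-unit {a = a} {b} {g} a≢0 z zero k<m = *-cancelˡ-0 a≢0 (≡.trans (≡.sym (line-⊛-zero a b g)) (z 0 k<m))
  cancel-unit {a = a} {b} {g} a≢0 z (suc k) k<m = *-cancelˡ-0 a≢0 (begin
    a * g (suc k)            ≡⟨ +-identityʳ _ ⟨
    a * g (suc k) + 0#       ≡⟨ ≡.cong (a * g (suc k) +_) (zeroʳ b) ⟨
    a * g (suc k) + b * 0#   ≡⟨ ≡.cong (λ e → a * g (suc k) + b * e) (cancel-unit a≢0 z k (ℕₚ.<⇒≤ k<m)) ⟨
    a * g (suc k) + b * g k  ≡⟨ line-⊛-suc a b g k ⟨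
    (line a b ⊛ g) (suc k)   ≡⟨ z (suc k) k<m ⟩
    0#                       ∎)
    where open ≡.≡-Reasoning

  -- The factor is Z times a unit, so exactly one order of vanishing is lost.
  cancel-Z : ∀ {m b g} → b ≢ 0# → line 0# b ⊛ g ≋[ suc m ] 0ₛ → g ≋[ m ] 0ₛ
  cancel-Z {b = b} {g} b≢0 z k k<m = *-cancelˡ-0 b≢0 (begin
    b * g k                   ≡⟨ +-identityˡ _ ⟨
    0# + b * g k              ≡⟨ ≡.cong (_+ b * g k) (zeroˡ _) ⟨
    0# * g (suc k) + b * g k  ≡⟨ line-⊛-suc 0# b g k ⟨
    (line 0# b ⊛ g) (suc k)   ≡⟨ z (suc k) (s≤s k<m) ⟩
    0#                        ∎)
    where open ≡.≡-Reasoning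

  -- The points are approached along lines x + (slope x) Z, and the multiplicity of a zero is the order of vanishing in Z.
  module _ (slope : Fin q → Fin q) where

    Vanishes : ∀ {n} → ℕ → (Fin n → Fin q) → Fin q → Set
    Vanishes m c x = P.ev c (line x (slope x)) ≋[ m ] 0ₛ

    -- Linear factors are divided out one at a time until no coefficient is left. `m` is the order
    -- still to be removed at the current point and `M` the order at each later one. A nonzero slope
    -- makes X - x equal to Z times a unit on the line through x, while X - x is a unit on the lines
    -- through the other points.
    multiplicities : ∀ {n} (c : Fin n → Fin q) m M x xs → slope x ≢ 0# → All (λ y → slope y ≢ 0#) xs →
      Unique (x ∷ xs) → Vanishes m c x → All (Vanishes M c) xs → n ℕ.≤ m ℕ.+ length xs ℕ.* M →
      ∀ u → P.ev c u ≋ 0ₛ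
    multiplicities {zero}  c m M x xs sx sxs un v vs n≤ u k = refl
    multiplicities {suc n} c zero M x (y ∷ xs) sx (sy ∷ sxs) (_ ∷ un) v (w ∷ vs) n≤ =
      multiplicities c M M y xs sy sxs un w vs n≤
    multiplicities {suc n} c (suc m) M x xs sx sxs (x∉ ∷ un) v vs (s≤s n≤) u k = ≡.trans (c≋ u k)
      (≡.trans (⊛-cong {f = u 𝕊.- const x} (λ _ → refl) zero-d k) (𝕊.zeroʳ (u 𝕊.- const x) k))
      where
      d = proj₁ (P.divide x c)
      ρ = proj₁ (proj₂ (P.divide x c))
      eq = proj₂ (proj₂ (P.divide x c))
      x-x : ∀ {b g} → (line x b 𝕊.- const x) ⊛ g ≋ line 0# b ⊛ g
      x-x {b} {g} = ⊛-cong (λ k → ≡.trans (line-- x b x k) (≡.cong (λ a → line a b k) (-‿inverseʳ x))) (λ _ → refl)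
      ρ≡0 : ρ ≡ 0#
      ρ≡0 = begin
        ρ                                              ≡⟨ +-identityˡ ρ ⟨
        0# + ρ                                         ≡⟨ ≡.cong (_+ ρ) (zeroˡ _) ⟨
        0# * P.ev d ℓ 0 + ρ                            ≡⟨ ≡.cong (_+ ρ) (line-⊛-zero 0# (slope x) (P.ev d ℓ)) ⟨
        (line 0# (slope x) ⊛ P.ev d ℓ) 0 + ρ           ≡⟨ ≡.cong (_+ ρ) (x-x {slope x} {P.ev d ℓ} 0) ⟨
        ((ℓ 𝕊.- const x) ⊛ P.ev d ℓ) 0 + ρ             ≡⟨ eq ℓ 0 ⟨
        P.ev c ℓ 0                                     ≡⟨ v 0 (s≤s z≤n) ⟩
        0#                                             ∎
        where
        open ≡.≡-Reasoning
        ℓ = line x (slope x)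
      c≋ : ∀ u → P.ev c u ≋ (u 𝕊.- const x) ⊛ P.ev d u
      c≋ u k = ≡.trans (eq u k) (≡.trans (≡.cong (((u 𝕊.- const x) ⊛ P.ev d u) k +_)
        (≡.trans (≡.cong (λ a → const a k) ρ≡0) (const-0 k))) (+-identityʳ _))
      v′ : Vanishes m d x
      v′ = cancel-Z sx λ k k<m →
        ≡.trans (≡.sym (≡.trans (c≋ _ k) (x-x {slope x} {P.ev d (line x (slope x))} k))) (v k k<m)
      step : ∀ {y} → x ≢ y → Vanishes M c y → Vanishes M d y
      step {y} x≢y w = cancel-unit (-≢0 (x≢y ∘ ≡.sym)) λ k k<M →
        ≡.trans (≡.sym (≡.trans (c≋ (line y (slope y)) k) (⊛-cong (line-- y (slope y) x) (λ _ → refl) k))) (w k k<M)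
      zero-d : P.ev d u ≋ 0ₛ
      zero-d = multiplicities d m M x xs sx sxs (x∉ ∷ un) v′
        (All.zipWith (λ (x≢y , w) → step x≢y w) (x∉ , vs)) n≤ u

  poly-roots : ∀ {n φ} → P.Poly n φ → ∀ xs → Unique xs → n ℕ.< length xs →
    All (λ x → φ (const x) 0 ≡ 0#) xs → ∀ u → φ u ≋ 0ₛ
  poly-roots {n} {φ} (c , p) (x ∷ xs) un n< zs u k = ≡.trans (p u k)
    (multiplicities (λ _ → 1#) c 1 1 x xs 1≢0 (All.universal (λ _ → 1≢0) xs) un (v (All.head zs)) (All.map v (All.tail zs))
      (ℕₚ.≤-trans n< (ℕₚ.≤-reflexive (≡.cong suc (≡.sym (ℕₚ.*-identityʳ _))))) u k)
    where
    1≢0 : 1# ≢ 0#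
    1≢0 = 0≢1 ∘ ≡.sym
    v : ∀ {x} → φ (const x) 0 ≡ 0# → Vanishes (λ _ → 1#) 1 c x
    v {x} z zero _ = ≡.trans (ev-head c (line-head x 1#)) (≡.trans (≡.sym (p (const x) 0)) z)
    v z (suc k) (s≤s ())

module _ {c ℓ} (M : CommutativeMonoid c ℓ) where
  open CommutativeMonoid M hiding (refl)
  open import Algebra.Properties.CommutativeMonoid.Sum M

  sum-concentrated : ∀ {n} (i : Fin n) f → (∀ j → j ≢ i → f j ≈ ε) → sum f ≈ f i
  sum-concentrated {suc n} zero f f≈ε =
    trans (∙-congˡ (trans (sum-cong-≋ (λ j → f≈ε (suc j) λ ())) (sum-replicate-zero n))) (identityʳ _)
  sum-concentrated {suc n} (suc i) f f≈ε =
    trans (∙-cong (f≈ε zero λ ()) (sum-concentrated i (f ∘ suc) λ j j≢i → f≈ε (suc j) λ { refl → j≢i refl })) (identityˡ _)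

-- Fermat's theorem, Frobenius and powers detecting squares.

module Fermat {q} (F : FiniteField q) where
  open Field F
  open FiniteField F using (0≢1; inverse)
  open import Algebra.Properties.CommutativeMonoid.Sum *-commutativeMonoid
    using () renaming (sum to ∏; sum-permute to ∏-permute; ∑-distrib-+ to ∏-distrib; sum-cong-≗ to ∏-cong; sum-replicate to ∏-replicate)
  open import Algebra.Solver.Ring.NaturalCoefficients.Default commutativeSemiring using (solve; _:=_; _:+_; _:*_)

  *-cancelʳ-≢0 : ∀ {x y z} → z ≢ 0# → x * z ≡ y * z → x ≡ y
  *-cancelʳ-≢0 {x} {y} {z} z≢0 eq with x ≟ y
  ... | yes x≡y = x≡y
  ... | no  x≢y = contradiction (*-cancelˡ-0 (-≢0 x≢y) (≡.trans ([y-z]x≈yx-zx z x y)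
        (≡.trans (≡.cong (_- y * z) eq) (-‿inverseʳ _)))) z≢0

  ∏-≢0 : ∀ {n} (f : Fin n → Fin q) → (∀ i → f i ≢ 0#) → ∏ f ≢ 0#
  ∏-≢0 {zero}  f f≢0 = 0≢1 ∘ ≡.sym
  ∏-≢0 {suc n} f f≢0 = *-≢0 (f≢0 zero) (∏-≢0 (f ∘ suc) (f≢0 ∘ suc))

  private
    at0 : Fin q → Fin q → Fin q → Fin q
    at0 a b x with x ≟ 0#
    ... | yes _ = a
    ... | no  _ = b

    at0-zero : ∀ {a b x} → x ≡ 0# → at0 a b x ≡ a
    at0-zero {x = x} x≡0 with x ≟ 0#
    ... | yes _ = refl
    ... | no x≢0 = contradiction x≡0 x≢0

    at0-nonzero : ∀ {a b x} → x ≢ 0# → at0 a b x ≡ b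
    at0-nonzero {x = x} x≢0 with x ≟ 0#
    ... | yes x≡0 = contradiction x≡0 x≢0
    ... | no _ = refl

  -- Multiplication by x permutes the nonzero elements, so x to their number is 1; the remaining
  -- factor x belongs to the element 0. Since the products run over the whole field, `at0` replaces
  -- the factor at 0 by 1, which keeps them cancellable.
  fermat : ∀ x → x ^ q ≡ x
  fermat x with x ≟ 0#
  ... | yes refl = 0^ q refl
    where
    0^ : ∀ m → m ≡ q → 0# ^ m ≡ 0#
    -- An exponent 0 would give 1, but `Fin 0` cannot contain the element 0 of the field.
    0^ zero    refl with () ← 0#
    0^ (suc m) _    = zeroˡ _
  ... | no x≢0 = begin
      x ^ q                          ≡⟨ ∏-replicate q ⟨
      ∏ {q} (λ _ → x)                ≡⟨ ∏-cong hk ⟨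
      ∏ (λ b → at0 1# x b * at0 x 1# b) ≡⟨ ∏-distrib (at0 1# x) (at0 x 1#) ⟩
      ∏ (at0 1# x) * ∏ (at0 x 1#)    ≡⟨ ≡.cong₂ _*_ ∏h≡1 ∏k≡x ⟩
      1# * x                         ≡⟨ *-identityˡ x ⟩
      x                              ∎
    where
    open ≡.≡-Reasoning
    x⁻¹ = proj₁ (inverse x x≢0)
    g : Fin q → Fin q
    g b = at0 1# b b
    g≢0 : ∀ b → g b ≢ 0#
    g≢0 b with b ≟ 0#
    ... | yes _ = 0≢1 ∘ ≡.sym
    ... | no b≢0 = b≢0
    hk : ∀ b → at0 1# x b * at0 x 1# b ≡ x
    hk b with b ≟ 0#
    ... | yes _ = *-identityˡ x
    ... | no _ = *-identityʳ x
    g-* : ∀ b → g (x * b) ≡ at0 1# x b * g b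
    g-* b with b ≟ 0#
    ... | yes refl = ≡.trans (at0-zero (zeroʳ x)) (≡.sym (*-identityˡ 1#))
    ... | no b≢0 = at0-nonzero (*-≢0 x≢0 b≢0)
    π : Permutation q q
    π = permutation (x *_) (x⁻¹ *_)
      (λ b → ≡.trans (≡.sym (*-assoc _ _ _)) (≡.trans (≡.cong (_* b) (proj₂ (inverse x x≢0))) (*-identityˡ b)))
      (λ b → ≡.trans (≡.sym (*-assoc _ _ _)) (≡.trans (≡.cong (_* b) (≡.trans (*-comm x⁻¹ x) (proj₂ (inverse x x≢0)))) (*-identityˡ b)))
    ∏h≡1 : ∏ (at0 1# x) ≡ 1#
    ∏h≡1 = *-cancelʳ-≢0 (∏-≢0 g g≢0) (begin
      ∏ (at0 1# x) * ∏ g             ≡⟨ ∏-distrib (at0 1# x) g ⟨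
      ∏ (λ b → at0 1# x b * g b)     ≡⟨ ∏-cong g-* ⟨
      ∏ (λ b → g (x * b))            ≡⟨ ∏-permute g π ⟨
      ∏ g                            ≡⟨ *-identityˡ _ ⟨
      1# * ∏ g                       ∎)
    ∏k≡x : ∏ (at0 x 1#) ≡ x
    ∏k≡x = ≡.trans (sum-concentrated *-commutativeMonoid 0# (at0 x 1#) (λ j j≢0 → at0-nonzero j≢0)) (at0-zero refl)

  all-roots : ∀ {n φ} → P.Poly n φ → n ℕ.< q → (∀ x → φ (const x) 0 ≡ 0#) → ∀ u → φ u ≋ 0ₛ
  all-roots p n<q z = poly-roots p (allFin q) (Unique.allFin⁺ q)
    (ℕₚ.≤-trans n<q (ℕₚ.≤-reflexive (≡.sym (length-tabulate id)))) (All.universal z (allFin q))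

  head-^ : ∀ u n → (u 𝕊.^ n) 0 ≡ u 0 ^ n
  head-^ u zero    = refl
  head-^ u (suc n) = ≡.cong (u 0 *_) (head-^ u n)

  ^-vanish : ∀ {u} → u 0 ≡ 0# → ∀ n → u 𝕊.^ n ≋[ n ] 0ₛ
  ^-vanish {u} u₀≡0 (suc n) zero    _ = ≡.trans (≡.cong (_* (u 𝕊.^ n) 0) u₀≡0) (zeroˡ _)
  ^-vanish {u} u₀≡0 (suc n) (suc k) (s≤s k<n) = begin
    u 0 * (u 𝕊.^ n) (suc k) + (tail u ⊛ (u 𝕊.^ n)) k
      ≡⟨ ≡.cong₂ _+_ (≡.trans (≡.cong (_* (u 𝕊.^ n) (suc k)) u₀≡0) (zeroˡ _))
           (⊛-cong-mod {n} {tail u} (λ _ _ → refl) (^-vanish u₀≡0 n) k k<n) ⟩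
    0# + (tail u ⊛ 0ₛ) k  ≡⟨ +-identityˡ _ ⟩
    (tail u ⊛ 0ₛ) k       ≡⟨ 𝕊.zeroʳ (tail u) k ⟩
    0#                    ∎
    where open ≡.≡-Reasoning

  -- Here `suc n` is (q - 1) / 2.
  module _ (n : ℕ) (q≡ : q ≡ suc (suc n ℕ.+ suc n)) where

    -- (u + a)^q - u^q - a has degree below q and, by `fermat`, all q field elements as roots. So it
    -- is the zero polynomial and vanishes at every series.
    frobenius : ∀ a u → (const a ⊕ u) 𝕊.^ q ≋ const a ⊕ u 𝕊.^ q
    frobenius a u k = begin
      ((const a ⊕ u) 𝕊.^ q) k                  ≡⟨ 𝕊.^-congˡ q (𝕊.+-comm (const a) u) k ⟩
      ((u ⊕ const a) 𝕊.^ q) k                  ≡⟨ x-y≡z⇒x≡z+y _ _ _ (x-y≡0⇒x≡y _ _ (φ≋0 k)) ⟩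
      const a k + (u 𝕊.^ q) k                  ∎
      where
      open ≡.≡-Reasoning
      x-y≡z⇒x≡z+y : ∀ x y z → x - y ≡ z → x ≡ z + y
      x-y≡z⇒x≡z+y x y z refl = ≡.sym (≡.trans (+-assoc x (- y) y) (≡.trans (≡.cong (x +_) (-‿inverseˡ y)) (+-identityʳ x)))
      φ : Series → Series
      φ u = ((u ⊕ const a) 𝕊.^ q 𝕊.- u 𝕊.^ q) 𝕊.- const a
      φ-poly : P.Poly (suc n ℕ.+ suc n) φ
      φ-poly = P.poly-+ (≡.subst (λ m → P.Poly (suc n ℕ.+ suc n) (λ u → (u ⊕ const a) 𝕊.^ m 𝕊.- u 𝕊.^ m)) (≡.sym q≡)
        (P.poly-^-translate a (suc n ℕ.+ suc n))) (P.poly-neg (P.poly-const a))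
      root : ∀ b → φ (const b) 0 ≡ 0#
      root b = begin
        ((const b ⊕ const a) 𝕊.^ q) 0 - (const b 𝕊.^ q) 0 - a
          ≡⟨ ≡.cong₂ (λ x y → x - y - a) (≡.trans (head-^ (const b ⊕ const a) q) (fermat (b + a)))
               (≡.trans (head-^ (const b) q) (fermat b)) ⟩
        b + a - b - a   ≡⟨ ≡.cong (λ x → x - b - a) (+-comm b a) ⟩
        a + b - b - a   ≡⟨ ≡.cong (_- a) (≡.trans (+-assoc a b (- b)) (≡.trans (≡.cong (a +_) (-‿inverseʳ b)) (+-identityʳ a))) ⟩
        a - a           ≡⟨ -‿inverseʳ a ⟩
        0#              ∎
      φ≋0 : φ u ≋ 0ₛ
      φ≋0 = all-roots φ-poly (ℕₚ.≤-reflexive (≡.sym q≡)) root u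

    -- Modulo Z^q the q-th power of a point X = x + f(x) Z is the scalar x. This is what keeps the
    -- powers X^(jq) from contributing large degrees.
    line-^q : ∀ a b → line a b 𝕊.^ q ≋[ q ] const a
    line-^q a b k k<q = ≡.trans (frobenius a (const b ⊛ Z) k)
      (≡.trans (≡.cong (const a k +_) (^-vanish {const b ⊛ Z} (zeroʳ b) q k k<q)) (+-identityʳ _))

    ^-order : ∀ {x} → x ≢ 0# → x ^ (suc n ℕ.+ suc n) ≡ 1#
    ^-order {x} x≢0 = *-cancelʳ-≢0 x≢0 (begin
      x ^ (suc n ℕ.+ suc n) * x  ≡⟨ *-comm _ x ⟩
      x ^ suc (suc n ℕ.+ suc n)  ≡⟨ ≡.cong (x ^_) q≡ ⟨
      x ^ q                      ≡⟨ fermat x ⟩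
      x                          ≡⟨ *-identityˡ x ⟨
      1# * x                     ∎)
      where open ≡.≡-Reasoning

    ^-half : ∀ {x} → x ≢ 0# → x ^ suc n ≡ 1# ⊎ x ^ suc n ≡ - 1#
    ^-half {x} x≢0 with x ^ suc n ≟ 1#
    ... | yes eq = inj₁ eq
    ... | no neq = inj₂ (x-y≡0⇒x≡y _ _ (≡.trans (≡.cong (y +_) (-‿involutive 1#)) (*-cancelˡ-0 (-≢0 neq) (begin
      (y - 1#) * (y + 1#)          ≡⟨ solve 3 (λ y m i → (y :+ m) :* (y :+ i) := y :* y :+ y :* i :+ m :* y :+ m :* i) refl y (- 1#) 1# ⟩
      y * y + y * 1# + - 1# * y + - 1# * 1#  ≡⟨ ≡.cong₂ (λ a b → a + y * 1# + b + - 1# * 1#) yy≡1 (-1*x≈-x y) ⟩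
      1# + y * 1# + - y + - 1# * 1#  ≡⟨ ≡.cong₂ (λ a b → 1# + a + - y + b) (*-identityʳ y) (*-identityʳ (- 1#)) ⟩
      1# + y - y - 1#              ≡⟨ ≡.cong (_- 1#) (≡.trans (+-assoc 1# y (- y)) (≡.trans (≡.cong (1# +_) (-‿inverseʳ y)) (+-identityʳ 1#))) ⟩
      1# - 1#                      ≡⟨ -‿inverseʳ 1# ⟩
      0#                           ∎))))
      where
      open ≡.≡-Reasoning
      y = x ^ suc n
      yy≡1 : y * y ≡ 1#
      yy≡1 = ≡.trans (≡.sym (^-homo-* x (suc n) (suc n))) (^-order x≢0)

    -- If x ^ n = 1 for a nonsquare x, then u ^ n - 1 = (u - x) H(u) and u H(u²), of degree 2n - 1, vanishes on the whole field.
    nonsquare-^ : ∀ {x} → (∀ z → z * z ≢ x) → x ^ suc n ≢ 1#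
    -- The polynomial u H(u²) vanishes identically, in particular at u = Z, so H(Z²) has constant
    -- coefficient 0. But (Z² - x) H(Z²) = Z^(2n+2) - 1 has constant coefficient -1.
    nonsquare-^ {x} ns x^n≡1 = 0≢1 (≡.sym (x-y≡0⇒x≡y 1# 0# (begin
        1# - 0#          ≡⟨ ≡.cong (1# +_) -0#≈0# ⟩
        1# + 0#          ≡⟨ +-identityʳ 1# ⟩
        1#               ≡⟨ -‿involutive 1# ⟨
        - - 1#           ≡⟨ ≡.cong -_ (begin
          - 1#                          ≡⟨ +-identityˡ _ ⟨
          0# - 1#                       ≡⟨ ≡.cong (_- 1#) (≡.trans (≡.cong (_* ((Z ⊛ Z) 𝕊.^ n) 0) (zeroˡ 0#)) (zeroˡ _)) ⟨
          G (Z ⊛ Z) 0                   ≡⟨ G≋ (Z ⊛ Z) 0 ⟩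
          (Z ⊛ Z 𝕊.- const x) 0 * H (Z ⊛ Z) 0  ≡⟨ ≡.cong ((Z ⊛ Z 𝕊.- const x) 0 *_) (≡.trans (≡.sym (Z-⊛-suc (H (Z ⊛ Z)) 0)) (all-roots uH-poly uH-deg root Z 1)) ⟩
          (Z ⊛ Z 𝕊.- const x) 0 * 0#    ≡⟨ zeroʳ _ ⟩
          0#                            ∎) ⟩
        - 0#             ≡⟨ -0#≈0# ⟩
        0#               ∎)))
      where
      open ≡.≡-Reasoning
      G : Series → Series
      G u = u 𝕊.^ suc n 𝕊.- 𝕊.1#
      G-poly : P.Poly (suc n) G
      G-poly = P.poly-+ (P.poly-≤ (ℕₚ.≤-reflexive (ℕₚ.*-identityʳ (suc n))) (P.poly-^ (suc n) P.poly-id)) (P.poly-neg P.poly-1)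
      G-head : ∀ z → G (const z) 0 ≡ z ^ suc n - 1#
      G-head z = ≡.cong (_- 1#) (head-^ (const z) (suc n))
      division = P.divide x (proj₁ G-poly)
      H : Series → Series
      H = P.ev (proj₁ division)
      ρ = proj₁ (proj₂ division)
      G≡ : ∀ u → G u ≋ (u 𝕊.- const x) ⊛ H u ⊕ const ρ
      G≡ u k = ≡.trans (proj₂ G-poly u k) (proj₂ (proj₂ division) u k)
      ρ≡0 : ρ ≡ 0#
      ρ≡0 = begin
        ρ                                  ≡⟨ +-identityˡ ρ ⟨
        0# + ρ                             ≡⟨ ≡.cong (_+ ρ) (≡.trans (≡.cong (_* H (const x) 0) (-‿inverseʳ x)) (zeroˡ _)) ⟨
        (x - x) * H (const x) 0 + ρ        ≡⟨ G≡ (const x) 0 ⟨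
        G (const x) 0                      ≡⟨ G-head x ⟩
        x ^ suc n - 1#                     ≡⟨ ≡.cong (_- 1#) x^n≡1 ⟩
        1# - 1#                            ≡⟨ -‿inverseʳ 1# ⟩
        0#                                 ∎
      G≋ : ∀ u → G u ≋ (u 𝕊.- const x) ⊛ H u
      G≋ u k = ≡.trans (G≡ u k) (≡.trans (≡.cong (((u 𝕊.- const x) ⊛ H u) k +_)
        (≡.trans (≡.cong (λ a → const a k) ρ≡0) (const-0 k))) (+-identityʳ _))
      uH-poly : P.Poly (suc (n ℕ.* 2)) (λ u → u ⊛ H (u ⊛ u))
      uH-poly = P.poly-shift (P.poly-∘ (proj₁ division , λ u k → refl) (P.poly-* P.poly-id P.poly-id))
      uH-deg : suc (n ℕ.* 2) ℕ.< q
      uH-deg = ℕₚ.≤-trans (ℕₚ.≤-reflexive (≡.cong (λ m → suc (suc m)) (≡.trans (ℕₚ.*-comm n 2) (≡.cong (n ℕ.+_) (ℕₚ.+-identityʳ n)))))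
        (ℕₚ.≤-trans (s≤s (s≤s (ℕₚ.+-monoʳ-≤ n (ℕₚ.n≤1+n n)))) (ℕₚ.≤-reflexive (≡.sym q≡)))
      root : ∀ z → (const z ⊛ H (const z ⊛ const z)) 0 ≡ 0#
      root z with z ≟ 0#
      ... | yes refl = zeroˡ _
      ... | no z≢0 = ≡.trans (≡.cong (z *_) (≡.trans (ev-head (proj₁ division) refl)
              (*-cancelˡ-0 (-≢0 (ns z)) (≡.trans (≡.sym (G≋ (const (z * z)) 0)) (begin
                G (const (z * z)) 0     ≡⟨ G-head (z * z) ⟩
                (z * z) ^ suc n - 1#    ≡⟨ ≡.cong (_- 1#) (begin
                  (z * z) ^ suc n         ≡⟨ ^-distrib-* z z (suc n) ⟩
                  z ^ suc n * z ^ suc n   ≡⟨ ^-homo-* z (suc n) (suc n) ⟨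
                  z ^ (suc n ℕ.+ suc n)   ≡⟨ ^-order z≢0 ⟩
                  1#                      ∎) ⟩
                1# - 1#                 ≡⟨ -‿inverseʳ 1# ⟩
                0#                      ∎))))) (zeroʳ z)

-- The auxiliary polynomial is not identically zero.

module Nonvanishing {q} (F : FiniteField q) (n : ℕ) (q≡ : q ≡ suc (suc n ℕ.+ suc n)) where
  open Field F
  open Fermat F
  open import Algebra.Solver.Ring.NaturalCoefficients.Default 𝕊.commutativeSemiring
    using () renaming (solve to solveₛ; _:=_ to _:≋_; _:*_ to _:⊛_)

  mod-≤ : ∀ {l m f g} → l ℕ.≤ m → f ≋[ m ] g → f ≋[ l ] g
  mod-≤ l≤m p k k<l = p k (ℕₚ.<-≤-trans k<l l≤m)

  fromRoots-≢0 : ∀ {x as} → All (x ≢_) as → Q.fromRoots as x ≢ 0#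
  fromRoots-≢0 []        = FiniteField.0≢1 F ∘ ≡.sym
  fromRoots-≢0 (x≢ ∷ xs) = *-≢0 (-≢0 x≢) (fromRoots-≢0 xs)

  fromRoots-head : ∀ as u → P.fromRoots as u 0 ≡ Q.fromRoots as (u 0)
  fromRoots-head []       u = refl
  fromRoots-head (a ∷ as) u = ≡.cong ((u 0 - a) *_) (fromRoots-head as u)

  -- Each factor (Z - a)^q reduces to its constant term by `line-^q`.
  fromRoots-^q : ∀ as → P.fromRoots as Z 𝕊.^ q ≋[ q ] const (Q.fromRoots as 0#)
  fromRoots-^q [] k k<q = one-^ q k
    where
    one-^ : ∀ m → 𝕊.1# 𝕊.^ m ≋ 𝕊.1#
    one-^ zero    k = refl
    one-^ (suc m) k = ≡.trans (⊛-identityˡ (𝕊.1# 𝕊.^ m) k) (one-^ m k)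
  fromRoots-^q (a ∷ as) k k<q = begin
    (((Z 𝕊.- const a) ⊛ P.fromRoots as Z) 𝕊.^ q) k
      ≡⟨ 𝕊.^-distrib-* (Z 𝕊.- const a) (P.fromRoots as Z) q k ⟩
    ((Z 𝕊.- const a) 𝕊.^ q ⊛ P.fromRoots as Z 𝕊.^ q) k
      ≡⟨ ⊛-cong-mod (λ i i<q → ≡.trans (𝕊.^-congˡ q Z-a i) (line-^q n q≡ (0# - a) 1# i i<q)) (fromRoots-^q as) k k<q ⟩
    (const (0# - a) ⊛ const (Q.fromRoots as 0#)) k
      ≡⟨ const-* (0# - a) (Q.fromRoots as 0#) k ⟨
    const (Q.fromRoots (a ∷ as) 0#) k ∎
    where
    open ≡.≡-Reasoning
    Z-a : Z 𝕊.- const a ≋ line (0# - a) 1#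
    Z-a k = ≡.trans (≡.cong (_- const a k) (≡.sym (≡.trans (≡.cong₂ _+_ (const-0 k) (⊛-identityˡ Z k)) (+-identityˡ (Z k)))))
                    (line-- 0# 1# a k)

  Z-cancel : ∀ {f g} → Z ⊛ f ≋ Z ⊛ g → f ≋ g
  Z-cancel {f} {g} p k = ≡.trans (≡.sym (Z-⊛-suc f k)) (≡.trans (p (suc k)) (Z-⊛-suc g k))

  Z-factor : ∀ {f} → f 0 ≡ 0# → f ≋ Z ⊛ tail f
  Z-factor {f} f₀≡0 zero    = ≡.trans f₀≡0 (≡.sym (zeroˡ (f 1)))
  Z-factor {f} f₀≡0 (suc k) = ≡.sym (Z-⊛-suc (tail f) k)

  -- The order of vanishing is odd on the left and even on the right, so both sides are zero.
  odd-valuation : ∀ {e h} → e ≢ 0# → h 0 ≢ 0# → ∀ {r s} → r ⊛ r ⊛ (Z ⊛ h) ≋ const e ⊛ (s ⊛ s) →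
    ∀ k → r k ≡ 0# × s k ≡ 0#
  odd-valuation {e} {h} e≢0 h₀≢0 {r} {s} eq = result
    where
    open import Relation.Binary.Reasoning.Setoid 𝕊.setoid
    s₀≡0 : s 0 ≡ 0#
    s₀≡0 = square≡0 (*-cancelˡ-0 e≢0 (≡.trans (≡.sym (eq 0)) (≡.trans (≡.cong ((r ⊛ r) 0 *_) (zeroˡ (h 0))) (zeroʳ _))))
    eq₁ : r ⊛ r ⊛ h ≋ Z ⊛ (const e ⊛ (tail s ⊛ tail s))
    eq₁ = Z-cancel (begin
      Z ⊛ (r ⊛ r ⊛ h)                             ≈⟨ solveₛ 3 (λ r z h → z :⊛ (r :⊛ r :⊛ h) :≋ r :⊛ r :⊛ (z :⊛ h)) 𝕊.refl r Z h ⟩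
      r ⊛ r ⊛ (Z ⊛ h)                             ≈⟨ eq ⟩
      const e ⊛ (s ⊛ s)                           ≈⟨ 𝕊.*-congˡ {const e} (⊛-cong (Z-factor {s} s₀≡0) (Z-factor {s} s₀≡0)) ⟩
      const e ⊛ ((Z ⊛ tail s) ⊛ (Z ⊛ tail s))     ≈⟨ solveₛ 3 (λ e z s → e :⊛ ((z :⊛ s) :⊛ (z :⊛ s)) :≋ z :⊛ (z :⊛ (e :⊛ (s :⊛ s)))) 𝕊.refl (const e) Z (tail s) ⟩
      Z ⊛ (Z ⊛ (const e ⊛ (tail s ⊛ tail s)))     ∎)
    r₀≡0 : r 0 ≡ 0#
    r₀≡0 = square≡0 (*-cancelˡ-0 h₀≢0 (≡.trans (*-comm _ _) (≡.trans (eq₁ 0) (zeroˡ _))))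
    eq₂ : tail r ⊛ tail r ⊛ (Z ⊛ h) ≋ const e ⊛ (tail s ⊛ tail s)
    eq₂ = Z-cancel (begin
      Z ⊛ (tail r ⊛ tail r ⊛ (Z ⊛ h))             ≈⟨ solveₛ 3 (λ r z h → z :⊛ (r :⊛ r :⊛ (z :⊛ h)) :≋ (z :⊛ r) :⊛ (z :⊛ r) :⊛ h) 𝕊.refl (tail r) Z h ⟩
      (Z ⊛ tail r) ⊛ (Z ⊛ tail r) ⊛ h             ≈⟨ 𝕊.*-congʳ {h} (⊛-cong (Z-factor {r} r₀≡0) (Z-factor {r} r₀≡0)) ⟨
      r ⊛ r ⊛ h                                   ≈⟨ eq₁ ⟩
      Z ⊛ (const e ⊛ (tail s ⊛ tail s))           ∎)
    result : ∀ k → r k ≡ 0# × s k ≡ 0#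
    result zero    = r₀≡0 , s₀≡0
    result (suc k) = odd-valuation e≢0 h₀≢0 {tail r} {tail s} eq₂ k

  -- Substituting Z - a undoes the translation and returns to the generic point, where the
  -- coefficients can be read off.
  ev-translate-0 : ∀ {A} a (c : Fin A → Fin q) → P.ev c (Z ⊕ const a) ≋ 0ₛ → ∀ i → c i ≡ 0#
  ev-translate-0 a c z = coefficients-0 c λ k _ →
    ≡.trans (P.ev-congʳ c Z≋ k) (poly-vanish (P.poly-translate a c) (λ k _ → z k) (Z 𝕊.- const a) k)
    where
    Z≋ : Z ≋ Z 𝕊.- const a ⊕ const a
    Z≋ k = ≡.sym (≡.trans (+-assoc _ _ _) (≡.trans (≡.cong (Z k +_) (-‿inverseˡ (const a k))) (+-identityʳ _)))

  module _ (a₀ : Fin q) (as : List (Fin q)) (roots≢0 : All (0# ≢_) (a₀ ∷ as)) (a₀∉as : All (a₀ ≢_) as)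
           {A} (2A+d<q : A ℕ.+ A ℕ.+ length (a₀ ∷ as) ℕ.< q) where

    f g : Series → Series
    f = P.fromRoots (a₀ ∷ as)
    g u = f u 𝕊.^ suc n

    -- r = − s g mod Z^q gives r² f = f(0) s² mod Z^q by Frobenius, hence exactly by comparing degrees.
    independent-mod : (r s : Fin A → Fin q) → P.ev r Z ⊕ P.ev s Z ⊛ g Z ≋[ q ] 0ₛ →
      (∀ i → r i ≡ 0#) × (∀ i → s i ≡ 0#)
    independent-mod r s r+sg≋0 =
        ev-translate-0 a₀ r (λ k → proj₁ (rs≋0 k)) , ev-translate-0 a₀ s (λ k → proj₂ (rs≋0 k))
      where
      open import Relation.Binary.Reasoning.Setoid 𝕊.setoid
      e = Q.fromRoots (a₀ ∷ as) 0#
      φ : Series → Series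
      φ u = P.ev r u ⊛ P.ev r u ⊛ f u 𝕊.- const e ⊛ (P.ev s u ⊛ P.ev s u)
      φ-poly : P.Poly (A ℕ.+ A ℕ.+ length (a₀ ∷ as)) φ
      φ-poly = P.poly-+ (P.poly-* (P.poly-* (P.poly-ev r) (P.poly-ev r)) (P.poly-fromRoots (a₀ ∷ as)))
        (P.poly-neg (P.poly-≤ (ℕₚ.m≤m+n _ _) (P.poly-scale e (P.poly-* (P.poly-ev s) (P.poly-ev s)))))
      fgg≋e : f Z ⊛ (g Z ⊛ g Z) ≋[ q ] const e
      fgg≋e k k<q = ≡.trans (≡.sym (⊛-cong {f Z} (λ _ → refl) (𝕊.^-homo-* (f Z) (suc n) (suc n)) k))
        (≡.trans (≡.cong (λ m → (f Z 𝕊.^ m) k) (≡.sym q≡)) (fromRoots-^q (a₀ ∷ as) k k<q))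
      φZ≋0 : φ Z ≋[ q ] 0ₛ
      φZ≋0 k k<q = ≡.trans (≡.cong (λ x → (R ⊛ R ⊛ f Z) k - x)
          (≡.sym (⊛-cong-mod {q} {f Z ⊛ (g Z ⊛ g Z)} fgg≋e (λ _ _ → refl) k k<q)))
        (≡.trans (P.difference-of-squares R S (f Z) (g Z) k)
        (≡.trans (⊛-cong-mod {q} {R ⊕ S ⊛ g Z} r+sg≋0 (λ _ _ → refl) k k<q) (⊛-zeroˡ (f Z ⊛ (R 𝕊.- S ⊛ g Z)) k)))
        where
        R = P.ev r Z
        S = P.ev s Z
      -- Expansion about the root a₀: there f = Z h, and h(0) is nonzero because a₀ is not among the
      -- other roots. This supplies the odd order of vanishing.
      u₀ : Series
      u₀ = Z ⊕ const a₀
      u₀-a₀ : u₀ 𝕊.- const a₀ ≋ Z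
      u₀-a₀ k = ≡.trans (+-assoc _ _ _) (≡.trans (≡.cong (Z k +_) (-‿inverseʳ (const a₀ k))) (+-identityʳ _))
      rs≋0 : ∀ k → P.ev r u₀ k ≡ 0# × P.ev s u₀ k ≡ 0#
      rs≋0 = odd-valuation {e} {P.fromRoots as u₀} (fromRoots-≢0 roots≢0)
        (λ z → fromRoots-≢0 a₀∉as (≡.trans (≡.sym (≡.trans (fromRoots-head as u₀) (≡.cong (Q.fromRoots as) (+-identityˡ a₀)))) z))
        (λ k → ≡.trans (⊛-cong {P.ev r u₀ ⊛ P.ev r u₀} (λ _ → refl) (⊛-cong {g = P.fromRoots as u₀} (𝕊.sym u₀-a₀) (λ _ → refl)) k)
          (x-y≡0⇒x≡y _ _ (poly-vanish φ-poly (mod-≤ 2A+d<q φZ≋0) u₀ k)))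

    Z^-cancel : ∀ m {h} → Z 𝕊.^ m ⊛ h ≋ 0ₛ → h ≋ 0ₛ
    Z^-cancel zero    {h} z k = ≡.trans (≡.sym (⊛-identityˡ h k)) (z k)
    Z^-cancel (suc m) {h} z = Z^-cancel m (Z-cancel
      (λ k → ≡.trans (≡.sym (⊛-assoc Z (Z 𝕊.^ m) h k)) (≡.trans (z k) (≡.sym (𝕊.zeroʳ Z k)))))

    -- Modulo Z^q only the term j = 0 survives. Once `independent-mod` has removed it, the rest can
    -- be divided by Z^q.
    independent : ∀ {J} (r s : Fin J → Fin A → Fin q) → P.form r s Z (g Z) (Z 𝕊.^ q) ≋ 0ₛ →
      ∀ j → (∀ i → r j i ≡ 0#) × (∀ i → s j i ≡ 0#)
    independent {suc J} r s z = λ { zero → first ; (suc j) → independent (r ∘ suc) (s ∘ suc) rest j }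
      where
      first-term rest-term : Series
      first-term = P.ev (r zero) Z ⊕ P.ev (s zero) Z ⊛ g Z
      rest-term = P.form (r ∘ suc) (s ∘ suc) Z (g Z) (Z 𝕊.^ q)
      first : (∀ i → r zero i ≡ 0#) × (∀ i → s zero i ≡ 0#)
      first = independent-mod (r zero) (s zero) λ k k<q → begin
        first-term k                                ≡⟨ +-identityʳ _ ⟨
        first-term k + 0#                           ≡⟨ ≡.cong (first-term k +_) (⊛-zeroˡ rest-term k) ⟨
        first-term k + (0ₛ ⊛ rest-term) k           ≡⟨ ≡.cong (first-term k +_)
          (⊛-cong-mod {q} {Z 𝕊.^ q} {0ₛ} {rest-term} (^-vanish {Z} refl q) (λ _ _ → refl) k k<q) ⟨
        first-term k + (Z 𝕊.^ q ⊛ rest-term) k      ≡⟨ z k ⟩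
        0#                                          ∎
        where open ≡.≡-Reasoning
      first-term≋0 : first-term ≋ 0ₛ
      first-term≋0 k = ≡.trans (≡.cong₂ _+_ (P.ev-0 (proj₁ first) Z k)
        (≡.trans (⊛-cong {g = g Z} (P.ev-0 (proj₂ first) Z) (λ _ → refl) k) (⊛-zeroˡ (g Z) k))) (+-identityˡ 0#)
      rest : rest-term ≋ 0ₛ
      rest = Z^-cancel q λ k → ≡.trans (≡.sym (≡.trans (≡.cong (_+ (Z 𝕊.^ q ⊛ rest-term) k) (first-term≋0 k)) (+-identityˡ _))) (z k)

-- Stepanov's bound for a level set.

module Stepanov {q} (F : FiniteField q) (n : ℕ) (q≡ : q ≡ suc (suc n ℕ.+ suc n)) where
  open Field F
  open Fermat F
  open Nonvanishing F n q≡
  open +-*-Solver using (solve; _:=_; _:+_; _:*_; con)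

  -- A grading in which Z has weight d. In use d is the degree of f, because Z always comes with the
  -- slope f(x).
  Weighted : ℕ → ℕ → (Fin q → Series) → Set
  Weighted d W Φ = ∀ k → Q.Poly (W ℕ.+ k ℕ.* d) (λ x → Φ x k)

  wt-≤ : ∀ {d V W Φ} → V ℕ.≤ W → Weighted d V Φ → Weighted d W Φ
  wt-≤ V≤W w k = Q.poly-≤ (ℕₚ.+-monoˡ-≤ _ V≤W) (w k)

  wt-const : ∀ {d W φ} → Q.Poly W φ → Weighted d W (const ∘ φ)
  wt-const p zero    = Q.poly-≤ (ℕₚ.m≤m+n _ _) p
  wt-const p (suc k) = Q.poly-0

  wt-+ : ∀ {d W Φ Ψ} → Weighted d W Φ → Weighted d W Ψ → Weighted d W (λ x → Φ x ⊕ Ψ x)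
  wt-+ v w k = Q.poly-+ (v k) (w k)

  wt-⊛ : ∀ {d V W Φ Ψ} → Weighted d V Φ → Weighted d W Ψ → Weighted d (V ℕ.+ W) (λ x → Φ x ⊛ Ψ x)
  wt-⊛ {d} {V} {W} v w zero = Q.poly-≤
    (ℕₚ.≤-reflexive (solve 2 (λ V W → (V :+ con 0) :+ (W :+ con 0) := V :+ W :+ con 0) refl V W))
    (Q.poly-* (v 0) (w 0))
  wt-⊛ {d} {V} {W} {Φ} v w (suc k) = Q.poly-+
    (Q.poly-≤ (ℕₚ.≤-reflexive (solve 4 (λ d V W k → (V :+ con 0) :+ (W :+ (d :+ k :* d)) := V :+ W :+ (d :+ k :* d)) refl d V W k))
      (Q.poly-* (v 0) (w (suc k))))
    (Q.poly-≤ (ℕₚ.≤-reflexive (solve 4 (λ d V W k → (V :+ d) :+ W :+ k :* d := V :+ W :+ (d :+ k :* d)) refl d V W k))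
      -- Passing to `tail` shifts the index by one, which is paid for by raising the base weight by
      -- d.
      (wt-⊛ {d} {V ℕ.+ d} {W} {tail ∘ Φ} (λ i → Q.poly-≤ (ℕₚ.≤-reflexive (≡.sym (ℕₚ.+-assoc V d _))) (v (suc i))) w k))

  wt-^ : ∀ {d Φ} m → Weighted d 0 Φ → Weighted d 0 (λ x → Φ x 𝕊.^ m)
  wt-^ zero    w = wt-const Q.poly-1
  wt-^ (suc m) w = wt-⊛ w (wt-^ m w)

  wt-Z : ∀ {d φ} → Q.Poly d φ → Weighted d 0 (λ x → const (φ x) ⊛ Z)
  wt-Z p zero          = Q.poly-cong (λ _ → ≡.sym (zeroʳ _)) Q.poly-0
  wt-Z p (suc zero)    = Q.poly-≤ (ℕₚ.m≤m+n _ 0) (Q.poly-cong (λ x → ≡.sym (≡.trans (const-⊛ _ Z 1) (*-identityʳ _))) p)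
  wt-Z p (suc (suc k)) = Q.poly-cong (λ x → ≡.sym (≡.trans (const-⊛ _ Z (suc (suc k))) (zeroʳ _))) Q.poly-0

  wt-line : ∀ {d W φ ψ} → Q.Poly W φ → Q.Poly d ψ → Weighted d W (λ x → line (φ x) (ψ x))
  wt-line p r = wt-+ (wt-const p) (wt-≤ z≤n (wt-Z r))

  wt-ev : ∀ {d A Φ} (c : Fin A → Fin q) → Weighted d 1 Φ → Weighted d A (λ x → P.ev c (Φ x))
  wt-ev {A = zero}  c w k = Q.poly-0
  wt-ev {A = suc A} c w = wt-+ (wt-const (Q.poly-const (c zero))) (wt-⊛ w (wt-ev (c ∘ suc) w))

  -- The last argument is `const x`, the reduced q-th power, so the index j costs at most J in
  -- degree rather than J q.
  wt-form : ∀ {d J A Φ Ψ} (r s : Fin J → Fin A → Fin q) → Weighted d 1 Φ → Weighted d 0 Ψ →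
    Weighted d (J ℕ.+ A) (λ x → P.form r s (Φ x) (Ψ x) (const x))
  wt-form {J = zero}  r s v w k = Q.poly-0
  wt-form {J = suc J} {A} r s v w = wt-+
    (wt-≤ (ℕₚ.m≤n+m A (suc J)) (wt-+ (wt-ev (r zero) v)
      (wt-≤ (ℕₚ.≤-reflexive (ℕₚ.+-identityʳ A)) (wt-⊛ (wt-ev (s zero) v) w))))
    (wt-⊛ (wt-const Q.poly-id) (wt-form (r ∘ suc) (s ∘ suc) v w))

  -- With y = h(x) ∏(x - b), each factor x - b + y Z is (x - b)(1 + (y / (x - b)) Z).
  cofactor : (Fin q → Fin q) → List (Fin q) → Fin q → Series
  cofactor h []       x = 𝕊.1#
  cofactor h (b ∷ bs) x = line 1# (h x * Q.fromRoots bs x) ⊛ cofactor (λ x → h x * (x - b)) bs x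

  wt-cofactor : ∀ {d e h} bs → Q.Poly e h → e ℕ.+ length bs ℕ.≤ d → Weighted d 0 (cofactor h bs)
  wt-cofactor []       p e≤d = wt-const Q.poly-1
  wt-cofactor {d} {e} (b ∷ bs) p e≤d = wt-⊛
    (wt-line Q.poly-1 (Q.poly-≤ (ℕₚ.≤-trans (ℕₚ.+-monoʳ-≤ e (ℕₚ.n≤1+n (length bs))) e≤d) (Q.poly-* p (Q.poly-fromRoots bs))))
    (wt-cofactor bs (Q.poly-* p (Q.poly-linear b)) (ℕₚ.≤-trans (ℕₚ.≤-reflexive (ℕₚ.+-assoc e 1 (length bs))) e≤d))

  -- `h` accumulates the factors already split off: y stays the product over all roots while the
  -- list gets shorter.
  fromRoots-line : ∀ h bs x {y} → y ≡ h x * Q.fromRoots bs x →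
    P.fromRoots bs (line x y) ≋ const (Q.fromRoots bs x) ⊛ cofactor h bs x
  fromRoots-line h []       x     y≡ = 𝕊.sym (𝕊.*-identityˡ 𝕊.1#)
  fromRoots-line h (b ∷ bs) x {y} y≡ = begin
    (line x y 𝕊.- const b) ⊛ P.fromRoots bs (line x y)
      ≈⟨ ⊛-cong (𝕊.trans (line-- x y b) split) (fromRoots-line h′ bs x (≡.trans y≡ (≡.sym (*-assoc (h x) (x - b) R)))) ⟩
    (const (x - b) ⊛ line 1# (h x * R)) ⊛ (const R ⊛ C)
      ≈⟨ interchange (const (x - b)) (line 1# (h x * R)) (const R) C ⟩
    (const (x - b) ⊛ const R) ⊛ (line 1# (h x * R) ⊛ C)
      ≈⟨ 𝕊.*-congʳ {line 1# (h x * R) ⊛ C} (const-* (x - b) R) ⟨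
    const ((x - b) * R) ⊛ (line 1# (h x * R) ⊛ C) ∎
    where
    open import Relation.Binary.Reasoning.Setoid 𝕊.setoid
    open import Algebra.Properties.CommutativeSemigroup 𝕊.*-commutativeSemigroup using (interchange)
    open import Algebra.Properties.CommutativeSemigroup *-commutativeSemigroup using (x∙yz≈y∙xz)
    R = Q.fromRoots bs x
    h′ : Fin q → Fin q
    h′ x = h x * (x - b)
    C = cofactor h′ bs x
    split : line (x - b) y ≋ const (x - b) ⊛ line 1# (h x * R)
    split = begin
      const (x - b) ⊕ const y ⊛ Z
        ≈⟨ 𝕊.+-cong (λ k → ≡.cong (λ a → const a k) (≡.sym (*-identityʳ (x - b))))
             (𝕊.*-congʳ {Z} (λ k → ≡.cong (λ a → const a k) (≡.trans y≡ (x∙yz≈y∙xz (h x) (x - b) R)))) ⟩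
      const ((x - b) * 1#) ⊕ const ((x - b) * (h x * R)) ⊛ Z
        ≈⟨ 𝕊.+-cong (const-* (x - b) 1#) (𝕊.trans (𝕊.*-congʳ {Z} (const-* (x - b) (h x * R)))
             (𝕊.*-assoc (const (x - b)) (const (h x * R)) Z)) ⟩
      const (x - b) ⊛ const 1# ⊕ const (x - b) ⊛ (const (h x * R) ⊛ Z)
        ≈⟨ 𝕊.distribˡ (const (x - b)) (const 1#) (const (h x * R) ⊛ Z) ⟨
      const (x - b) ⊛ line 1# (h x * R) ∎

  form-cong-mod : ∀ {m J A} (r s : Fin J → Fin A → Fin q) {u g g′ v v′} → g ≋[ m ] g′ → v ≋[ m ] v′ →
    P.form r s u g v ≋[ m ] P.form r s u g′ v′
  form-cong-mod {J = zero}  r s p p′ k k<m = refl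
  form-cong-mod {J = suc J} r s {u} p p′ k k<m = ≡.cong₂ _+_
    (≡.cong (P.ev (r zero) u k +_) (⊛-cong-mod {f = P.ev (s zero) u} (λ _ _ → refl) p k k<m))
    (⊛-cong-mod p′ (form-cong-mod (r ∘ suc) (s ∘ suc) p p′) k k<m)

  1<q : 1 ℕ.< q
  1<q = ℕₚ.≤-trans (s≤s (s≤s z≤n)) (ℕₚ.≤-reflexive (≡.sym q≡))

  -- More unknowns than equations over 𝔽_q: a nonzero solution exists by counting.
  collision : ∀ {X Y} → Y ℕ.< X → (key : (Fin X → Fin q) → Fin Y → Fin q) →
    ∃[ p ] ∃[ p′ ] ((∃[ i ] p i ≢ p′ i) × (∀ i → key p i ≡ key p′ i))
  collision {X} {Y} Y<X key with pigeonhole (ℕₚ.^-monoʳ-< q 1<q Y<X) (λ i → funToFin (key (finToFun i)))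
  ... | i , j , i<j , eq = p , p′ , differ , agree
    where
    p p′ : Fin X → Fin q
    p  = finToFun i
    p′ = finToFun j
    agree : ∀ l → key p l ≡ key p′ l
    agree l = ≡.trans (≡.sym (finToFun-funToFin (key p) l)) (≡.trans (≡.cong (λ e → finToFun e l) eq) (finToFun-funToFin (key p′) l))
    differ : ∃[ l ] p l ≢ p′ l
    differ with any? (λ l → ¬? (p l ≟ p′ l))
    ... | yes d = d
    ... | no  nd = contradiction i≡j (<⇒≢ i<j)
      where
      i≡j : i ≡ j
      i≡j = ≡.trans (≡.sym (funToFin-finToFin {X} {q} i)) (≡.trans (funToFin-cong (λ l → decidable-stable (p l ≟ p′ l) (λ ne → nd (l , ne)))) (funToFin-finToFin {X} {q} j))
        where
        funToFin-cong : ∀ {m n} {f g : Fin m → Fin n} → (∀ i → f i ≡ g i) → funToFin f ≡ funToFin g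
        funToFin-cong {zero}  p = refl
        funToFin-cong {suc m} p = ≡.cong₂ combine (p zero) (funToFin-cong (p ∘ suc))

  module _ {a₀ : Fin q} {as : List (Fin q)} (roots≢0 : All (0# ≢_) (a₀ ∷ as)) (a₀∉as : All (a₀ ≢_) as)
           (J M A : ℕ) where

    private
      roots : List (Fin q)
      roots = a₀ ∷ as
      d L : ℕ
      d = length roots
      -- The number of coefficients in x of one Z-coefficient of order below M. There are M such
      -- orders, hence `M * L` equations.
      L = suc (J ℕ.+ A ℕ.+ M ℕ.* d)

    private
      Params : Set
      Params = Fin (J ℕ.* (A ℕ.+ A)) → Fin q

      coeffs : Params → (Fin A → Fin (A ℕ.+ A)) → Fin J → Fin A → Fin q
      coeffs p half j i = p (combine j (half i))

    module _ (c : Fin q) where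

      u w : Fin q → Series
      u x = line x (Q.fromRoots roots x)
      w x = const c ⊛ cofactor (λ _ → 1#) roots x 𝕊.^ suc n

      -- At a point with g(x) = c this is the auxiliary polynomial on the line through x, modulo
      -- Z^q. Putting the constant c for g(x) everywhere makes its Z-coefficients polynomials in x
      -- of low degree, so they can be made to agree at all x at once.
      Ψ : Params → Fin q → Series
      Ψ p x = P.form (coeffs p (_↑ˡ A)) (coeffs p (A ↑ʳ_)) (u x) (w x) (const x)

      Ψ-poly : ∀ p (k : Fin M) → Q.Poly (J ℕ.+ A ℕ.+ M ℕ.* d) (λ x → Ψ p x (toℕ k))
      Ψ-poly p k = Q.poly-≤ (ℕₚ.+-monoʳ-≤ (J ℕ.+ A) (ℕₚ.*-monoˡ-≤ d (ℕₚ.<⇒≤ (toℕ<n k))))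
        (wt-form (coeffs p (_↑ˡ A)) (coeffs p (A ↑ʳ_)) (wt-line Q.poly-id (Q.poly-fromRoots roots))
          (wt-⊛ (wt-const (Q.poly-const c)) (wt-^ (suc n) (wt-cofactor {d} {0} roots Q.poly-1 ℕₚ.≤-refl))) (toℕ k))

      -- All coefficients of all Z-orders below M. Two parameter vectors with equal keys are
      -- subtracted later, so a collision takes the place of solving a linear system.
      key : Params → Fin (M ℕ.* L) → Fin q
      key p i = proj₁ (Ψ-poly p (proj₁ (remQuot {M} L i))) (proj₂ (remQuot {M} L i))

      module _ (p p′ : Params) (differ : ∃[ i ] p i ≢ p′ i) (same-key : ∀ i → key p i ≡ key p′ i) where

        r s : Fin J → Fin A → Fin q
        r j i = coeffs p (_↑ˡ A) j i - coeffs p′ (_↑ˡ A) j i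
        s j i = coeffs p (A ↑ʳ_) j i - coeffs p′ (A ↑ʳ_) j i

        nontrivial : (∀ j → (∀ i → r j i ≡ 0#) × (∀ i → s j i ≡ 0#)) → ⊥
        nontrivial z = proj₂ differ (≡.subst (λ e → p e ≡ p′ e) (combine-remQuot {J} (A ℕ.+ A) (proj₁ differ))
                (agree (proj₁ (remQuot {J} (A ℕ.+ A) (proj₁ differ))) (proj₂ (remQuot {J} (A ℕ.+ A) (proj₁ differ)))))
          where
          agree : ∀ j m → p (combine j m) ≡ p′ (combine j m)
          agree j m with splitAt A m | join-splitAt A A m
          ... | inj₁ i | refl = x-y≡0⇒x≡y _ _ (proj₁ (z j) i)
          ... | inj₂ i | refl = x-y≡0⇒x≡y _ _ (proj₂ (z j) i)

        Ψ-agree : ∀ x k → k ℕ.< M → Ψ p x k ≡ Ψ p′ x k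
        Ψ-agree x k k<M = begin
          Ψ p x k                                        ≡⟨ ≡.cong (Ψ p x) (toℕ-fromℕ< k<M) ⟨
          Ψ p x (toℕ k′)                                 ≡⟨ proj₂ (Ψ-poly p k′) x ⟩
          Q.ev (proj₁ (Ψ-poly p k′)) x                   ≡⟨ Q.ev-congˡ same x ⟩
          Q.ev (proj₁ (Ψ-poly p′ k′)) x                  ≡⟨ proj₂ (Ψ-poly p′ k′) x ⟨
          Ψ p′ x (toℕ k′)                                ≡⟨ ≡.cong (Ψ p′ x) (toℕ-fromℕ< k<M) ⟩
          Ψ p′ x k                                       ∎
          where
          open ≡.≡-Reasoning
          k′ = fromℕ< k<M
          same : ∀ l → proj₁ (Ψ-poly p k′) l ≡ proj₁ (Ψ-poly p′ k′) l
          same l = ≡.subst (λ (a , b) → proj₁ (Ψ-poly p a) b ≡ proj₁ (Ψ-poly p′ a) b) (remQuot-combine k′ l)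
            (same-key (combine k′ l))

        E : Series → Series
        E v = P.form r s v (P.fromRoots roots v 𝕊.^ suc n) (v 𝕊.^ q)

        E-poly : P.Poly (J ℕ.* q ℕ.+ (A ℕ.+ suc n ℕ.* d)) E
        E-poly = P.poly-form r s (P.poly-^ (suc n) (P.poly-fromRoots roots))
          (P.poly-≤ (ℕₚ.≤-reflexive (ℕₚ.*-identityʳ q)) (P.poly-^ q P.poly-id))

        -- On the line the power of f is exactly c times a power of the cofactor, and since M ≤ q
        -- the q-th power may be replaced by x. What remains is a difference of two values of `Ψ`,
        -- which the equal keys make zero.
        vanishes : M ℕ.≤ q → ∀ {x} → Q.fromRoots roots x ≢ 0# × Q.fromRoots roots x ^ suc n ≡ c →
          Vanishes (Q.fromRoots roots) M (proj₁ E-poly) x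
        vanishes M≤q {x} (_ , fx^n≡c) k k<M = begin
          P.ev (proj₁ E-poly) (u x) k            ≡⟨ proj₂ E-poly (u x) k ⟨
          E (u x) k                              ≡⟨ form-cong-mod {M} r s {u x} (λ i _ → g≋ i)
                                                      (mod-≤ M≤q (line-^q n q≡ x (Q.fromRoots roots x))) k k<M ⟩
          P.form r s (u x) (w x) (const x) k     ≡⟨ P.form-- (coeffs p (_↑ˡ A)) (coeffs p (A ↑ʳ_))
                                                      (coeffs p′ (_↑ˡ A)) (coeffs p′ (A ↑ʳ_)) (u x) (w x) (const x) k ⟩
          Ψ p x k - Ψ p′ x k                     ≡⟨ ≡.cong (_- Ψ p′ x k) (Ψ-agree x k k<M) ⟩
          Ψ p′ x k - Ψ p′ x k                    ≡⟨ -‿inverseʳ _ ⟩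
          0#                                     ∎
          where
          open ≡.≡-Reasoning
          C = cofactor (λ _ → 1#) roots x
          g≋ : P.fromRoots roots (u x) 𝕊.^ suc n ≋ w x
          g≋ i = ≡.trans (𝕊.^-congˡ (suc n) (fromRoots-line (λ _ → 1#) roots x (≡.sym (*-identityˡ _))) i)
            (≡.trans (𝕊.^-distrib-* (const (Q.fromRoots roots x)) C (suc n) i)
              (𝕊.*-congʳ {C 𝕊.^ suc n} (λ l → ≡.trans (≡.sym (const-^ (Q.fromRoots roots x) (suc n) l)) (≡.cong (λ a → const a l) fx^n≡c)) i))

        -- Otherwise the nonzero difference would give an auxiliary polynomial with more zeros,
        -- counted with multiplicity, than its degree; it would vanish at Z, against `independent`.
        bound : M ℕ.≤ q → A ℕ.+ A ℕ.+ d ℕ.< q → ∀ xs → Unique xs →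
          All (λ x → Q.fromRoots roots x ≢ 0# × Q.fromRoots roots x ^ suc n ≡ c) xs →
          length xs ℕ.* M ℕ.≤ J ℕ.* q ℕ.+ (A ℕ.+ suc n ℕ.* d)
        bound M≤q 2A+d<q [] un hyp = z≤n
        bound M≤q 2A+d<q (x₀ ∷ xs) un (hyp₀ ∷ hyps) = ℕₚ.≮⇒≥ λ D<len →
          nontrivial (independent a₀ as roots≢0 a₀∉as {A} 2A+d<q r s λ k → ≡.trans (proj₂ E-poly Z k)
            (multiplicities (Q.fromRoots roots) (proj₁ E-poly) M M x₀ xs (proj₁ hyp₀) (All.map proj₁ hyps) un
              (vanishes M≤q hyp₀) (All.map (vanishes M≤q) hyps) D<len Z k))

    level-set-bound : M ℕ.≤ q → A ℕ.+ A ℕ.+ d ℕ.< q → M ℕ.* L ℕ.< J ℕ.* (A ℕ.+ A) →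
      ∀ c xs → Unique xs → All (λ x → Q.fromRoots roots x ≢ 0# × Q.fromRoots roots x ^ suc n ≡ c) xs →
      length xs ℕ.* M ℕ.≤ J ℕ.* q ℕ.+ (A ℕ.+ suc n ℕ.* d)
    level-set-bound M≤q 2A+d<q ML<2AJ c =
      let (p , p′ , differ , same-key) = collision ML<2AJ (key c) in bound c p p′ differ same-key M≤q 2A+d<q

-- Choice of parameters: level sets hold at most 17/32 of the field.

module HalfBound {q} (F : FiniteField q) (n : ℕ) (q≡ : q ≡ suc (suc n ℕ.+ suc n)) where
  open Field F
  open Stepanov F n q≡
  open +-*-Solver using (solve; _:=_; _:+_; _:*_; con)

  -- After cancelling 64 d A on both sides, 2 d A has to exceed 4096 d³ + 2112 d² + 64 d, which is
  -- at most 6272 d³. Taking A = 3200 d² gives 6400 d³. The added polynomial in e = d - 1 is the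
  -- exact slack.
  unknowns>equations : ∀ e → let d = suc e; A = 3200 ℕ.* (d ℕ.* d) in
    64 ℕ.* d ℕ.* suc (33 ℕ.* d ℕ.+ A ℕ.+ 64 ℕ.* d ℕ.* d) ℕ.< 33 ℕ.* d ℕ.* (A ℕ.+ A)
  unknowns>equations e = ℕₚ.≤-trans (ℕₚ.m≤m+n (suc lhs) (127 ℕ.+ 2624 ℕ.* e ℕ.+ 4800 ℕ.* (e ℕ.* e) ℕ.+ 2304 ℕ.* (e ℕ.* e ℕ.* e)))
    (ℕₚ.≤-reflexive (solve 1 (λ e → let d = con 1 :+ e; A = con 3200 :* (d :* d) in
      (con 1 :+ con 64 :* d :* (con 1 :+ (con 33 :* d :+ A :+ con 64 :* d :* d)))
        :+ (con 127 :+ con 2624 :* e :+ con 4800 :* (e :* e) :+ con 2304 :* (e :* e :* e))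
      := con 33 :* d :* (A :+ A)) refl e))
    where
    lhs = 64 ℕ.* suc e ℕ.* suc (33 ℕ.* suc e ℕ.+ 3200 ℕ.* (suc e ℕ.* suc e) ℕ.+ 64 ℕ.* suc e ℕ.* suc e)

  -- J / M = 1/2 + 1/64 leaves just enough unknowns, and the degree d (q - 1) / 2 of f ^ ((q - 1) / 2) costs at most
  -- d q / M = q / 64 after division by M; hence 1/2 + 1/64 + 1/64 = 17/32.
  nonzero-roots-bound : ∀ {a₀ as} → All (0# ≢_) (a₀ ∷ as) → All (a₀ ≢_) as → let d = length (a₀ ∷ as) in
    6401 ℕ.* (d ℕ.* d) ℕ.< q → ∀ c xs → Unique xs →
    All (λ x → Q.fromRoots (a₀ ∷ as) x ≢ 0# × Q.fromRoots (a₀ ∷ as) x ^ suc n ≡ c) xs →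
    32 ℕ.* length xs ℕ.≤ 17 ℕ.* q
  nonzero-roots-bound {a₀} {as} roots≢0 a₀∉as d²<q c xs un hyp = ℕₚ.*-cancelʳ-≤ _ _ (2 ℕ.* d) (begin
      32 ℕ.* l ℕ.* (2 ℕ.* d)
        ≡⟨ solve 2 (λ l d → con 32 :* l :* (con 2 :* d) := l :* (con 64 :* d)) refl l d ⟩
      l ℕ.* (64 ℕ.* d)
        ≤⟨ level-set-bound roots≢0 a₀∉as (33 ℕ.* d) (64 ℕ.* d) A M≤q 2A+d<q (unknowns>equations (length as)) c xs un hyp ⟩
      33 ℕ.* d ℕ.* q ℕ.+ (A ℕ.+ suc n ℕ.* d)
        ≤⟨ ℕₚ.+-monoʳ-≤ (33 ℕ.* d ℕ.* q) rest≤ ⟩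
      33 ℕ.* d ℕ.* q ℕ.+ d ℕ.* q
        ≡⟨ solve 2 (λ d q → con 33 :* d :* q :+ d :* q := con 17 :* q :* (con 2 :* d)) refl d q ⟩
      17 ℕ.* q ℕ.* (2 ℕ.* d) ∎)
    where
    open ℕₚ.≤-Reasoning
    l d A : ℕ
    l = length xs
    d = length (a₀ ∷ as)
    A = 3200 ℕ.* (d ℕ.* d)
    d≤dd : d ℕ.≤ d ℕ.* d
    d≤dd = ℕₚ.m≤m*n d d
    M≤q : 64 ℕ.* d ℕ.≤ q
    M≤q = ℕₚ.≤-trans (ℕₚ.*-mono-≤ (ℕₚ.m≤m+n 64 6337) d≤dd) (ℕₚ.<⇒≤ d²<q)
    2A+d<q : A ℕ.+ A ℕ.+ d ℕ.< q
    2A+d<q = ℕₚ.≤-<-trans (begin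
      A ℕ.+ A ℕ.+ d          ≤⟨ ℕₚ.+-monoʳ-≤ (A ℕ.+ A) d≤dd ⟩
      A ℕ.+ A ℕ.+ d ℕ.* d    ≡⟨ solve 1 (λ x → con 3200 :* x :+ con 3200 :* x :+ x := con 6401 :* x) refl (d ℕ.* d) ⟩
      6401 ℕ.* (d ℕ.* d)     ∎) d²<q
    rest≤ : A ℕ.+ suc n ℕ.* d ℕ.≤ d ℕ.* q
    rest≤ = ℕₚ.*-cancelˡ-≤ 2 (begin
      2 ℕ.* (A ℕ.+ suc n ℕ.* d)
        ≡⟨ solve 3 (λ A m d → con 2 :* (A :+ m :* d) := (A :+ A) :+ d :* (m :+ m)) refl A (suc n) d ⟩
      (A ℕ.+ A) ℕ.+ d ℕ.* (suc n ℕ.+ suc n)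
        ≤⟨ ℕₚ.+-mono-≤ {A ℕ.+ A} {d ℕ.* q} (ℕₚ.≤-trans (ℕₚ.m≤m+n (A ℕ.+ A) d) (ℕₚ.≤-trans (ℕₚ.<⇒≤ 2A+d<q) (ℕₚ.m≤n*m q d)))
             (ℕₚ.*-monoʳ-≤ d (ℕₚ.≤-trans (ℕₚ.n≤1+n _) (ℕₚ.≤-reflexive (≡.sym q≡)))) ⟩
      d ℕ.* q ℕ.+ d ℕ.* q
        ≡⟨ ≡.cong (d ℕ.* q ℕ.+_) (ℕₚ.+-identityʳ (d ℕ.* q)) ⟨
      2 ℕ.* (d ℕ.* q) ∎)

  -‿translate : ∀ x a b → (x - b) - (a - b) ≡ x - a
  -‿translate x a b = begin
    (x - b) - (a - b)          ≡⟨ ≡.cong ((x - b) +_) (-‿+-comm a (- b)) ⟨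
    (x - b) + (- a + - - b)    ≡⟨ ≡.cong (λ e → (x - b) + (- a + e)) (-‿involutive b) ⟩
    (x - b) + (- a + b)        ≡⟨ interchange x (- b) (- a) b ⟩
    (x - a) + (- b + b)        ≡⟨ ≡.cong ((x - a) +_) (-‿inverseˡ b) ⟩
    (x - a) + 0#               ≡⟨ +-identityʳ _ ⟩
    x - a                      ∎
    where
    open ≡.≡-Reasoning
    open import Algebra.Properties.CommutativeSemigroup +-commutativeSemigroup using (interchange)

  fromRoots-translate : ∀ b as x → Q.fromRoots (map (_- b) as) (x - b) ≡ Q.fromRoots as x
  fromRoots-translate b []       x = refl
  fromRoots-translate b (a ∷ as) x = ≡.cong₂ _*_ (-‿translate x a b) (fromRoots-translate b as x)

  -‿cancelʳ : ∀ b {x y} → x - b ≡ y - b → x ≡ y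
  -‿cancelʳ b {x} {y} eq = x-y≡0⇒x≡y x y
    (≡.trans (≡.sym (-‿translate x y b)) (≡.trans (≡.cong (_- (y - b)) eq) (-‿inverseʳ _)))

  fromRoots-∉ : ∀ as {x} → Q.fromRoots as x ≢ 0# → All (_≢ x) as
  fromRoots-∉ []       _ = []
  fromRoots-∉ (a ∷ as) {x} ne =
    (λ { refl → ne (≡.trans (≡.cong (_* Q.fromRoots as x) (-‿inverseʳ x)) (zeroˡ _)) }) ∷
    fromRoots-∉ as (λ z → ne (≡.trans (≡.cong ((x - a) *_) z) (zeroʳ _)))

  -- Translating by a point of the level set makes all roots nonzero.
  level-set-≤ : ∀ {a₀ as} → All (a₀ ≢_) as → let d = length (a₀ ∷ as) in
    6401 ℕ.* (d ℕ.* d) ℕ.< q → ∀ c xs → Unique xs →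
    All (λ x → Q.fromRoots (a₀ ∷ as) x ≢ 0# × Q.fromRoots (a₀ ∷ as) x ^ suc n ≡ c) xs →
    32 ℕ.* length xs ℕ.≤ 17 ℕ.* q
  level-set-≤ a₀∉as d²<q c [] un hyp = z≤n
  level-set-≤ {a₀} {as} a₀∉as d²<q c xs@(b ∷ _) un hyp@((fb≢0 , _) ∷ _) =
    ≡.subst (λ l → 32 ℕ.* l ℕ.≤ 17 ℕ.* q) (length-map (_- b) xs)
      (nonzero-roots-bound
        (All.map⁺ (All.map (λ a≢b 0≡ → -≢0 a≢b (≡.sym 0≡)) (fromRoots-∉ (a₀ ∷ as) fb≢0)))
        (All.map⁺ (All.map (λ ne eq → ne (-‿cancelʳ b eq)) a₀∉as))
        (≡.subst (λ l → 6401 ℕ.* (suc l ℕ.* suc l) ℕ.< q) (≡.sym (length-map (_- b) as)) d²<q)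
        c (map (_- b) xs) (Unique.map⁺ (-‿cancelʳ b) un)
        (All.map⁺ (All.map (λ {x} (ne , eq) →
          (λ z → ne (≡.trans (≡.sym (fromRoots-translate b (a₀ ∷ as) x)) z)) ,
          ≡.trans (≡.cong (_^ suc n) (fromRoots-translate b (a₀ ∷ as) x)) eq) hyp)))

open import Data.Bool as Bool using (Bool; true; false; if_then_else_; not; _∧_; _∨_)
open import Data.Bool.ListAction using (all; any)
open import Data.Fin.Subset as Subset using (Subset)
open import Data.Fin.Subset.Properties using (∣p∣≤n)
open import Data.Integer as ℤ using (ℤ; +_; -[1+_])
open import Data.Integer.Properties as ℤₚ using ()
import Data.Integer.Solver as ℤ
open import Data.Nat.Combinatorics using (_C_; nCk+nC[k+1]≡[n+1]C[k+1])
import Data.Nat.DivMod as ℕ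
import Data.Rational as ℚ
import Data.Rational.Properties as ℚₚ
import Data.Rational.Unnormalised as ℚᵘ
import Data.Rational.Unnormalised.Properties as ℚᵘₚ
open import Data.Vec using ([]; _∷_; lookup; replicate)

-- Coefficients of nearly balanced products of 1 + z and 1 - z.

module ℤ⟦z⟧ = PowerSeries ℤₚ.+-*-commutativeRing
module ℤ⟦z⟧ᵣ = RingTheory ℤ⟦z⟧.seriesRing

module BinomialBias where
  open ℤ⟦z⟧
  open ℤ⟦z⟧ᵣ using (_^_; ^-homo-*; ^-distrib-*; *-congˡ; *-congʳ)
  open +-*-Solver using (solve; _:=_; _:+_; _:*_; con)

  nC0≡1 : ∀ n → n C 0 ≡ 1
  nC0≡1 zero    = refl
  nC0≡1 (suc n) = refl

  1+z 1-z : Series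
  1+z = line (+ 1) (+ 1)
  1-z = line (+ 1) -[1+ 0 ]

  binomial : ∀ m k → (1+z ^ m) k ≡ + (m C k)
  binomial zero    zero    = refl
  binomial zero    (suc k) = refl
  binomial (suc m) zero    = ≡.trans (line-⊛-zero (+ 1) (+ 1) (1+z ^ m)) (≡.trans (ℤₚ.*-identityˡ _)
    (≡.trans (binomial m 0) (≡.cong +_ (≡.trans (nC0≡1 m) (≡.sym (nC0≡1 (suc m)))))))
  binomial (suc m) (suc k) = begin
    (1+z ⊛ 1+z ^ m) (suc k)                            ≡⟨ line-⊛-suc (+ 1) (+ 1) (1+z ^ m) k ⟩
    + 1 ℤ.* (1+z ^ m) (suc k) ℤ.+ + 1 ℤ.* (1+z ^ m) k  ≡⟨ ≡.cong₂ ℤ._+_ (ℤₚ.*-identityˡ ((1+z ^ m) (suc k))) (ℤₚ.*-identityˡ ((1+z ^ m) k)) ⟩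
    (1+z ^ m) (suc k) ℤ.+ (1+z ^ m) k                  ≡⟨ ≡.cong₂ ℤ._+_ (binomial m (suc k)) (binomial m k) ⟩
    + (m C suc k ℕ.+ m C k)                            ≡⟨ ≡.cong +_ (≡.trans (ℕₚ.+-comm (m C suc k) (m C k)) (nCk+nC[k+1]≡[n+1]C[k+1] m k)) ⟩
    + (suc m C suc k)                                  ∎
    where open ≡.≡-Reasoning

  -- The subtraction-free form of (k + 1) C(n, k + 1) = (n - k) C(n, k).
  absorption : ∀ n k → suc k ℕ.* (n C suc k) ℕ.+ k ℕ.* (n C k) ≡ n ℕ.* (n C k)
  absorption zero    zero    = refl
  absorption zero    (suc k) = ≡.cong₂ ℕ._+_ (ℕₚ.*-zeroʳ (suc (suc k))) (ℕₚ.*-zeroʳ (suc k))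
  absorption (suc n) zero    = begin
    1 ℕ.* (suc n C 1) ℕ.+ 0    ≡⟨ ≡.trans (ℕₚ.+-identityʳ _) (ℕₚ.*-identityˡ _) ⟩
    suc n C 1                  ≡⟨ nCk+nC[k+1]≡[n+1]C[k+1] n 0 ⟨
    n C 0 ℕ.+ n C 1            ≡⟨ ≡.cong₂ ℕ._+_ (nC0≡1 n) (≡.sym (≡.trans (ℕₚ.+-identityʳ _) (ℕₚ.*-identityˡ (n C 1)))) ⟩
    1 ℕ.+ (1 ℕ.* (n C 1) ℕ.+ 0) ≡⟨ ≡.cong suc (≡.trans (absorption n 0) (≡.trans (≡.cong (n ℕ.*_) (nC0≡1 n)) (ℕₚ.*-identityʳ n))) ⟩
    suc n                      ≡⟨ ≡.trans (≡.cong (suc n ℕ.*_) (nC0≡1 (suc n))) (ℕₚ.*-identityʳ (suc n)) ⟨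
    suc n ℕ.* (suc n C 0)      ∎
    where open ≡.≡-Reasoning
  absorption (suc n) (suc k) = begin
    suc (suc k) ℕ.* (suc n C suc (suc k)) ℕ.+ suc k ℕ.* (suc n C suc k)
      ≡⟨ ≡.cong₂ (λ x y → suc (suc k) ℕ.* x ℕ.+ suc k ℕ.* y) (nCk+nC[k+1]≡[n+1]C[k+1] n (suc k)) (nCk+nC[k+1]≡[n+1]C[k+1] n k) ⟨
    suc (suc k) ℕ.* (y ℕ.+ z) ℕ.+ suc k ℕ.* (x ℕ.+ y)
      ≡⟨ solve 4 (λ k x y z → (con 2 :+ k) :* (y :+ z) :+ (con 1 :+ k) :* (x :+ y)
           := ((con 2 :+ k) :* z :+ (con 1 :+ k) :* y) :+ ((con 1 :+ k) :* y :+ k :* x) :+ (x :+ y)) refl k x y z ⟩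
    (suc (suc k) ℕ.* z ℕ.+ suc k ℕ.* y) ℕ.+ (suc k ℕ.* y ℕ.+ k ℕ.* x) ℕ.+ (x ℕ.+ y)
      ≡⟨ ≡.cong₂ (λ a b → a ℕ.+ b ℕ.+ (x ℕ.+ y)) (absorption n (suc k)) (absorption n k) ⟩
    n ℕ.* y ℕ.+ n ℕ.* x ℕ.+ (x ℕ.+ y)
      ≡⟨ solve 3 (λ n x y → n :* y :+ n :* x :+ (x :+ y) := (con 1 :+ n) :* (x :+ y)) refl n x y ⟩
    suc n ℕ.* (x ℕ.+ y)
      ≡⟨ ≡.cong (suc n ℕ.*_) (nCk+nC[k+1]≡[n+1]C[k+1] n k) ⟩
    suc n ℕ.* (suc n C suc k) ∎
    where
    open ≡.≡-Reasoning
    x = n C k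
    y = n C suc k
    z = n C suc (suc k)

  -- Consecutive binomials have ratio (n - k) / (k + 1). The target is 64 = 8² because the j-th term
  -- of a power of `1-z²` sits in degree 2j and must gain 8 per degree.
  C-growth : ∀ n k → 65 ℕ.* suc k ℕ.≤ n → 64 ℕ.* (n C k) ℕ.≤ n C suc k
  C-growth n k 65k≤n = ℕₚ.*-cancelˡ-≤ (suc k) (ℕₚ.+-cancelʳ-≤ (k ℕ.* (n C k)) _ _ (begin
    suc k ℕ.* (64 ℕ.* x) ℕ.+ k ℕ.* x   ≤⟨ ℕₚ.+-monoʳ-≤ (suc k ℕ.* (64 ℕ.* x)) (ℕₚ.*-monoˡ-≤ x (ℕₚ.n≤1+n k)) ⟩
    suc k ℕ.* (64 ℕ.* x) ℕ.+ suc k ℕ.* x ≡⟨ solve 2 (λ k x → k :* (con 64 :* x) :+ k :* x := con 65 :* k :* x) refl (suc k) x ⟩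
    65 ℕ.* suc k ℕ.* x                 ≤⟨ ℕₚ.*-monoˡ-≤ x 65k≤n ⟩
    n ℕ.* x                            ≡⟨ absorption n k ⟨
    suc k ℕ.* (n C suc k) ℕ.+ k ℕ.* x  ∎))
    where
    open ℕₚ.≤-Reasoning
    x = n C k

  C-growth-^ : ∀ n K i j → i ℕ.+ j ℕ.≤ K → 65 ℕ.* K ℕ.≤ n → 64 ℕ.^ i ℕ.* (n C j) ℕ.≤ n C (i ℕ.+ j)
  C-growth-^ n K zero    j _    _    = ℕₚ.≤-reflexive (ℕₚ.+-identityʳ _)
  C-growth-^ n K (suc i) j i+j<K 65K≤n = begin
    64 ℕ.* 64 ℕ.^ i ℕ.* (n C j)    ≡⟨ ℕₚ.*-assoc 64 (64 ℕ.^ i) (n C j) ⟩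
    64 ℕ.* (64 ℕ.^ i ℕ.* (n C j))  ≤⟨ ℕₚ.*-monoʳ-≤ 64 (C-growth-^ n K i j (ℕₚ.<⇒≤ i+j<K) 65K≤n) ⟩
    64 ℕ.* (n C (i ℕ.+ j))         ≤⟨ C-growth n (i ℕ.+ j) (ℕₚ.≤-trans (ℕₚ.*-monoʳ-≤ 65 i+j<K) 65K≤n) ⟩
    n C suc (i ℕ.+ j)              ∎
    where open ℕₚ.≤-Reasoning

  C-mono : ∀ {m n} → m ℕ.≤ n → ∀ k → m C k ℕ.≤ n C k
  C-mono {n = n} z≤n zero    = ℕₚ.≤-reflexive (≡.sym (nC0≡1 n))
  C-mono {n = n} z≤n (suc k) = z≤n
  C-mono (s≤s m≤n) zero    = ℕₚ.≤-refl
  C-mono {suc m} {suc n} (s≤s m≤n) (suc k) = begin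
    suc m C suc k          ≡⟨ nCk+nC[k+1]≡[n+1]C[k+1] m k ⟨
    m C k ℕ.+ m C suc k    ≤⟨ ℕₚ.+-mono-≤ (C-mono m≤n k) (C-mono m≤n (suc k)) ⟩
    n C k ℕ.+ n C suc k    ≡⟨ nCk+nC[k+1]≡[n+1]C[k+1] n k ⟩
    suc n C suc k          ∎
    where open ℕₚ.≤-Reasoning

  1-z² : Series
  1-z² = 1+z ⊛ 1-z

  1-z²-⊛-0 : ∀ g → (1-z² ⊛ g) 0 ≡ g 0
  1-z²-⊛-0 g = ℤₚ.*-identityˡ (g 0)

  private
    step : ∀ g k → (1-z ⊛ g) (suc k) ≡ g (suc k) ℤ.- g k
    step g k = ≡.trans (line-⊛-suc (+ 1) -[1+ 0 ] g k) (≡.cong₂ ℤ._+_ (ℤₚ.*-identityˡ (g (suc k))) (ℤₚ.-1*i≡-i (g k)))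

    step² : ∀ g k → (1-z² ⊛ g) (suc k) ≡ (1-z ⊛ g) (suc k) ℤ.+ (1-z ⊛ g) k
    step² g k = ≡.trans (⊛-assoc 1+z 1-z g (suc k)) (≡.trans (line-⊛-suc (+ 1) (+ 1) (1-z ⊛ g) k)
      (≡.cong₂ ℤ._+_ (ℤₚ.*-identityˡ ((1-z ⊛ g) (suc k))) (ℤₚ.*-identityˡ ((1-z ⊛ g) k))))

    telescope : ∀ a b c → a ℤ.- b ℤ.+ (b ℤ.- c) ≡ a ℤ.- c
    telescope a b c = ≡.trans (ℤₚ.+-assoc a (ℤ.- b) (b ℤ.- c)) (≡.cong (λ e → a ℤ.+ e)
      (≡.trans (≡.sym (ℤₚ.+-assoc (ℤ.- b) b (ℤ.- c))) (≡.trans (≡.cong (ℤ._- c) (ℤₚ.+-inverseˡ b)) (ℤₚ.+-identityˡ _))))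

  1-z²-⊛-1 : ∀ g → (1-z² ⊛ g) 1 ≡ g 1
  1-z²-⊛-1 g = ≡.trans (step² g 0) (≡.trans (≡.cong₂ ℤ._+_ (step g 0) (≡.trans (line-⊛-zero (+ 1) -[1+ 0 ] g) (ℤₚ.*-identityˡ _)))
    (≡.trans (ℤₚ.+-assoc (g 1) (ℤ.- g 0) (g 0)) (≡.trans (≡.cong (λ e → g 1 ℤ.+ e) (ℤₚ.+-inverseˡ (g 0))) (ℤₚ.+-identityʳ _))))

  1-z²-⊛-2 : ∀ g k → (1-z² ⊛ g) (suc (suc k)) ≡ g (suc (suc k)) ℤ.- g k
  1-z²-⊛-2 g k = ≡.trans (step² g (suc k)) (≡.trans (≡.cong₂ ℤ._+_ (step g (suc k)) (step g k)) (telescope (g (suc (suc k))) (g (suc k)) (g k)))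

  double : ℕ → ℕ
  double zero    = zero
  double (suc j) = suc (suc (double j))

  double≡ : ∀ j → double j ≡ j ℕ.+ j
  double≡ zero    = refl
  double≡ (suc j) = ≡.cong suc (≡.trans (≡.cong suc (double≡ j)) (≡.sym (ℕₚ.+-suc j j)))

  data Parity : ℕ → Set where
    even : ∀ j → Parity (double j)
    odd  : ∀ j → Parity (suc (double j))

  parity : ∀ k → Parity k
  parity zero = even 0
  parity (suc k) with parity k
  ... | even j = odd j
  ... | odd j  = even (suc j)

  1-z²-even : ∀ β j → ℤ.∣ (1-z² ^ β) (double j) ∣ ℕ.≤ β C j
  1-z²-even zero    zero    = ℕₚ.≤-refl
  1-z²-even zero    (suc j) = z≤n
  1-z²-even (suc β) zero    = ≡.subst₂ ℕ._≤_ (≡.sym (≡.cong ℤ.∣_∣ (1-z²-⊛-0 (1-z² ^ β)))) (≡.trans (nC0≡1 β) (≡.sym (nC0≡1 (suc β)))) (1-z²-even β 0)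
  1-z²-even (suc β) (suc j) = begin
    ℤ.∣ (1-z² ^ suc β) (double (suc j)) ∣                              ≡⟨ ≡.cong ℤ.∣_∣ (1-z²-⊛-2 (1-z² ^ β) (double j)) ⟩
    ℤ.∣ (1-z² ^ β) (double (suc j)) ℤ.- (1-z² ^ β) (double j) ∣        ≤⟨ ℤₚ.∣i-j∣≤∣i∣+∣j∣ ((1-z² ^ β) (double (suc j))) ((1-z² ^ β) (double j)) ⟩
    ℤ.∣ (1-z² ^ β) (double (suc j)) ∣ ℕ.+ ℤ.∣ (1-z² ^ β) (double j) ∣  ≤⟨ ℕₚ.+-mono-≤ (1-z²-even β (suc j)) (1-z²-even β j) ⟩
    β C suc j ℕ.+ β C j                                                ≡⟨ ≡.trans (ℕₚ.+-comm (β C suc j) (β C j)) (nCk+nC[k+1]≡[n+1]C[k+1] β j) ⟩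
    suc β C suc j                                                      ∎
    where open ℕₚ.≤-Reasoning

  1-z²-odd : ∀ β j → (1-z² ^ β) (suc (double j)) ≡ + 0
  1-z²-odd zero    j       = refl
  1-z²-odd (suc β) zero    = ≡.trans (1-z²-⊛-1 (1-z² ^ β)) (1-z²-odd β 0)
  1-z²-odd (suc β) (suc j) = ≡.trans (1-z²-⊛-2 (1-z² ^ β) (suc (double j)))
    (≡.cong₂ ℤ._-_ (1-z²-odd β (suc j)) (1-z²-odd β j))

  -- A gain of 8 per degree: for r - |T| ≥ r / 2 this beats the 2 ^ r choices of T inside S, for which any gain above 4 would do.
  Dominated : ℕ → ℕ → Series → Series → Set
  Dominated a K f g = ∀ k → k ℕ.≤ K → ∃[ n ] (g k ≡ + n × a ℕ.* (8 ℕ.^ k ℕ.* ℤ.∣ f k ∣) ℕ.≤ n)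

  -- Dropping the head of f lowers its degrees by one and so gives up a factor 8. The scalar a in
  -- `Dominated` absorbs it: the recursion continues with 8 a.
  ⊛-dominated : ∀ {a b K f g f′ g′} → Dominated a K f g → Dominated b K f′ g′ → Dominated (a ℕ.* b) K (f ⊛ f′) (g ⊛ g′)
  ⊛-dominated {a} {b} {K} {f} {g} {f′} {g′} p p′ zero 0≤K =
    let (n , g≡ , ≤n) = p 0 z≤n; (n′ , g′≡ , ≤n′) = p′ 0 z≤n in
    n ℕ.* n′ , ≡.trans (≡.cong₂ ℤ._*_ g≡ g′≡) (≡.sym (ℤₚ.pos-* n n′)) , (begin
      a ℕ.* b ℕ.* (1 ℕ.* ℤ.∣ f 0 ℤ.* f′ 0 ∣)              ≡⟨ ≡.cong (λ e → a ℕ.* b ℕ.* (1 ℕ.* e)) (ℤₚ.abs-* (f 0) (f′ 0)) ⟩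
      a ℕ.* b ℕ.* (1 ℕ.* (ℤ.∣ f 0 ∣ ℕ.* ℤ.∣ f′ 0 ∣))      ≡⟨ solve 4 (λ a b x y → a :* b :* (con 1 :* (x :* y)) := (a :* (con 1 :* x)) :* (b :* (con 1 :* y))) refl a b ℤ.∣ f 0 ∣ ℤ.∣ f′ 0 ∣ ⟩
      (a ℕ.* (1 ℕ.* ℤ.∣ f 0 ∣)) ℕ.* (b ℕ.* (1 ℕ.* ℤ.∣ f′ 0 ∣))  ≤⟨ ℕₚ.*-mono-≤ ≤n ≤n′ ⟩
      n ℕ.* n′ ∎)
    where open ℕₚ.≤-Reasoning
  ⊛-dominated {a} {b} {suc K} {f} {g} {f′} {g′} p p′ (suc k) (s≤s k≤K) =
    let (n , g≡ , ≤n) = p 0 z≤n; (n′ , g′≡ , ≤n′) = p′ (suc k) (s≤s k≤K)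
        (t , t≡ , ≤t) = ⊛-dominated {a ℕ.* 8} {b} {K} {tail f} {tail g} {f′} {g′}
          (λ i i≤K → let (m , m≡ , ≤m) = p (suc i) (s≤s i≤K) in m , m≡ ,
            ℕₚ.≤-trans (ℕₚ.≤-reflexive (solve 3 (λ a x y → a :* con 8 :* (x :* y) := a :* (con 8 :* x :* y)) refl a (8 ℕ.^ i) ℤ.∣ f (suc i) ∣)) ≤m)
          (λ i i≤K → p′ i (ℕₚ.m≤n⇒m≤1+n i≤K)) k k≤K in
    n ℕ.* n′ ℕ.+ t , ≡.cong₂ ℤ._+_ (≡.trans (≡.cong₂ ℤ._*_ g≡ g′≡) (≡.sym (ℤₚ.pos-* n n′))) t≡ , (begin
      a ℕ.* b ℕ.* (8 ℕ.* 8 ℕ.^ k ℕ.* ℤ.∣ f 0 ℤ.* f′ (suc k) ℤ.+ (tail f ⊛ f′) k ∣)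
        ≤⟨ ℕₚ.*-monoʳ-≤ (a ℕ.* b) (ℕₚ.*-monoʳ-≤ (8 ℕ.* 8 ℕ.^ k) (ℤₚ.∣i+j∣≤∣i∣+∣j∣ (f 0 ℤ.* f′ (suc k)) ((tail f ⊛ f′) k))) ⟩
      a ℕ.* b ℕ.* (8 ℕ.* 8 ℕ.^ k ℕ.* (ℤ.∣ f 0 ℤ.* f′ (suc k) ∣ ℕ.+ ℤ.∣ (tail f ⊛ f′) k ∣))
        ≡⟨ ≡.cong (λ e → a ℕ.* b ℕ.* (8 ℕ.* 8 ℕ.^ k ℕ.* (e ℕ.+ ℤ.∣ (tail f ⊛ f′) k ∣))) (ℤₚ.abs-* (f 0) (f′ (suc k))) ⟩
      a ℕ.* b ℕ.* (8 ℕ.* 8 ℕ.^ k ℕ.* (ℤ.∣ f 0 ∣ ℕ.* ℤ.∣ f′ (suc k) ∣ ℕ.+ ℤ.∣ (tail f ⊛ f′) k ∣))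
        ≡⟨ solve 6 (λ a b e x y z → a :* b :* (con 8 :* e :* (x :* y :+ z))
             := (a :* (con 1 :* x)) :* (b :* (con 8 :* e :* y)) :+ a :* con 8 :* b :* (e :* z)) refl
             a b (8 ℕ.^ k) ℤ.∣ f 0 ∣ ℤ.∣ f′ (suc k) ∣ ℤ.∣ (tail f ⊛ f′) k ∣ ⟩
      (a ℕ.* (1 ℕ.* ℤ.∣ f 0 ∣)) ℕ.* (b ℕ.* (8 ℕ.* 8 ℕ.^ k ℕ.* ℤ.∣ f′ (suc k) ∣)) ℕ.+ a ℕ.* 8 ℕ.* b ℕ.* (8 ℕ.^ k ℕ.* ℤ.∣ (tail f ⊛ f′) k ∣)
        ≤⟨ ℕₚ.+-mono-≤ (ℕₚ.*-mono-≤ ≤n ≤n′) ≤t ⟩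
      n ℕ.* n′ ℕ.+ t ∎)
    where open ℕₚ.≤-Reasoning

  ^-dominated : ∀ {K f g} m → Dominated 1 K f g → Dominated 1 K (f ^ m) (g ^ m)
  ^-dominated zero    p zero    _ = 1 , refl , ℕₚ.≤-refl
  ^-dominated {K} zero p (suc k) _ = 0 , refl , ℕₚ.≤-reflexive (≡.trans (ℕₚ.*-identityˡ _) (ℕₚ.*-zeroʳ (8 ℕ.^ suc k)))
  ^-dominated {K} {f} {g} (suc m) p = ⊛-dominated {1} {1} {K} {f} {g} {f ^ m} {g ^ m} p (^-dominated m p)

  -- In degree one the gain 8 is exactly C(8, 1); this fixes the exponent 8.
  linear-dominated : ∀ {K} ε → ℤ.∣ ε ∣ ≡ 1 → Dominated 1 K (line (+ 1) ε) (1+z ^ 8)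
  linear-dominated ε ∣ε∣≡1 zero _ = 1 , binomial 8 0 , ℕₚ.≤-reflexive
    (≡.cong (λ e → 1 ℕ.* (1 ℕ.* ℤ.∣ e ∣)) {+ 1 ℤ.+ ε ℤ.* + 0} {+ 1} (≡.cong (λ e → + 1 ℤ.+ e) (ℤₚ.*-zeroʳ ε)))
  linear-dominated ε ∣ε∣≡1 (suc zero) _ = 8 , binomial 8 1 , ℕₚ.≤-reflexive
    (≡.cong (λ e → 1 ℕ.* (8 ℕ.* 1 ℕ.* e)) {ℤ.∣ line (+ 1) ε 1 ∣} {1}
      (≡.trans (≡.cong ℤ.∣_∣ (≡.trans (ℤₚ.+-identityˡ _) (≡.trans (const-⊛ ε Z 1) (ℤₚ.*-identityʳ ε)))) ∣ε∣≡1))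
  linear-dominated ε ∣ε∣≡1 (suc (suc k)) _ = 8 C suc (suc k) , binomial 8 (suc (suc k)) , ℕₚ.≤-trans (ℕₚ.≤-reflexive
    (≡.trans (≡.cong (λ e → 1 ℕ.* (8 ℕ.^ suc (suc k) ℕ.* ℤ.∣ e ∣)) {line (+ 1) ε (suc (suc k))} {+ 0}
      (≡.trans (ℤₚ.+-identityˡ _) (≡.trans (const-⊛ ε Z (suc (suc k))) (ℤₚ.*-zeroʳ ε))))
      (≡.trans (ℕₚ.*-identityˡ _) (ℕₚ.*-zeroʳ (8 ℕ.^ suc (suc k)))))) z≤n

  -- In degree 2j the claim is 64^j C(β, j) ≤ C(β, 2j), and j steps of `C-growth` give it; odd
  -- coefficients are zero.
  1-z²-dominated : ∀ {K β} → 65 ℕ.* K ℕ.≤ β → Dominated 1 K (1-z² ^ β) (1+z ^ β)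
  1-z²-dominated {K} {β} 65K≤β k k≤K = β C k , binomial β k , ≡.subst (ℕ._≤ β C k) (≡.sym (ℕₚ.*-identityˡ _)) (bound k (parity k) k≤K)
    where
    open ℕₚ.≤-Reasoning
    8^double : ∀ j → 8 ℕ.^ double j ≡ 64 ℕ.^ j
    8^double zero    = refl
    8^double (suc j) = ≡.trans (≡.cong (λ e → 8 ℕ.* (8 ℕ.* e)) (8^double j)) (≡.sym (ℕₚ.*-assoc 8 8 (64 ℕ.^ j)))
    bound : ∀ k → Parity k → k ℕ.≤ K → 8 ℕ.^ k ℕ.* ℤ.∣ (1-z² ^ β) k ∣ ℕ.≤ β C k
    bound _ (even j) k≤K = begin
      8 ℕ.^ double j ℕ.* ℤ.∣ (1-z² ^ β) (double j) ∣  ≤⟨ ℕₚ.*-monoʳ-≤ (8 ℕ.^ double j) (1-z²-even β j) ⟩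
      8 ℕ.^ double j ℕ.* (β C j)                      ≡⟨ ≡.cong (ℕ._* (β C j)) (8^double j) ⟩
      64 ℕ.^ j ℕ.* (β C j)                            ≤⟨ C-growth-^ β K j j (ℕₚ.≤-trans (ℕₚ.≤-reflexive (≡.sym (double≡ j))) k≤K) 65K≤β ⟩
      β C (j ℕ.+ j)                                   ≡⟨ ≡.cong (β C_) (double≡ j) ⟨
      β C double j                                    ∎
    bound _ (odd j) k≤K = ≡.subst (ℕ._≤ β C suc (double j))
      (≡.sym (≡.trans (≡.cong (λ e → 8 ℕ.^ suc (double j) ℕ.* ℤ.∣ e ∣) (1-z²-odd β j)) (ℕₚ.*-zeroʳ (8 ℕ.^ suc (double j))))) z≤n

  -- The β pairs are dominated by only β factors `1+z`, while 2 β + c are available. The spare β pay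
  -- for the 7 extra factors charged to each of the c unmatched ones.
  paired-bound : ∀ {K} β c ε → ℤ.∣ ε ∣ ≡ 1 → 7 ℕ.* c ℕ.≤ β → 65 ℕ.* K ℕ.≤ β → ∀ k → k ℕ.≤ K →
    8 ℕ.^ k ℕ.* ℤ.∣ (1-z² ^ β ⊛ line (+ 1) ε ^ c) k ∣ ℕ.≤ (β ℕ.+ (β ℕ.+ c)) C k
  paired-bound {K} β c ε ∣ε∣≡1 7c≤β 65K≤β k k≤K with
    ⊛-dominated {1} {1} {K} {1-z² ^ β} {1+z ^ β} {line (+ 1) ε ^ c} {(1+z ^ 8) ^ c} (1-z²-dominated 65K≤β) (^-dominated c (linear-dominated ε ∣ε∣≡1)) k k≤K
  ... | n , g≡ , ≤n = begin
    8 ℕ.^ k ℕ.* ℤ.∣ (1-z² ^ β ⊛ line (+ 1) ε ^ c) k ∣  ≡⟨ ℕₚ.*-identityˡ _ ⟨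
    1 ℕ.* (8 ℕ.^ k ℕ.* ℤ.∣ (1-z² ^ β ⊛ line (+ 1) ε ^ c) k ∣)  ≤⟨ ≤n ⟩
    n                                  ≡⟨ ℤₚ.+-injective (≡.trans (≡.sym g≡) (≡.trans product≡ (binomial (β ℕ.+ 8 ℕ.* c) k))) ⟩
    (β ℕ.+ 8 ℕ.* c) C k                ≤⟨ C-mono (ℕₚ.+-monoʳ-≤ β (ℕₚ.≤-trans (ℕₚ.+-monoʳ-≤ c 7c≤β) (ℕₚ.≤-reflexive (ℕₚ.+-comm c β)))) k ⟩
    (β ℕ.+ (β ℕ.+ c)) C k              ∎
    where
    open ℕₚ.≤-Reasoning
    product≡ : (1+z ^ β ⊛ (1+z ^ 8) ^ c) k ≡ (1+z ^ (β ℕ.+ 8 ℕ.* c)) k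
    product≡ = ≡.trans (*-congˡ {1+z ^ β} (ℤ⟦z⟧ᵣ.^-assocʳ 1+z 8 c) k) (≡.sym (^-homo-* 1+z β (8 ℕ.* c) k))

  private
    7c≤ : ∀ β c → 7 ℕ.* (β ℕ.+ c) ℕ.≤ 8 ℕ.* β → 7 ℕ.* c ℕ.≤ β
    7c≤ β c p = ℕₚ.+-cancelˡ-≤ (7 ℕ.* β) _ _ (ℕₚ.≤-trans (ℕₚ.≤-reflexive (≡.sym (ℕₚ.*-distribˡ-+ 7 β c)))
      (ℕₚ.≤-trans p (ℕₚ.≤-reflexive (solve 1 (λ β → con 8 :* β := con 7 :* β :+ β) refl β))))

  -- Matching each `1+z` with a `1-z` leaves c = |a - b| factors of one kind. With β the smaller
  -- exponent, 7 (β + c) ≤ 8 β is just 7 c ≤ β.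
  bias : ∀ {K} a b → 7 ℕ.* a ℕ.≤ 8 ℕ.* b → 7 ℕ.* b ℕ.≤ 8 ℕ.* a → 65 ℕ.* K ℕ.≤ a → 65 ℕ.* K ℕ.≤ b →
    ∀ k → k ℕ.≤ K → 8 ℕ.^ k ℕ.* ℤ.∣ (1+z ^ a ⊛ 1-z ^ b) k ∣ ℕ.≤ (a ℕ.+ b) C k
  bias {K} a b 7a≤8b 7b≤8a K≤a K≤b k k≤K with ℕₚ.≤-total a b
  ... | inj₁ a≤b = ≡.subst₂ (λ x y → 8 ℕ.^ k ℕ.* ℤ.∣ x ∣ ℕ.≤ y C k) (≡.sym eq) (≡.cong (a ℕ.+_) a+c≡b)
        (paired-bound a c -[1+ 0 ] refl (7c≤ a c (ℕₚ.≤-trans (ℕₚ.≤-reflexive (≡.cong (7 ℕ.*_) a+c≡b)) 7b≤8a)) K≤a k k≤K)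
    where
    c = b ℕ.∸ a
    a+c≡b : a ℕ.+ c ≡ b
    a+c≡b = ℕₚ.m+[n∸m]≡n a≤b
    eq : (1+z ^ a ⊛ 1-z ^ b) k ≡ (1-z² ^ a ⊛ 1-z ^ c) k
    eq = ≡.trans (≡.cong (λ e → (1+z ^ a ⊛ 1-z ^ e) k) (≡.sym a+c≡b))
      (≡.trans (*-congˡ {1+z ^ a} (^-homo-* 1-z a c) k)
      (≡.trans (≡.sym (⊛-assoc (1+z ^ a) (1-z ^ a) (1-z ^ c) k))
        (*-congʳ {1-z ^ c} (ℤ⟦z⟧ᵣ.sym (^-distrib-* 1+z 1-z a)) k)))
  ... | inj₂ b≤a = ≡.subst₂ (λ x y → 8 ℕ.^ k ℕ.* ℤ.∣ x ∣ ℕ.≤ y C k) (≡.sym eq) (≡.trans (≡.cong (b ℕ.+_) b+c≡a) (ℕₚ.+-comm b a))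
        (paired-bound b c (+ 1) refl (7c≤ b c (ℕₚ.≤-trans (ℕₚ.≤-reflexive (≡.cong (7 ℕ.*_) b+c≡a)) 7a≤8b)) K≤b k k≤K)
    where
    c = a ℕ.∸ b
    b+c≡a : b ℕ.+ c ≡ a
    b+c≡a = ℕₚ.m+[n∸m]≡n b≤a
    open import Algebra.Properties.CommutativeSemigroup ℤ⟦z⟧ᵣ.*-commutativeSemigroup using (xy∙z≈xz∙y)
    eq : (1+z ^ a ⊛ 1-z ^ b) k ≡ (1-z² ^ b ⊛ 1+z ^ c) k
    eq = ≡.trans (≡.cong (λ e → (1+z ^ e ⊛ 1-z ^ b) k) (≡.sym b+c≡a))
      (≡.trans (*-congʳ {1-z ^ b} (^-homo-* 1+z b c) k)
      (≡.trans (xy∙z≈xz∙y (1+z ^ b) (1+z ^ c) (1-z ^ b) k)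
        (*-congʳ {1+z ^ c} (ℤ⟦z⟧ᵣ.sym (^-distrib-* 1+z 1-z b)) k)))

-- Sums over subsets, products over a subset, and complements.

module SubsetSums where
  open Subset using (∣_∣)
  open ℤ.+-*-Solver using (solve; _:=_; _:+_; _:*_; con)

  Σ∀ : ∀ n → (Subset n → ℤ) → ℤ
  Σ∀ zero    f = f []
  Σ∀ (suc n) f = Σ∀ n (f ∘ (true ∷_)) ℤ.+ Σ∀ n (f ∘ (false ∷_))

  Σ∀-cong : ∀ n {f g} → (∀ S → f S ≡ g S) → Σ∀ n f ≡ Σ∀ n g
  Σ∀-cong zero    p = p []
  Σ∀-cong (suc n) p = ≡.cong₂ ℤ._+_ (Σ∀-cong n (p ∘ (true ∷_))) (Σ∀-cong n (p ∘ (false ∷_)))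

  Σ∀-+ : ∀ n f g → Σ∀ n (λ S → f S ℤ.+ g S) ≡ Σ∀ n f ℤ.+ Σ∀ n g
  Σ∀-+ zero    f g = refl
  Σ∀-+ (suc n) f g = ≡.trans (≡.cong₂ ℤ._+_ (Σ∀-+ n _ _) (Σ∀-+ n _ _))
    (solve 4 (λ a b c d → (a :+ b) :+ (c :+ d) := (a :+ c) :+ (b :+ d)) refl
      (Σ∀ n (f ∘ (true ∷_))) (Σ∀ n (g ∘ (true ∷_))) (Σ∀ n (f ∘ (false ∷_))) (Σ∀ n (g ∘ (false ∷_))))

  Σ∀-* : ∀ n c f → Σ∀ n (λ S → c ℤ.* f S) ≡ c ℤ.* Σ∀ n f
  Σ∀-* zero    c f = refl
  Σ∀-* (suc n) c f = ≡.trans (≡.cong₂ ℤ._+_ (Σ∀-* n c _) (Σ∀-* n c _)) (≡.sym (ℤₚ.*-distribˡ-+ c _ _))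

  Σ∀-0 : ∀ n → Σ∀ n (λ _ → + 0) ≡ + 0
  Σ∀-0 zero    = refl
  Σ∀-0 (suc n) = ≡.cong₂ ℤ._+_ (Σ∀-0 n) (Σ∀-0 n)

  Σ∀-swap : ∀ m n (f : Subset m → Subset n → ℤ) → Σ∀ m (λ S → Σ∀ n (f S)) ≡ Σ∀ n (λ T → Σ∀ m (λ S → f S T))
  Σ∀-swap zero    n f = refl
  Σ∀-swap (suc m) n f = ≡.trans (≡.cong₂ ℤ._+_ (Σ∀-swap m n (f ∘ (true ∷_))) (Σ∀-swap m n (f ∘ (false ∷_)))) (≡.sym (Σ∀-+ n _ _))

  Σ∀-bound : ∀ n m {f g : Subset n → ℤ} → (∀ S → + (m ℕ.* ℤ.∣ f S ∣) ℤ.≤ g S) → + (m ℕ.* ℤ.∣ Σ∀ n f ∣) ℤ.≤ Σ∀ n g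
  Σ∀-bound zero    m p = p []
  Σ∀-bound (suc n) m {f} {g} p = ℤₚ.≤-trans
    (ℤ.+≤+ (ℕₚ.≤-trans (ℕₚ.*-monoʳ-≤ m (ℤₚ.∣i+j∣≤∣i∣+∣j∣ (Σ∀ n (f ∘ (true ∷_))) (Σ∀ n (f ∘ (false ∷_)))))
      (ℕₚ.≤-reflexive (ℕₚ.*-distribˡ-+ m _ _))))
    (ℤₚ.+-mono-≤ (Σ∀-bound n m (p ∘ (true ∷_))) (Σ∀-bound n m (p ∘ (false ∷_))))

  Σ∀-split-∅ : ∀ n f → Σ∀ n f ≡ f (replicate n false) ℤ.+ Σ∀ n (λ S → if ∣ S ∣ ≡ᵇ 0 then + 0 else f S)
  Σ∀-split-∅ zero    f = ≡.sym (ℤₚ.+-identityʳ (f []))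
  Σ∀-split-∅ (suc n) f = ≡.trans (≡.cong (λ e → Σ∀ n (f ∘ (true ∷_)) ℤ.+ e) (Σ∀-split-∅ n (f ∘ (false ∷_))))
    (solve 3 (λ a b c → a :+ (b :+ c) := b :+ (a :+ c)) refl (Σ∀ n (f ∘ (true ∷_)))
      (f (replicate (suc n) false)) (Σ∀ n (λ S → if ∣ S ∣ ≡ᵇ 0 then + 0 else f (false ∷ S))))

  filter-map : ∀ {A B : Set} (b : B → Bool) (f : A → B) xs →
    length (filter (λ S → b S Bool.≟ true) (map f xs)) ≡ length (filter (λ x → b (f x) Bool.≟ true) xs)
  filter-map b f [] = refl
  filter-map b f (x ∷ xs) with b (f x)
  ... | true  = ≡.cong suc (filter-map b f xs)
  ... | false = filter-map b f xs

  count-Σ∀ : ∀ n (b : Subset n → Bool) →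
    + length (filter (λ S → b S Bool.≟ true) (allSubsets n)) ≡ Σ∀ n (λ S → if b S then + 1 else + 0)
  count-Σ∀ zero b with b []
  ... | true  = refl
  ... | false = refl
  count-Σ∀ (suc n) b = begin
    + length (filter B? (map (true ∷_) (allSubsets n) ++ map (false ∷_) (allSubsets n)))
      ≡⟨ ≡.cong (λ l → + length l) (filter-++ B? (map (true ∷_) (allSubsets n)) _) ⟩
    + length (filter B? (map (true ∷_) (allSubsets n)) ++ filter B? (map (false ∷_) (allSubsets n)))
      ≡⟨ ≡.cong +_ (length-++ (filter B? (map (true ∷_) (allSubsets n)))) ⟩
    + length (filter B? (map (true ∷_) (allSubsets n))) ℤ.+ + length (filter B? (map (false ∷_) (allSubsets n)))
      ≡⟨ ≡.cong₂ (λ x y → + x ℤ.+ + y) (filter-map b (true ∷_) (allSubsets n)) (filter-map b (false ∷_) (allSubsets n)) ⟩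
    + length (filter (λ S → b (true ∷ S) Bool.≟ true) (allSubsets n)) ℤ.+ + length (filter (λ S → b (false ∷ S) Bool.≟ true) (allSubsets n))
      ≡⟨ ≡.cong₂ ℤ._+_ (count-Σ∀ n (b ∘ (true ∷_))) (count-Σ∀ n (b ∘ (false ∷_))) ⟩
    Σ∀ (suc n) (λ S → if b S then + 1 else + 0) ∎
    where
    open ≡.≡-Reasoning
    B? = λ S → b S Bool.≟ true

  ∏∈ : ∀ {n} → Subset n → (Fin n → ℤ) → ℤ
  ∏∈ []          f = + 1
  ∏∈ (true  ∷ S) f = f zero ℤ.* ∏∈ S (f ∘ suc)
  ∏∈ (false ∷ S) f = ∏∈ S (f ∘ suc)

  ∏∈-cong : ∀ {n} (S : Subset n) {f g} → (∀ i → f i ≡ g i) → ∏∈ S f ≡ ∏∈ S g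
  ∏∈-cong []          p = refl
  ∏∈-cong (true  ∷ S) p = ≡.cong₂ ℤ._*_ (p zero) (∏∈-cong S (p ∘ suc))
  ∏∈-cong (false ∷ S) p = ∏∈-cong S (p ∘ suc)

  ∏∈-* : ∀ {n} (S : Subset n) f g → ∏∈ S (λ i → f i ℤ.* g i) ≡ ∏∈ S f ℤ.* ∏∈ S g
  ∏∈-* []          f g = refl
  ∏∈-* (true  ∷ S) f g = ≡.trans (≡.cong (λ e → f zero ℤ.* g zero ℤ.* e) (∏∈-* S (f ∘ suc) (g ∘ suc)))
    (solve 4 (λ a b c d → (a :* b) :* (c :* d) := (a :* c) :* (b :* d)) refl (f zero) (g zero) (∏∈ S (f ∘ suc)) (∏∈ S (g ∘ suc)))
  ∏∈-* (false ∷ S) f g = ∏∈-* S (f ∘ suc) (g ∘ suc)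

  ∏∈-1 : ∀ {n} (S : Subset n) {f} → (∀ i → f i ≡ + 1) → ∏∈ S f ≡ + 1
  ∏∈-1 []          p = refl
  ∏∈-1 (true  ∷ S) p = ≡.cong₂ ℤ._*_ (p zero) (∏∈-1 S (p ∘ suc))
  ∏∈-1 (false ∷ S) p = ∏∈-1 S (p ∘ suc)

  ∏∈-square : ∀ {n} (S : Subset n) {f} → (∀ i → f i ℤ.* f i ≡ + 1) → ∏∈ S f ℤ.* ∏∈ S f ≡ + 1
  ∏∈-square S {f} p = ≡.trans (≡.sym (∏∈-* S f f)) (∏∈-1 S p)

  ∏∈-swap : ∀ {m n} (S : Subset m) (T : Subset n) (f : Fin m → Fin n → ℤ) →
    ∏∈ S (λ i → ∏∈ T (f i)) ≡ ∏∈ T (λ j → ∏∈ S (λ i → f i j))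
  ∏∈-swap []          T f = ≡.sym (∏∈-1 T (λ _ → refl))
  ∏∈-swap (true  ∷ S) T f = ≡.trans (≡.cong (λ e → ∏∈ T (f zero) ℤ.* e) (∏∈-swap S T (f ∘ suc))) (≡.sym (∏∈-* T _ _))
  ∏∈-swap (false ∷ S) T f = ∏∈-swap S T (f ∘ suc)

  -- The factors m i j and m j i occur together and multiply to 1. Applied to adjacency signs this
  -- is the handshake lemma: the number of vertices of odd degree is even.
  ∏∈-symmetric : ∀ {n} (S : Subset n) (m : Fin n → Fin n → ℤ) → (∀ i j → m i j ≡ m j i) → (∀ i → m i i ≡ + 1) →
    (∀ i j → m i j ℤ.* m i j ≡ + 1) → ∏∈ S (λ j → ∏∈ S (λ i → m i j)) ≡ + 1
  ∏∈-symmetric []          m sy di sq = refl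
  ∏∈-symmetric (false ∷ S) m sy di sq = ∏∈-symmetric S (λ i j → m (suc i) (suc j)) (λ i j → sy _ _) (λ i → di _) (λ i j → sq _ _)
  ∏∈-symmetric (true ∷ S) m sy di sq = begin
    m zero zero ℤ.* A ℤ.* ∏∈ S (λ j → m zero (suc j) ℤ.* ∏∈ S (λ i → m (suc i) (suc j)))
      ≡⟨ ≡.cong₂ (λ x y → x ℤ.* A ℤ.* y) (di zero) (∏∈-* S _ _) ⟩
    + 1 ℤ.* A ℤ.* (∏∈ S (λ j → m zero (suc j)) ℤ.* ∏∈ S (λ j → ∏∈ S (λ i → m (suc i) (suc j))))
      ≡⟨ ≡.cong₂ (λ x y → + 1 ℤ.* A ℤ.* (x ℤ.* y)) (∏∈-cong S (λ j → sy zero (suc j)))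
           (∏∈-symmetric S (λ i j → m (suc i) (suc j)) (λ i j → sy _ _) (λ i → di _) (λ i j → sq _ _)) ⟩
    + 1 ℤ.* A ℤ.* (A ℤ.* + 1)
      ≡⟨ solve 1 (λ a → con (+ 1) :* a :* (a :* con (+ 1)) := a :* a) refl A ⟩
    A ℤ.* A
      ≡⟨ ∏∈-square S (λ i → sq (suc i) zero) ⟩
    + 1 ∎
    where
    open ≡.≡-Reasoning
    A = ∏∈ S (λ i → m (suc i) zero)

  -- The indicator of containment, integer valued so that a sum over the subsets of S becomes a sum
  -- over all subsets, whose order can be exchanged.
  within : ∀ {n} → Subset n → Subset n → ℤ
  within []          []          = + 1
  within (true  ∷ T) (false ∷ S) = + 0
  within (true  ∷ T) (true  ∷ S) = within T S
  within (false ∷ T) (_     ∷ S) = within T S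

  infix 4 _⊑_

  data _⊑_ : ∀ {n} → Subset n → Subset n → Set where
    []   : [] ⊑ []
    keep : ∀ {n} {T S : Subset n} → T ⊑ S → (true ∷ T) ⊑ (true ∷ S)
    drop : ∀ {n b} {T S : Subset n} → T ⊑ S → (false ∷ T) ⊑ (b ∷ S)

  within-⊑ : ∀ {n} (T S : Subset n) → within T S ≡ + 0 ⊎ T ⊑ S
  within-⊑ []          []          = inj₂ []
  within-⊑ (true  ∷ T) (false ∷ S) = inj₁ refl
  within-⊑ (true  ∷ T) (true  ∷ S) with within-⊑ T S
  ... | inj₁ z = inj₁ z
  ... | inj₂ p = inj₂ (keep p)
  within-⊑ (false ∷ T) (b ∷ S) with within-⊑ T S
  ... | inj₁ z = inj₁ z
  ... | inj₂ p = inj₂ (drop p)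

  within-cong : ∀ {n} {T S : Subset n} {x y} → (T ⊑ S → x ≡ y) → within T S ℤ.* x ≡ within T S ℤ.* y
  within-cong {T = T} {S} {x} {y} p with within-⊑ T S
  ... | inj₁ z rewrite z = ≡.trans (ℤₚ.*-zeroˡ x) (≡.sym (ℤₚ.*-zeroˡ y))
  ... | inj₂ T⊑S = ≡.cong (within T S ℤ.*_) (p T⊑S)

  ∏∈-expand : ∀ {n} (S : Subset n) ε → ∏∈ S (λ v → + 1 ℤ.+ ε v) ≡ Σ∀ n (λ T → within T S ℤ.* ∏∈ T ε)
  ∏∈-expand [] ε = refl
  ∏∈-expand {suc n} (true ∷ S) ε = begin
    (+ 1 ℤ.+ ε zero) ℤ.* ∏∈ S (λ v → + 1 ℤ.+ ε (suc v))
      ≡⟨ ≡.cong ((+ 1 ℤ.+ ε zero) ℤ.*_) (∏∈-expand S (ε ∘ suc)) ⟩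
    (+ 1 ℤ.+ ε zero) ℤ.* X
      ≡⟨ solve 2 (λ e x → (con (+ 1) :+ e) :* x := e :* x :+ x) refl (ε zero) X ⟩
    ε zero ℤ.* X ℤ.+ X
      ≡⟨ ≡.cong (ℤ._+ X) (Σ∀-* n (ε zero) _) ⟨
    Σ∀ n (λ T → ε zero ℤ.* (within T S ℤ.* ∏∈ T (ε ∘ suc))) ℤ.+ X
      ≡⟨ ≡.cong (ℤ._+ X) (Σ∀-cong n λ T → solve 3 (λ e w p → e :* (w :* p) := w :* (e :* p)) refl (ε zero) (within T S) (∏∈ T (ε ∘ suc))) ⟩
    Σ∀ n (λ T → within T S ℤ.* (ε zero ℤ.* ∏∈ T (ε ∘ suc))) ℤ.+ X ∎
    where
    open ≡.≡-Reasoning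
    X = Σ∀ n (λ T → within T S ℤ.* ∏∈ T (ε ∘ suc))
  ∏∈-expand {suc n} (false ∷ S) ε = ≡.trans (∏∈-expand S (ε ∘ suc))
    (≡.trans (≡.sym (ℤₚ.+-identityˡ _)) (≡.cong (ℤ._+ Σ∀ n (λ T → within T S ℤ.* ∏∈ T (ε ∘ suc))) (≡.sym (Σ∀-0 n))))

  _∖_ : ∀ {n} → Subset n → Subset n → Subset n
  []          ∖ []          = []
  (false ∷ S) ∖ (_     ∷ T) = false ∷ (S ∖ T)
  (true  ∷ S) ∖ (true  ∷ T) = false ∷ (S ∖ T)
  (true  ∷ S) ∖ (false ∷ T) = true ∷ (S ∖ T)

  Σ∀-complement : ∀ {n} (S : Subset n) (h : Subset n → ℤ) → Σ∀ n (λ T → within T S ℤ.* h T) ≡ Σ∀ n (λ T → within T S ℤ.* h (S ∖ T))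
  Σ∀-complement [] h = refl
  Σ∀-complement {suc n} (true  ∷ S) h = ≡.trans (ℤₚ.+-comm (Σ∀ n (λ T → within T S ℤ.* h (true ∷ T))) _) (≡.cong₂ ℤ._+_ (Σ∀-complement S (h ∘ (false ∷_))) (Σ∀-complement S (h ∘ (true ∷_))))
  Σ∀-complement {suc n} (false ∷ S) h = ≡.cong₂ ℤ._+_
    (Σ∀-cong n λ T → ≡.trans (ℤₚ.*-zeroˡ (h (true ∷ T))) (≡.sym (ℤₚ.*-zeroˡ (h (false ∷ (S ∖ T)))))) (Σ∀-complement S (h ∘ (false ∷_)))

  ∏∈-∖ : ∀ {n} {T S : Subset n} → T ⊑ S → ∀ f → ∏∈ (S ∖ T) f ℤ.* ∏∈ T f ≡ ∏∈ S f
  ∏∈-∖ [] f = refl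
  ∏∈-∖ {T = true ∷ T} {true ∷ S} (keep p) f = ≡.trans
    (solve 3 (λ a b c → a :* (b :* c) := b :* (a :* c)) refl (∏∈ (S ∖ T) (f ∘ suc)) (f zero) (∏∈ T (f ∘ suc)))
    (≡.cong (f zero ℤ.*_) (∏∈-∖ p (f ∘ suc)))
  ∏∈-∖ {T = false ∷ T} {true ∷ S} (drop p) f = ≡.trans (ℤₚ.*-assoc (f zero) _ _) (≡.cong (f zero ℤ.*_) (∏∈-∖ p (f ∘ suc)))
  ∏∈-∖ {S = false ∷ S} (drop p) f = ∏∈-∖ p (f ∘ suc)

  ∣∖∣ : ∀ {n} {T S : Subset n} → T ⊑ S → ∣ S ∖ T ∣ ℕ.+ ∣ T ∣ ≡ ∣ S ∣
  ∣∖∣ [] = refl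
  ∣∖∣ {T = true ∷ T} {true ∷ S} (keep p) = ≡.trans (ℕₚ.+-suc _ _) (≡.cong suc (∣∖∣ p))
  ∣∖∣ {T = false ∷ T} {true  ∷ S} (drop p) = ≡.cong suc (∣∖∣ p)
  ∣∖∣ {T = false ∷ T} {false ∷ S} (drop p) = ∣∖∣ p

  -- The weights θ a b and θ b a, which add up to 2, put all the mass of a complementary pair T, S ∖ T on its smaller member.
  θ : ℕ → ℕ → ℕ
  θ zero    zero    = 1
  θ zero    (suc b) = 2
  θ (suc a) zero    = 0
  θ (suc a) (suc b) = θ a b

  θ-sum : ∀ a b → θ a b ℕ.+ θ b a ≡ 2
  θ-sum zero    zero    = refl
  θ-sum zero    (suc b) = refl
  θ-sum (suc a) zero    = refl
  θ-sum (suc a) (suc b) = θ-sum a b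

  θ≤2 : ∀ a b → θ a b ℕ.≤ 2
  θ≤2 a b = ℕₚ.≤-trans (ℕₚ.m≤m+n (θ a b) (θ b a)) (ℕₚ.≤-reflexive (θ-sum a b))

  θ-cases : ∀ a b → θ a b ≡ 0 ⊎ a ℕ.≤ b
  θ-cases zero    b       = inj₂ z≤n
  θ-cases (suc a) zero    = inj₁ refl
  θ-cases (suc a) (suc b) with θ-cases a b
  ... | inj₁ z = inj₁ z
  ... | inj₂ p = inj₂ (s≤s p)

  -- Twice the sum is split by `θ-sum`; reindexing the second part by complements swaps the
  -- arguments of `θ` and reproduces the first. Afterwards only T with at most half the elements of
  -- S carry weight.
  Σ∀-halve : ∀ {n} (S : Subset n) (h : Subset n → ℤ) → (∀ {T} → T ⊑ S → h (S ∖ T) ≡ h T) →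
    Σ∀ n (λ T → within T S ℤ.* h T) ≡ Σ∀ n (λ T → within T S ℤ.* (+ θ ∣ T ∣ (∣ S ∣ ℕ.∸ ∣ T ∣) ℤ.* h T))
  Σ∀-halve {n} S h sym = ℤₚ.*-cancelˡ-≡ (+ 2) _ _ (begin
    + 2 ℤ.* Σ∀ n (λ T → within T S ℤ.* h T)
      ≡⟨ Σ∀-* n (+ 2) _ ⟨
    Σ∀ n (λ T → + 2 ℤ.* (within T S ℤ.* h T))
      ≡⟨ Σ∀-cong n (λ T → ≡.trans (≡.cong (λ e → + e ℤ.* (within T S ℤ.* h T)) (≡.sym (θ-sum ∣ T ∣ (∣ S ∣ ℕ.∸ ∣ T ∣))))
           (solve 4 (λ a b w h → (a :+ b) :* (w :* h) := w :* (a :* h) :+ w :* (b :* h)) refl (+ θ ∣ T ∣ (∣ S ∣ ℕ.∸ ∣ T ∣)) (+ θ (∣ S ∣ ℕ.∸ ∣ T ∣) ∣ T ∣) (within T S) (h T))) ⟩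
    Σ∀ n (λ T → within T S ℤ.* (+ θ ∣ T ∣ (∣ S ∣ ℕ.∸ ∣ T ∣) ℤ.* h T) ℤ.+ within T S ℤ.* (+ θ (∣ S ∣ ℕ.∸ ∣ T ∣) ∣ T ∣ ℤ.* h T))
      ≡⟨ Σ∀-+ n _ _ ⟩
    Y ℤ.+ Σ∀ n (λ T → within T S ℤ.* (+ θ (∣ S ∣ ℕ.∸ ∣ T ∣) ∣ T ∣ ℤ.* h T))
      ≡⟨ ≡.cong (λ e → Y ℤ.+ e) (≡.trans (Σ∀-complement S (λ T → + θ (∣ S ∣ ℕ.∸ ∣ T ∣) ∣ T ∣ ℤ.* h T)) (Σ∀-cong n λ T → within-cong {T = T} {S} λ T⊑S →
           ≡.cong₂ ℤ._*_ (≡.cong₂ (λ a b → + θ a b) (small T⊑S) (large T⊑S)) (sym T⊑S))) ⟩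
    Y ℤ.+ Y
      ≡⟨ solve 1 (λ y → y :+ y := con (+ 2) :* y) refl Y ⟩
    + 2 ℤ.* Y ∎)
    where
    open ≡.≡-Reasoning
    Y = Σ∀ n (λ T → within T S ℤ.* (+ θ ∣ T ∣ (∣ S ∣ ℕ.∸ ∣ T ∣) ℤ.* h T))
    large : ∀ {T} → T ⊑ S → ∣ S ∖ T ∣ ≡ ∣ S ∣ ℕ.∸ ∣ T ∣
    large {T} p = ≡.trans (≡.sym (ℕₚ.m+n∸n≡m ∣ S ∖ T ∣ ∣ T ∣)) (≡.cong (ℕ._∸ ∣ T ∣) (∣∖∣ p))
    small : ∀ {T} → T ⊑ S → ∣ S ∣ ℕ.∸ ∣ S ∖ T ∣ ≡ ∣ T ∣
    small {T} p = ≡.trans (≡.cong (ℕ._∸ ∣ S ∖ T ∣) (≡.sym (∣∖∣ p))) (ℕₚ.m+n∸m≡n ∣ S ∖ T ∣ ∣ T ∣)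

  Σ∀-within : ∀ {n} (S : Subset n) → Σ∀ n (λ T → within T S) ≡ + (2 ℕ.^ ∣ S ∣)
  Σ∀-within [] = refl
  Σ∀-within (true ∷ S) = ≡.trans (≡.cong₂ ℤ._+_ (Σ∀-within S) (Σ∀-within S)) (≡.cong (λ e → + (2 ℕ.^ ∣ S ∣ ℕ.+ e)) (≡.sym (ℕₚ.+-identityʳ _)))
  Σ∀-within {suc n} (false ∷ S) = ≡.trans (≡.cong₂ ℤ._+_ (Σ∀-0 n) (Σ∀-within S)) (ℤₚ.+-identityˡ _)

  sized : ∀ {n} → ℕ → Subset n → ℤ
  sized r S = if ∣ S ∣ ≡ᵇ r then + 1 else + 0

  sized-cong : ∀ {n} r (S : Subset n) {x y} → (∣ S ∣ ≡ r → x ≡ y) → sized r S ℤ.* x ≡ sized r S ℤ.* y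
  sized-cong r S {x} {y} p with ∣ S ∣ ≡ᵇ r in eq
  ... | true  = ≡.cong (+ 1 ℤ.*_) (p (ℕₚ.≡ᵇ⇒≡ ∣ S ∣ r (≡.subst Bool.T (≡.sym eq) _)))
  ... | false = ≡.trans (ℤₚ.*-zeroˡ x) (≡.sym (ℤₚ.*-zeroˡ y))

  Σ∀-sized : ∀ n r → Σ∀ n (sized r) ≡ + (n C r)
  Σ∀-sized zero    zero    = refl
  Σ∀-sized zero    (suc r) = refl
  Σ∀-sized (suc n) zero    = ≡.trans (≡.cong₂ ℤ._+_ (Σ∀-0 n) (Σ∀-sized n 0)) (≡.cong +_ (≡.trans (BinomialBias.nC0≡1 n) (≡.sym (BinomialBias.nC0≡1 (suc n)))))
  Σ∀-sized (suc n) (suc r) = ≡.trans (≡.cong₂ ℤ._+_ (Σ∀-sized n r) (Σ∀-sized n (suc r))) (≡.cong +_ (nCk+nC[k+1]≡[n+1]C[k+1] n r))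

-- Signed counts of supersets as power series coefficients.

module GeneratingFunction where
  open Subset using (∣_∣)
  open SubsetSums
  open ℤ⟦z⟧
  open ℤ⟦z⟧ᵣ using (_^_; *-congʳ)
  open BinomialBias using (1+z; 1-z)
  open ℤ.+-*-Solver using (solve; _:=_; _:*_)

  factor : Bool → ℤ → Series
  factor b e = line (if b then + 0 else + 1) e

  -- The generating function, by size, of the sets S containing T, weighted by the product of η over
  -- S. An element of T has to be chosen, so its factor lacks the term 1.
  gen : ∀ {n} → Subset n → (Fin n → ℤ) → Series
  gen []      η = const (+ 1)
  gen (b ∷ T) η = factor b (η zero) ⊛ gen T (η ∘ suc)

  weight : ∀ {n} → ℕ → Subset n → (Fin n → ℤ) → Subset n → ℤ
  weight r T η S = sized r S ℤ.* (within T S ℤ.* ∏∈ S η)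

  gen-coefficient : ∀ {n} (T : Subset n) η r → Σ∀ n (weight r T η) ≡ gen T η r
  gen-coefficient [] η zero    = refl
  gen-coefficient [] η (suc r) = refl
  gen-coefficient {suc n} (b ∷ T) η zero = begin
    Σ∀ n (weight 0 (b ∷ T) η ∘ (true ∷_)) ℤ.+ Σ∀ n (weight 0 (b ∷ T) η ∘ (false ∷_))
      ≡⟨ ≡.cong₂ ℤ._+_ (≡.trans (Σ∀-cong n λ S → ℤₚ.*-zeroˡ (within (b ∷ T) (true ∷ S) ℤ.* ∏∈ (true ∷ S) η)) (Σ∀-0 n)) (absent b) ⟩
    + 0 ℤ.+ (if b then + 0 else + 1) ℤ.* Σ∀ n (weight 0 T (η ∘ suc))
      ≡⟨ ≡.trans (ℤₚ.+-identityˡ _) (≡.cong ((if b then + 0 else + 1) ℤ.*_) (gen-coefficient T (η ∘ suc) 0)) ⟩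
    (if b then + 0 else + 1) ℤ.* gen T (η ∘ suc) 0
      ≡⟨ line-⊛-zero (if b then + 0 else + 1) (η zero) (gen T (η ∘ suc)) ⟨
    gen (b ∷ T) η 0 ∎
    where
    open ≡.≡-Reasoning
    absent : ∀ b → Σ∀ n (weight 0 (b ∷ T) η ∘ (false ∷_)) ≡ (if b then + 0 else + 1) ℤ.* Σ∀ n (weight 0 T (η ∘ suc))
    absent true  = ≡.trans (Σ∀-cong n λ S → ℤₚ.*-zeroʳ (sized 0 S)) (≡.trans (Σ∀-0 n) (≡.sym (ℤₚ.*-zeroˡ (Σ∀ n (weight 0 T (η ∘ suc))))))
    absent false = ≡.sym (ℤₚ.*-identityˡ _)
  gen-coefficient {suc n} (b ∷ T) η (suc r) = begin
    Σ∀ n (weight (suc r) (b ∷ T) η ∘ (true ∷_)) ℤ.+ Σ∀ n (weight (suc r) (b ∷ T) η ∘ (false ∷_))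
      ≡⟨ ℤₚ.+-comm (Σ∀ n (weight (suc r) (b ∷ T) η ∘ (true ∷_))) _ ⟩
    Σ∀ n (weight (suc r) (b ∷ T) η ∘ (false ∷_)) ℤ.+ Σ∀ n (weight (suc r) (b ∷ T) η ∘ (true ∷_))
      ≡⟨ ≡.cong₂ ℤ._+_ (absent b) (present b) ⟩
    (if b then + 0 else + 1) ℤ.* Σ∀ n (weight (suc r) T (η ∘ suc)) ℤ.+ η zero ℤ.* Σ∀ n (weight r T (η ∘ suc))
      ≡⟨ ≡.cong₂ (λ x y → (if b then + 0 else + 1) ℤ.* x ℤ.+ η zero ℤ.* y) (gen-coefficient T (η ∘ suc) (suc r)) (gen-coefficient T (η ∘ suc) r) ⟩
    (if b then + 0 else + 1) ℤ.* gen T (η ∘ suc) (suc r) ℤ.+ η zero ℤ.* gen T (η ∘ suc) r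
      ≡⟨ line-⊛-suc (if b then + 0 else + 1) (η zero) (gen T (η ∘ suc)) r ⟨
    gen (b ∷ T) η (suc r) ∎
    where
    open ≡.≡-Reasoning
    absent : ∀ b → Σ∀ n (weight (suc r) (b ∷ T) η ∘ (false ∷_)) ≡ (if b then + 0 else + 1) ℤ.* Σ∀ n (weight (suc r) T (η ∘ suc))
    absent true  = ≡.trans (Σ∀-cong n λ S → ℤₚ.*-zeroʳ (sized (suc r) S)) (≡.trans (Σ∀-0 n) (≡.sym (ℤₚ.*-zeroˡ (Σ∀ n (weight (suc r) T (η ∘ suc))))))
    absent false = ≡.sym (ℤₚ.*-identityˡ _)
    within-true : ∀ b S → within (b ∷ T) (true ∷ S) ≡ within T S
    within-true true  S = refl
    within-true false S = refl
    present : ∀ b → Σ∀ n (weight (suc r) (b ∷ T) η ∘ (true ∷_)) ≡ η zero ℤ.* Σ∀ n (weight r T (η ∘ suc))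
    present b = ≡.trans (Σ∀-cong n λ S → ≡.trans (≡.cong (λ w → sized r S ℤ.* (w ℤ.* (η zero ℤ.* ∏∈ S (η ∘ suc)))) (within-true b S))
      (solve 4 (λ s w e p → s :* (w :* (e :* p)) := e :* (s :* (w :* p))) refl (sized r S) (within T S) (η zero) (∏∈ S (η ∘ suc))))
      (Σ∀-* n (η zero) (weight r T (η ∘ suc)))

  -- The points outside T are kept as lists of distinct points, the form in which the level-set
  -- bound takes them; only their lengths enter the exponents. `sign` collects the values of η on T.
  record Factorisation {n} (T : Subset n) (η : Fin n → ℤ) : Set where
    field
      plus minus   : List (Fin n)
      plus-unique  : Unique plus
      minus-unique : Unique minus
      plus-holds   : All (λ i → lookup T i ≡ false × η i ≡ + 1) plus
      minus-holds  : All (λ i → lookup T i ≡ false × η i ≡ -[1+ 0 ]) minus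
      total        : length plus ℕ.+ length minus ℕ.+ ∣ T ∣ ≡ n
      sign         : ℤ
      sign-unit    : ℤ.∣ sign ∣ ≡ 1
      factored     : gen T η ≋ const sign ⊛ (Z ^ ∣ T ∣ ⊛ (1+z ^ length plus ⊛ 1-z ^ length minus))

  private
    unique-suc : ∀ {n} {xs : List (Fin n)} → Unique xs → Unique (map suc xs)
    unique-suc = Unique.map⁺ Fin.suc-injective

    unique-zero∷ : ∀ {n} {xs : List (Fin n)} → Unique xs → Unique (zero ∷ map suc xs)
    unique-zero∷ {xs = xs} u = All.map⁺ (All.universal (λ _ ()) xs) ∷ unique-suc u

    module S where
      open import Algebra.Solver.Ring.NaturalCoefficients.Default ℤ⟦z⟧ᵣ.commutativeSemiring public using (solve; _:=_; _:*_)

  factorise : ∀ {n} (T : Subset n) η → (∀ i → η i ≡ + 1 ⊎ η i ≡ -[1+ 0 ]) → Factorisation T η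
  factorise [] η h = record
    { plus = [] ; minus = [] ; plus-unique = [] ; minus-unique = [] ; plus-holds = [] ; minus-holds = [] ; total = refl
    ; sign = + 1 ; sign-unit = refl
    ; factored = ℤ⟦z⟧ᵣ.sym (ℤ⟦z⟧ᵣ.trans (⊛-identityˡ _) (ℤ⟦z⟧ᵣ.trans (⊛-identityˡ _) (⊛-identityˡ (const (+ 1))))) }
  factorise (true ∷ T) η h = record
    { plus = map suc plus ; minus = map suc minus
    ; plus-unique = unique-suc plus-unique ; minus-unique = unique-suc minus-unique
    ; plus-holds = All.map⁺ plus-holds ; minus-holds = All.map⁺ minus-holds
    ; total = ≡.trans (≡.cong₂ (λ a b → a ℕ.+ b ℕ.+ suc ∣ T ∣) (length-map suc plus) (length-map suc minus))
                (≡.trans (ℕₚ.+-suc _ _) (≡.cong suc total))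
    ; sign = η zero ℤ.* sign
    ; sign-unit = ≡.trans (ℤₚ.abs-* (η zero) sign) (≡.cong₂ ℕ._*_ (unit (h zero)) sign-unit)
    ; factored = ℤ⟦z⟧ᵣ.trans (⊛-cong 0-line factored) (ℤ⟦z⟧ᵣ.trans
        (S.solve 5 (λ e z s t b → (e S.:* z) S.:* (s S.:* (t S.:* b)) S.:= (e S.:* s) S.:* ((z S.:* t) S.:* b)) ℤ⟦z⟧ᵣ.refl
          (const (η zero)) Z (const sign) (Z ^ ∣ T ∣) (1+z ^ length plus ⊛ 1-z ^ length minus))
        (ℤ⟦z⟧ᵣ.trans (*-congʳ {Z ^ suc ∣ T ∣ ⊛ (1+z ^ length plus ⊛ 1-z ^ length minus)} (λ k → ≡.sym (const-mul (η zero) sign k)))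
          (λ k → ≡.cong₂ (λ a b → (const (η zero ℤ.* sign) ⊛ (Z ^ suc ∣ T ∣ ⊛ (1+z ^ a ⊛ 1-z ^ b))) k)
            (≡.sym (length-map suc plus)) (≡.sym (length-map suc minus))))) }
    where
    open Factorisation (factorise T (η ∘ suc) (h ∘ suc))
    unit : ∀ {e} → e ≡ + 1 ⊎ e ≡ -[1+ 0 ] → ℤ.∣ e ∣ ≡ 1
    unit (inj₁ refl) = refl
    unit (inj₂ refl) = refl
    0-line : line (+ 0) (η zero) ≋ const (η zero) ⊛ Z
    0-line k = ≡.trans (≡.cong (ℤ._+ (const (η zero) ⊛ Z) k) (const-0 k)) (ℤₚ.+-identityˡ _)
    const-mul : ∀ a b → const (a ℤ.* b) ≋ const a ⊛ const b
    const-mul a b zero    = refl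
    const-mul a b (suc k) = ≡.sym (≡.trans (const-⊛ a (const b) (suc k)) (ℤₚ.*-zeroʳ a))
  factorise (false ∷ T) η h with h zero
  ... | inj₁ η₀≡1 = record
    { plus = zero ∷ map suc plus ; minus = map suc minus
    ; plus-unique = unique-zero∷ plus-unique ; minus-unique = unique-suc minus-unique
    ; plus-holds = (refl , η₀≡1) ∷ All.map⁺ plus-holds ; minus-holds = All.map⁺ minus-holds
    ; total = ≡.trans (≡.cong₂ (λ a b → suc a ℕ.+ b ℕ.+ ∣ T ∣) (length-map suc plus) (length-map suc minus)) (≡.cong suc total)
    ; sign = sign ; sign-unit = sign-unit
    ; factored = ℤ⟦z⟧ᵣ.trans (⊛-cong (λ k → ≡.cong (λ e → line (+ 1) e k) η₀≡1) factored) (ℤ⟦z⟧ᵣ.trans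
        (S.solve 5 (λ l s t p m → l S.:* (s S.:* (t S.:* (p S.:* m))) S.:= s S.:* (t S.:* ((l S.:* p) S.:* m))) ℤ⟦z⟧ᵣ.refl
          1+z (const sign) (Z ^ ∣ T ∣) (1+z ^ length plus) (1-z ^ length minus))
          (λ k → ≡.cong₂ (λ a b → (const sign ⊛ (Z ^ ∣ T ∣ ⊛ (1+z ^ suc a ⊛ 1-z ^ b))) k)
            (≡.sym (length-map suc plus)) (≡.sym (length-map suc minus)))) }
    where open Factorisation (factorise T (η ∘ suc) (h ∘ suc))
  ... | inj₂ η₀≡-1 = record
    { plus = map suc plus ; minus = zero ∷ map suc minus
    ; plus-unique = unique-suc plus-unique ; minus-unique = unique-zero∷ minus-unique
    ; plus-holds = All.map⁺ plus-holds ; minus-holds = (refl , η₀≡-1) ∷ All.map⁺ minus-holds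
    ; total = ≡.trans (≡.cong₂ (λ a b → a ℕ.+ suc b ℕ.+ ∣ T ∣) (length-map suc plus) (length-map suc minus))
                (≡.trans (≡.cong (ℕ._+ ∣ T ∣) (ℕₚ.+-suc _ _)) (≡.cong suc total))
    ; sign = sign ; sign-unit = sign-unit
    ; factored = ℤ⟦z⟧ᵣ.trans (⊛-cong (λ k → ≡.cong (λ e → line (+ 1) e k) η₀≡-1) factored) (ℤ⟦z⟧ᵣ.trans
        (S.solve 5 (λ l s t p m → l S.:* (s S.:* (t S.:* (p S.:* m))) S.:= s S.:* (t S.:* (p S.:* (l S.:* m)))) ℤ⟦z⟧ᵣ.refl
          1-z (const sign) (Z ^ ∣ T ∣) (1+z ^ length plus) (1-z ^ length minus))
          (λ k → ≡.cong₂ (λ a b → (const sign ⊛ (Z ^ ∣ T ∣ ⊛ (1+z ^ a ⊛ 1-z ^ suc b))) k)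
            (≡.sym (length-map suc plus)) (≡.sym (length-map suc minus)))) }
    where open Factorisation (factorise T (η ∘ suc) (h ∘ suc))

  gen-1 : ∀ {n} (T : Subset n) m → m ℕ.+ ∣ T ∣ ≡ n → gen T (λ _ → + 1) ≋ Z ^ ∣ T ∣ ⊛ 1+z ^ m
  gen-1 [] zero refl = ℤ⟦z⟧ᵣ.sym (⊛-identityˡ (const (+ 1)))
  gen-1 (true ∷ T) m eq = ℤ⟦z⟧ᵣ.trans
    (⊛-cong 0-line (gen-1 T m (ℕₚ.suc-injective (≡.trans (≡.sym (ℕₚ.+-suc m ∣ T ∣)) eq))))
    (ℤ⟦z⟧ᵣ.sym (⊛-assoc Z (Z ^ ∣ T ∣) (1+z ^ m)))
    where
    0-line : line (+ 0) (+ 1) ≋ Z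
    0-line k = ≡.trans (≡.cong (ℤ._+ (const (+ 1) ⊛ Z) k) (const-0 k)) (≡.trans (ℤₚ.+-identityˡ _) (⊛-identityˡ Z k))
  gen-1 (false ∷ T) zero eq = contradiction eq (ℕₚ.<⇒≢ (s≤s (∣p∣≤n T)))
  gen-1 (false ∷ T) (suc m) eq = ℤ⟦z⟧ᵣ.trans (⊛-cong {f = 1+z} (λ _ → refl) (gen-1 T m (ℕₚ.suc-injective eq)))
    (x∙yz≈y∙xz 1+z (Z ^ ∣ T ∣) (1+z ^ m))
    where open import Algebra.Properties.CommutativeSemigroup ℤ⟦z⟧ᵣ.*-commutativeSemigroup using (x∙yz≈y∙xz)

  Z^-shift : ∀ t g k → (Z ^ t ⊛ g) (t ℕ.+ k) ≡ g k
  Z^-shift zero    g k = ⊛-identityˡ g k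
  Z^-shift (suc t) g k = ≡.trans (⊛-assoc Z (Z ^ t) g (suc t ℕ.+ k)) (≡.trans (Z-⊛-suc (Z ^ t ⊛ g) (t ℕ.+ k)) (Z^-shift t g k))

  -- A nearly balanced sign pattern makes the signed count of supersets exponentially smaller than the unsigned one.
  superset-bias : ∀ {n} (T : Subset n) η (f : Factorisation T η) → let open Factorisation f in ∀ k →
    7 ℕ.* length plus ℕ.≤ 8 ℕ.* length minus → 7 ℕ.* length minus ℕ.≤ 8 ℕ.* length plus →
    65 ℕ.* k ℕ.≤ length plus → 65 ℕ.* k ℕ.≤ length minus →
    + (8 ℕ.^ k ℕ.* ℤ.∣ gen T η (∣ T ∣ ℕ.+ k) ∣) ℤ.≤ gen T (λ _ → + 1) (∣ T ∣ ℕ.+ k)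
  superset-bias T η f k 7a≤8b 7b≤8a K≤a K≤b = ≡.subst₂ (λ x y → + (8 ℕ.^ k ℕ.* x) ℤ.≤ y) (≡.sym lhs) (≡.sym rhs)
    (ℤ.+≤+ (BinomialBias.bias (length plus) (length minus) 7a≤8b 7b≤8a K≤a K≤b k ℕₚ.≤-refl))
    where
    open Factorisation f
    B = 1+z ^ length plus ⊛ 1-z ^ length minus
    lhs : ℤ.∣ gen T η (∣ T ∣ ℕ.+ k) ∣ ≡ ℤ.∣ B k ∣
    lhs = ≡.trans (≡.cong ℤ.∣_∣ (≡.trans (factored (∣ T ∣ ℕ.+ k)) (const-⊛ sign (Z ^ ∣ T ∣ ⊛ B) (∣ T ∣ ℕ.+ k))))
      (≡.trans (ℤₚ.abs-* sign ((Z ^ ∣ T ∣ ⊛ B) (∣ T ∣ ℕ.+ k)))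
        (≡.trans (≡.cong₂ ℕ._*_ sign-unit (≡.cong ℤ.∣_∣ (Z^-shift ∣ T ∣ B k))) (ℕₚ.*-identityˡ _)))
    rhs : gen T (λ _ → + 1) (∣ T ∣ ℕ.+ k) ≡ + ((length plus ℕ.+ length minus) C k)
    rhs = ≡.trans (gen-1 T (length plus ℕ.+ length minus) total (∣ T ∣ ℕ.+ k))
      (≡.trans (Z^-shift ∣ T ∣ (1+z ^ (length plus ℕ.+ length minus)) k) (BinomialBias.binomial (length plus ℕ.+ length minus) k))

-- Parity conditions as products of signs.

module ParitySums where
  open Subset using (∣_∣)
  open SubsetSums
  open ℤ.+-*-Solver using (solve; _:=_; _:*_; con)

  -1^ : ℕ → ℤ
  -1^ zero    = + 1
  -1^ (suc m) = -[1+ 0 ] ℤ.* -1^ m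

  -1^-parity : ∀ m → -1^ m ≡ (if m ℕ.% 2 ≡ᵇ 0 then + 1 else -[1+ 0 ])
  -1^-parity zero          = refl
  -1^-parity (suc zero)    = refl
  -1^-parity (suc (suc m)) = ≡.trans (solve 1 (λ x → con -[1+ 0 ] :* (con -[1+ 0 ] :* x) := x) refl (-1^ m)) (-1^-parity m)

  -- A general g allows the induction to pass to `g ∘ suc`; with g = `id` the filtered list is the
  -- one that `degIn` counts.
  ∏∈-signs : ∀ {n} {A : Set} (S : Subset n) (c : Fin n → Bool) (p : A → Bool) (g : Fin n → A) →
    (∀ i → p (g i) ≡ lookup S i ∧ c i) →
    ∏∈ S (λ i → if c i then -[1+ 0 ] else + 1) ≡ -1^ (length (filter (λ x → p x Bool.≟ true) (tabulate g)))
  ∏∈-signs [] c p g h = refl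
  ∏∈-signs (b ∷ S) c p g h with p (g zero) | h zero
  ∏∈-signs (true ∷ S) c p g h | _ | refl with c zero
  ... | true  = ≡.cong (-[1+ 0 ] ℤ.*_) (∏∈-signs S (c ∘ suc) p (g ∘ suc) (h ∘ suc))
  ... | false = ≡.trans (ℤₚ.*-identityˡ _) (∏∈-signs S (c ∘ suc) p (g ∘ suc) (h ∘ suc))
  ∏∈-signs (false ∷ S) c p g h | _ | refl = ∏∈-signs S (c ∘ suc) p (g ∘ suc) (h ∘ suc)

  -- Each factor is 2 or 0, so a single failing vertex annihilates the product.
  ∏∈-all : ∀ {n} {A : Set} (S : Subset n) (e : Fin n → Bool) (p : A → Bool) (g : Fin n → A) →
    (∀ i → p (g i) ≡ not (lookup S i) ∨ e i) →
    ∏∈ S (λ i → + 1 ℤ.+ (if e i then + 1 else -[1+ 0 ])) ≡ (if all p (tabulate g) then + (2 ℕ.^ ∣ S ∣) else + 0)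
  ∏∈-all [] e p g h = refl
  ∏∈-all (b ∷ S) e p g h with p (g zero) | h zero
  ∏∈-all (false ∷ S) e p g h | _ | refl = ∏∈-all S (e ∘ suc) p (g ∘ suc) (h ∘ suc)
  ∏∈-all (true ∷ S) e p g h | _ | refl with e zero
  ... | false = ℤₚ.*-zeroˡ (∏∈ S (λ i → + 1 ℤ.+ (if e (suc i) then + 1 else -[1+ 0 ])))
  ... | true  = ≡.trans (≡.cong (+ 2 ℤ.*_) (∏∈-all S (e ∘ suc) p (g ∘ suc) (h ∘ suc))) (double (all p (tabulate (g ∘ suc))))
    where
    double : ∀ b → + 2 ℤ.* (if b then + (2 ℕ.^ ∣ S ∣) else + 0) ≡ (if b then + (2 ℕ.^ suc ∣ S ∣) else + 0)
    double true  = ≡.sym (ℤₚ.pos-* 2 (2 ℕ.^ ∣ S ∣))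
    double false = refl

any-true : ∀ {n} {A : Set} (p : A → Bool) (g : Fin n → A) → any p (tabulate g) ≡ true → ∃[ i ] p (g i) ≡ true
any-true {suc n} p g eq with p (g zero) in e
... | true  = zero , e
... | false = let (i , pi) = any-true p (g ∘ suc) eq in suc i , pi

any-false : ∀ {n} {A : Set} (p : A → Bool) (g : Fin n → A) → any p (tabulate g) ≡ false → ∀ i → p (g i) ≡ false
any-false {suc n} p g eq i with p (g zero) in e
any-false {suc n} p g eq zero    | false = e
any-false {suc n} p g eq (suc i) | false = any-false p (g ∘ suc) eq i

-- Since 15 · 17 = 255, the first inequality has a slack of one q out of 256, which covers 256 t.
-- The constant 2112 = 32 · 65 + 32 serves the second, where k and t are both at most r.
balanced : ∀ {a b t q k r} → a ℕ.+ b ℕ.+ t ≡ q → 32 ℕ.* a ℕ.≤ 17 ℕ.* q → t ℕ.≤ r → k ℕ.≤ r → 2112 ℕ.* r ℕ.≤ q →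
  7 ℕ.* a ℕ.≤ 8 ℕ.* b × 65 ℕ.* k ℕ.≤ b
balanced {a} {b} {t} {q} {k} {r} sum a≤ t≤r k≤r r≤q =
    ℕₚ.*-cancelˡ-≤ 32 (ℕₚ.+-cancelʳ-≤ (256 ℕ.* a ℕ.+ 256 ℕ.* t) _ _ (begin
      32 ℕ.* (7 ℕ.* a) ℕ.+ (256 ℕ.* a ℕ.+ 256 ℕ.* t)
        ≡⟨ solve 2 (λ a t → con 32 :* (con 7 :* a) :+ (con 256 :* a :+ con 256 :* t) := con 15 :* (con 32 :* a) :+ con 256 :* t) refl a t ⟩
      15 ℕ.* (32 ℕ.* a) ℕ.+ 256 ℕ.* t
        ≤⟨ ℕₚ.+-mono-≤ (ℕₚ.*-monoʳ-≤ 15 a≤) (ℕₚ.≤-trans (ℕₚ.*-mono-≤ (ℕₚ.m≤m+n 256 1856) t≤r) r≤q) ⟩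
      15 ℕ.* (17 ℕ.* q) ℕ.+ q
        ≡⟨ solve 1 (λ q → con 15 :* (con 17 :* q) :+ q := con 256 :* q) refl q ⟩
      256 ℕ.* q
        ≡⟨ ≡.cong (256 ℕ.*_) sum ⟨
      256 ℕ.* (a ℕ.+ b ℕ.+ t)
        ≡⟨ solve 3 (λ a b t → con 256 :* (a :+ b :+ t) := con 32 :* (con 8 :* b) :+ (con 256 :* a :+ con 256 :* t)) refl a b t ⟩
      32 ℕ.* (8 ℕ.* b) ℕ.+ (256 ℕ.* a ℕ.+ 256 ℕ.* t) ∎))
  , ℕₚ.*-cancelˡ-≤ 32 (ℕₚ.+-cancelʳ-≤ (32 ℕ.* a ℕ.+ 32 ℕ.* t) _ _ (begin
      32 ℕ.* (65 ℕ.* k) ℕ.+ (32 ℕ.* a ℕ.+ 32 ℕ.* t)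
        ≤⟨ ℕₚ.+-mono-≤ (ℕₚ.*-monoʳ-≤ 32 (ℕₚ.*-monoʳ-≤ 65 k≤r)) (ℕₚ.+-mono-≤ a≤ (ℕₚ.*-monoʳ-≤ 32 t≤r)) ⟩
      32 ℕ.* (65 ℕ.* r) ℕ.+ (17 ℕ.* q ℕ.+ 32 ℕ.* r)
        ≡⟨ solve 2 (λ r q → con 32 :* (con 65 :* r) :+ (con 17 :* q :+ con 32 :* r) := con 2112 :* r :+ con 17 :* q) refl r q ⟩
      2112 ℕ.* r ℕ.+ 17 ℕ.* q
        ≤⟨ ℕₚ.+-monoˡ-≤ (17 ℕ.* q) r≤q ⟩
      18 ℕ.* q
        ≤⟨ ℕₚ.*-monoˡ-≤ q (ℕₚ.m≤m+n 18 14) ⟩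
      32 ℕ.* q
        ≡⟨ ≡.cong (32 ℕ.*_) sum ⟨
      32 ℕ.* (a ℕ.+ b ℕ.+ t)
        ≡⟨ solve 3 (λ a b t → con 32 :* (a :+ b :+ t) := con 32 :* b :+ (con 32 :* a :+ con 32 :* t)) refl a b t ⟩
      32 ℕ.* b ℕ.+ (32 ℕ.* a ℕ.+ 32 ℕ.* t) ∎))
  where
  open ℕₚ.≤-Reasoning
  open +-*-Solver using (solve; _:=_; _:+_; _:*_; con)

-- Adjacency signs and the quadratic character.

module PaleySigns {q} (F : FiniteField q) (m : ℕ) (q≡ : q ≡ suc ((suc m ℕ.+ suc m) ℕ.+ (suc m ℕ.+ suc m))) where
  open Subset using (∣_∣)
  open Field F
  open Fermat F
  open Paley F
  open SubsetSums

  -- This is (q - 1) / 2, visibly even for the sake of -1, and by computation equal to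
  -- `suc (m + suc m)`, the form the earlier modules expect.
  N/2 : ℕ
  N/2 = suc m ℕ.+ suc m

  1^ : ∀ k → 1# ^ k ≡ 1#
  1^ zero    = refl
  1^ (suc k) = ≡.trans (*-identityˡ _) (1^ k)

  ==-true : ∀ {x y} → (x == y) ≡ true → x ≡ y
  ==-true {x} {y} eq with x ≟ y
  ... | yes p = p

  square-true : ∀ {y} → isNonzeroSquare y ≡ true → ∃[ z ] z * z ≡ y
  square-true {y} eq with y ≟ 0#
  ... | no _ = let (z , e) = any-true (λ z → (z * z) == y) id eq in z , ==-true e

  square-false : ∀ {y} → y ≢ 0# → isNonzeroSquare y ≡ false → ∀ z → z * z ≢ y
  square-false {y} y≢0 eq z zz≡y with y ≟ 0#
  ... | yes y≡0 = y≢0 y≡0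
  ... | no _ = contradiction (≡.trans (≡.sym (dec-true (z * z ≟ y) zz≡y)) (any-false (λ z → (z * z) == y) id eq z)) λ ()

  square-intro : ∀ {y} → y ≢ 0# → ∀ {z} → z * z ≡ y → isNonzeroSquare y ≡ true
  square-intro {y} y≢0 {z} zz≡y with isNonzeroSquare y in eq
  ... | true  = refl
  ... | false = contradiction zz≡y (square-false y≢0 eq z)

  euler-true : ∀ {y} → y ≢ 0# → isNonzeroSquare y ≡ true → y ^ N/2 ≡ 1#
  euler-true {y} y≢0 eq = let (z , zz≡y) = square-true eq in
    ≡.trans (≡.cong (_^ N/2) (≡.sym zz≡y)) (≡.trans (^-distrib-* z z N/2) (≡.trans (≡.sym (^-homo-* z N/2 N/2))
      (^-order (m ℕ.+ suc m) q≡ λ z≡0 → y≢0 (≡.trans (≡.sym zz≡y) (≡.trans (≡.cong (_* z) z≡0) (zeroˡ z))))))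

  euler-false : ∀ {y} → y ≢ 0# → isNonzeroSquare y ≡ false → y ^ N/2 ≡ - 1#
  euler-false y≢0 eq with ^-half (m ℕ.+ suc m) q≡ y≢0
  ... | inj₁ y^≡1 = contradiction y^≡1 (nonsquare-^ (m ℕ.+ suc m) q≡ (square-false y≢0 eq))
  ... | inj₂ y^≡-1 = y^≡-1

  -x*-x : ∀ x → - x * - x ≡ x * x
  -x*-x x = ≡.trans (≡.sym (-‿distribˡ-* x (- x))) (≡.trans (≡.cong -_ (≡.sym (-‿distribʳ-* x x))) (-‿involutive (x * x)))

  -- q ≡ 1 (mod 4) enters here: (-1) ^ ((q - 1) / 2) = 1.
  -1-square : ∃[ w ] w * w ≡ - 1#
  -1-square with Fin.any? (λ w → w * w ≟ - 1#)
  ... | yes p = p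
  ... | no np = contradiction -1^≡1 (nonsquare-^ (m ℕ.+ suc m) q≡ λ z e → np (z , e))
    where
    -1^≡1 : (- 1#) ^ N/2 ≡ 1#
    -1^≡1 = ≡.trans (^-homo-* (- 1#) (suc m) (suc m)) (≡.trans (≡.sym (^-distrib-* (- 1#) (- 1#) (suc m)))
      (≡.trans (≡.cong (_^ suc m) (≡.trans (-x*-x 1#) (*-identityˡ 1#))) (1^ (suc m))))

  -‿swap : ∀ u v → - (u - v) ≡ v - u
  -‿swap u v = ≡.trans (≡.sym (-‿+-comm u (- v))) (≡.trans (≡.cong (λ e → - u + e) (-‿involutive v)) (+-comm (- u) v))

  square-neg : ∀ {u v} → u ≢ v → isNonzeroSquare (u - v) ≡ true → isNonzeroSquare (v - u) ≡ true
  square-neg {u} {v} u≢v eq = let (z , zz≡) = square-true eq; (w , ww≡) = -1-square in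
    square-intro (-≢0 (u≢v ∘ ≡.sym)) {w * z} (begin
      (w * z) * (w * z)  ≡⟨ interchange w z w z ⟩
      (w * w) * (z * z)  ≡⟨ ≡.cong₂ _*_ ww≡ zz≡ ⟩
      - 1# * (u - v)     ≡⟨ -1*x≈-x _ ⟩
      - (u - v)          ≡⟨ -‿swap u v ⟩
      v - u              ∎)
    where
    open ≡.≡-Reasoning
    open import Algebra.Properties.CommutativeSemigroup *-commutativeSemigroup using (interchange)

  adj-sym : ∀ {u v} → u ≢ v → adj u v ≡ adj v u
  adj-sym {u} {v} u≢v with adj u v in e | adj v u in e′
  ... | true  | true  = refl
  ... | false | false = refl
  ... | true  | false = contradiction (≡.trans (≡.sym (square-neg u≢v e)) e′) λ ()
  ... | false | true  = contradiction (≡.trans (≡.sym (square-neg (u≢v ∘ ≡.sym) e′)) e) λ ()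

  -- Written exactly as the test inside `degIn`, so that `∏∈-signs` applies with `refl`.
  joined : Fin q → Fin q → Bool
  joined u v = not (u == v) ∧ adj u v

  σ : Fin q → Fin q → ℤ
  σ u v = if joined u v then -[1+ 0 ] else + 1

  joined-self : ∀ u → joined u u ≡ false
  joined-self u = ≡.cong (λ b → not b ∧ adj u u) (dec-true (u ≟ u) refl)

  joined-≢ : ∀ {u v} → u ≢ v → joined u v ≡ adj u v
  joined-≢ {u} {v} u≢v = ≡.cong (λ b → not b ∧ adj u v) (dec-false (u ≟ v) u≢v)

  σ-self : ∀ u → σ u u ≡ + 1
  σ-self u = ≡.cong (if_then -[1+ 0 ] else + 1) (joined-self u)

  σ-sym : ∀ u v → σ u v ≡ σ v u
  σ-sym u v = cases (u ≟ v)
    where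
    cases : Dec (u ≡ v) → σ u v ≡ σ v u
    cases (yes refl) = refl
    cases (no u≢v)   = ≡.cong (if_then -[1+ 0 ] else + 1)
      (≡.trans (joined-≢ u≢v) (≡.trans (adj-sym u≢v) (≡.sym (joined-≢ (u≢v ∘ ≡.sym)))))

  σ-unit : ∀ u v → σ u v ≡ + 1 ⊎ σ u v ≡ -[1+ 0 ]
  σ-unit u v with joined u v
  ... | true  = inj₂ refl
  ... | false = inj₁ refl

  -- Carries a sign from ℤ into the field, so that a product of signs can be followed factor by
  -- factor on both sides.
  data SameSign : ℤ → Fin q → Set where
    plus  : ∀ {y} → y ≡ 1# → SameSign (+ 1) y
    minus : ∀ {y} → y ≡ - 1# → SameSign -[1+ 0 ] y

  sameSign-* : ∀ {i j x y} → SameSign i x → SameSign j y → SameSign (i ℤ.* j) (x * y)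
  sameSign-* (plus  refl) (plus  refl) = plus (*-identityˡ 1#)
  sameSign-* (plus  refl) (minus refl) = minus (*-identityˡ (- 1#))
  sameSign-* (minus refl) (plus  refl) = minus (*-identityʳ (- 1#))
  sameSign-* (minus refl) (minus refl) = plus (≡.trans (-x*-x 1#) (*-identityˡ 1#))

  -- Adjacency has sign -1 but a nonzero square has character 1: the sign is minus the quadratic
  -- character.
  σ-sameSign : ∀ {u v} → u ≢ v → SameSign (σ u v) (- 1# * (u - v) ^ N/2)
  σ-sameSign {u} {v} u≢v rewrite joined-≢ u≢v with adj u v in e
  ... | true  = minus (≡.trans (≡.cong ((- 1#) *_) (euler-true (-≢0 u≢v) e)) (*-identityʳ (- 1#)))
  ... | false = plus (≡.trans (≡.cong ((- 1#) *_) (euler-false (-≢0 u≢v) e)) (≡.trans (-x*-x 1#) (*-identityˡ 1#)))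

  elements : ∀ {n} → Subset n → (Fin n → Fin q) → List (Fin q)
  elements []          g = []
  elements (true  ∷ T) g = g zero ∷ elements T (g ∘ suc)
  elements (false ∷ T) g = elements T (g ∘ suc)

  length-elements : ∀ {n} (T : Subset n) g → length (elements T g) ≡ ∣ T ∣
  length-elements []          g = refl
  length-elements (true  ∷ T) g = ≡.cong suc (length-elements T (g ∘ suc))
  length-elements (false ∷ T) g = length-elements T (g ∘ suc)

  elements-all : ∀ {n} (T : Subset n) g {P : Fin q → Set} → (∀ i → lookup T i ≡ true → P (g i)) → All P (elements T g)
  elements-all []          g p = []
  elements-all (true  ∷ T) g p = p zero refl ∷ elements-all T (g ∘ suc) (p ∘ suc)
  elements-all (false ∷ T) g p = elements-all T (g ∘ suc) (p ∘ suc)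

  elements-∷ : ∀ {n} (T : Subset n) g → (∀ {i j} → g i ≡ g j → i ≡ j) → ∣ T ∣ ≢ 0 →
    ∃[ a ] ∃[ as ] (elements T g ≡ a ∷ as × All (a ≢_) as)
  elements-∷ []          g inj ne = contradiction refl ne
  elements-∷ (true  ∷ T) g inj ne = g zero , elements T (g ∘ suc) , refl ,
    elements-all T (g ∘ suc) λ i _ e → contradiction (inj e) λ ()
  elements-∷ (false ∷ T) g inj ne = elements-∷ T (g ∘ suc) (Fin.suc-injective ∘ inj) ne

  η : Subset q → Fin q → ℤ
  η T u = ∏∈ T (σ u)

  -- By multiplicativity the signs towards T combine into the character of the single value f(u), up
  -- to one factor -1 for each element of T.
  ∏-sameSign : ∀ {n} (T : Subset n) g u → (∀ i → lookup T i ≡ true → u ≢ g i) →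
    SameSign (∏∈ T (σ u ∘ g)) ((- 1#) ^ ∣ T ∣ * Q.fromRoots (elements T g) u ^ N/2)
  ∏-sameSign []          g u p = plus (≡.trans (*-identityˡ _) (1^ N/2))
  ∏-sameSign (false ∷ T) g u p = ∏-sameSign T (g ∘ suc) u (p ∘ suc)
  ∏-sameSign (true  ∷ T) g u p = ≡.subst (SameSign _) (begin
    (- 1# * (u - g zero) ^ N/2) * ((- 1#) ^ ∣ T ∣ * R ^ N/2)  ≡⟨ interchange (- 1#) _ _ _ ⟩
    (- 1# * (- 1#) ^ ∣ T ∣) * ((u - g zero) ^ N/2 * R ^ N/2)  ≡⟨ ≡.cong ((- 1# * (- 1#) ^ ∣ T ∣) *_) (^-distrib-* (u - g zero) R N/2) ⟨
    (- 1# * (- 1#) ^ ∣ T ∣) * ((u - g zero) * R) ^ N/2        ∎)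
    (sameSign-* (σ-sameSign (p zero refl)) (∏-sameSign T (g ∘ suc) u (p ∘ suc)))
    where
    open ≡.≡-Reasoning
    open import Algebra.Properties.CommutativeSemigroup *-commutativeSemigroup using (interchange)
    R = Q.fromRoots (elements T (g ∘ suc)) u

-- Counting even subsets, with an explicit error bound.

module Counting {q} (F : FiniteField q) (m : ℕ) (q≡ : q ≡ suc ((suc m ℕ.+ suc m) ℕ.+ (suc m ℕ.+ suc m))) where
  open Subset using (∣_∣)
  open Field F
  open Paley F
  open Nonvanishing F (m ℕ.+ suc m) q≡ using (fromRoots-≢0)
  open HalfBound F (m ℕ.+ suc m) q≡
  open PaleySigns F m q≡
  open SubsetSums
  open GeneratingFunction
  open ParitySums
  open ℤ.+-*-Solver using (solve; _:=_; _:*_)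

  ∏∈-unit : ∀ {n} (T : Subset n) {f} → (∀ i → f i ≡ + 1 ⊎ f i ≡ -[1+ 0 ]) → ∏∈ T f ≡ + 1 ⊎ ∏∈ T f ≡ -[1+ 0 ]
  ∏∈-unit []          p = inj₁ refl
  ∏∈-unit (false ∷ T) p = ∏∈-unit T (p ∘ suc)
  ∏∈-unit (true  ∷ T) p with p zero | ∏∈-unit T (p ∘ suc)
  ... | inj₁ e | inj₁ e′ rewrite e | e′ = inj₁ refl
  ... | inj₁ e | inj₂ e′ rewrite e | e′ = inj₂ refl
  ... | inj₂ e | inj₁ e′ rewrite e | e′ = inj₂ refl
  ... | inj₂ e | inj₂ e′ rewrite e | e′ = inj₁ refl

  sameSign-plus : ∀ {i y} → SameSign i y → i ≡ + 1 → y ≡ 1#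
  sameSign-plus (plus p) refl = p

  sameSign-minus : ∀ {i y} → SameSign i y → i ≡ -[1+ 0 ] → y ≡ - 1#
  sameSign-minus (minus p) refl = p

  module _ (T : Subset q) (T≢∅ : ∣ T ∣ ≢ 0) where

    private
      -- As κ is its own inverse, the points outside T where η has the field sign e lie in the level
      -- set of f^((q-1)/2) with value κ e.
      κ : Fin q
      κ = (- 1#) ^ ∣ T ∣

      roots = elements T id

      κκ≡1 : κ * κ ≡ 1#
      κκ≡1 = ≡.trans (≡.sym (^-distrib-* (- 1#) (- 1#) ∣ T ∣))
        (≡.trans (≡.cong (_^ ∣ T ∣) (≡.trans (-x*-x 1#) (*-identityˡ 1#))) (1^ ∣ T ∣))

      ∉T : ∀ {x} → lookup T x ≡ false → ∀ i → lookup T i ≡ true → x ≢ i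
      ∉T x∉T i i∈T refl = contradiction (≡.trans (≡.sym i∈T) x∉T) λ ()

      level : ∀ {x e} → lookup T x ≡ false → κ * Q.fromRoots roots x ^ N/2 ≡ e →
        Q.fromRoots roots x ≢ 0# × Q.fromRoots roots x ^ N/2 ≡ κ * e
      level {x} {e} x∉T eq = fromRoots-≢0 (elements-all T id (∉T x∉T)) , (begin
        f^              ≡⟨ *-identityˡ _ ⟨
        1# * f^         ≡⟨ ≡.cong (_* f^) κκ≡1 ⟨
        κ * κ * f^      ≡⟨ *-assoc κ κ f^ ⟩
        κ * (κ * f^)    ≡⟨ ≡.cong (κ *_) eq ⟩
        κ * e           ∎)
        where
        open ≡.≡-Reasoning
        f^ = Q.fromRoots roots x ^ N/2

      size-bound : 6401 ℕ.* (∣ T ∣ ℕ.* ∣ T ∣) ℕ.< q → ∀ c xs → Unique xs →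
        All (λ x → Q.fromRoots roots x ≢ 0# × Q.fromRoots roots x ^ N/2 ≡ c) xs → 32 ℕ.* length xs ℕ.≤ 17 ℕ.* q
      size-bound small c xs un hyp with elements T id | elements-∷ T id id T≢∅ | length-elements T id
      ... | _ | a , as , refl , a∉as | len =
        level-set-≤ a∉as (≡.subst (λ d → 6401 ℕ.* (d ℕ.* d) ℕ.< q) (≡.sym len) small) c xs un hyp

    small-set-bias : ∀ k → let r = ∣ T ∣ ℕ.+ k in 6401 ℕ.* (r ℕ.* r) ℕ.< q →
      + (8 ℕ.^ k ℕ.* ℤ.∣ gen T (η T) r ∣) ℤ.≤ gen T (λ _ → + 1) r
    small-set-bias k small = superset-bias T (η T) f k (proj₁ bal) (proj₁ bal′) (proj₂ bal′) (proj₂ bal)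
      where
      f = factorise T (η T) (λ u → ∏∈-unit T (σ-unit u))
      open Factorisation f renaming (plus to xs; minus to ys)
      r = ∣ T ∣ ℕ.+ k
      t≤r : ∣ T ∣ ℕ.≤ r
      t≤r = ℕₚ.m≤m+n ∣ T ∣ k
      t-small : 6401 ℕ.* (∣ T ∣ ℕ.* ∣ T ∣) ℕ.< q
      t-small = ℕₚ.≤-<-trans (ℕₚ.*-monoʳ-≤ 6401 (ℕₚ.*-mono-≤ t≤r t≤r)) small
      r-small : 2112 ℕ.* r ℕ.≤ q
      r-small = ℕₚ.≤-trans (ℕₚ.*-mono-≤ (ℕₚ.m≤m+n 2112 4289) (ℕₚ.m≤m*n r r {{ℕ.≢-nonZero λ r≡0 → T≢∅ (ℕₚ.m+n≡0⇒m≡0 ∣ T ∣ r≡0)}})) (ℕₚ.<⇒≤ small)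
      xs≤ : 32 ℕ.* length xs ℕ.≤ 17 ℕ.* q
      xs≤ = size-bound t-small (κ * 1#) xs plus-unique
        (All.map (λ {x} (x∉T , η≡) → level x∉T (sameSign-plus (∏-sameSign T id x (∉T x∉T)) η≡)) plus-holds)
      ys≤ : 32 ℕ.* length ys ℕ.≤ 17 ℕ.* q
      ys≤ = size-bound t-small (κ * - 1#) ys minus-unique
        (All.map (λ {x} (x∉T , η≡) → level x∉T (sameSign-minus (∏-sameSign T id x (∉T x∉T)) η≡)) minus-holds)
      bal = balanced {length xs} {length ys} total xs≤ t≤r (ℕₚ.m≤n+m k ∣ T ∣) r-small
      bal′ = balanced {length ys} {length xs} (≡.trans (≡.cong (ℕ._+ ∣ T ∣) (ℕₚ.+-comm (length ys) (length xs))) total)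
        ys≤ t≤r (ℕₚ.m≤n+m k ∣ T ∣) r-small

  -- (-1) to the degree of v in S; v itself contributes the factor `σ v v` = 1.
  ε : Subset q → Fin q → ℤ
  ε S v = ∏∈ S (λ u → σ u v)

  ∏-ε : ∀ S → ∏∈ S (λ v → + 1 ℤ.+ ε S v) ≡ (if isEven S then + (2 ℕ.^ ∣ S ∣) else + 0)
  ∏-ε S = ≡.trans (∏∈-cong S λ v → ≡.cong (λ e → + 1 ℤ.+ e)
      (≡.trans (∏∈-signs S (λ u → joined u v) _ id (λ _ → refl)) (-1^-parity (degIn S v))))
    (∏∈-all S (λ v → degIn S v ℕ.% 2 ≡ᵇ 0) _ id (λ _ → refl))

  units-squared : ∀ {i} → i ≡ + 1 ⊎ i ≡ -[1+ 0 ] → i ℤ.* i ≡ + 1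
  units-squared (inj₁ refl) = refl
  units-squared (inj₂ refl) = refl

  -- The product over all of S is 1 by the handshake lemma, and the product over T is its own
  -- inverse.
  ∏-ε-complement : ∀ {T S} → T ⊑ S → ∏∈ (S ∖ T) (ε S) ≡ ∏∈ T (ε S)
  ∏-ε-complement {T} {S} T⊑S = begin
    x                ≡⟨ ℤₚ.*-identityʳ x ⟨
    x ℤ.* + 1        ≡⟨ ≡.cong (x ℤ.*_) (units-squared (∏∈-unit T (λ v → ∏∈-unit S (λ u → σ-unit u v)))) ⟨
    x ℤ.* (y ℤ.* y)  ≡⟨ ℤₚ.*-assoc x y y ⟨
    x ℤ.* y ℤ.* y    ≡⟨ ≡.cong (ℤ._* y) (≡.trans (∏∈-∖ T⊑S (ε S)) (∏∈-symmetric S σ σ-sym σ-self (λ u v → units-squared (σ-unit u v)))) ⟩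
    + 1 ℤ.* y        ≡⟨ ℤₚ.*-identityˡ y ⟩
    y                ∎
    where
    open ≡.≡-Reasoning
    x = ∏∈ (S ∖ T) (ε S)
    y = ∏∈ T (ε S)

  -- Exchanging the products over T and S turns the degree signs, which depend on S, into vertex
  -- weights `η T`, which do not. For fixed T the sum over S is then a coefficient of `gen`.
  main-identity : ∀ r → + (2 ℕ.^ r ℕ.* N r) ≡ Σ∀ q (λ T → + θ ∣ T ∣ (r ℕ.∸ ∣ T ∣) ℤ.* gen T (η T) r)
  main-identity r = begin
    + (2 ℕ.^ r ℕ.* N r)
      ≡⟨ ℤₚ.pos-* (2 ℕ.^ r) (N r) ⟩
    + (2 ℕ.^ r) ℤ.* + N r
      ≡⟨ ≡.cong (+ (2 ℕ.^ r) ℤ.*_) (count-Σ∀ q (λ S → (∣ S ∣ ≡ᵇ r) ∧ isEven S)) ⟩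
    + (2 ℕ.^ r) ℤ.* Σ∀ q (λ S → if (∣ S ∣ ≡ᵇ r) ∧ isEven S then + 1 else + 0)
      ≡⟨ Σ∀-* q (+ (2 ℕ.^ r)) _ ⟨
    Σ∀ q (λ S → + (2 ℕ.^ r) ℤ.* (if (∣ S ∣ ≡ᵇ r) ∧ isEven S then + 1 else + 0))
      ≡⟨ Σ∀-cong q (λ S → ≡.trans (indicator (∣ S ∣ ≡ᵇ r) (isEven S)) (sized-cong r S λ e →
           ≡.trans (≡.cong (λ l → if isEven S then + (2 ℕ.^ l) else + 0) (≡.sym e)) (≡.sym (∏-ε S)))) ⟩
    Σ∀ q (λ S → sized r S ℤ.* ∏∈ S (λ v → + 1 ℤ.+ ε S v))
      ≡⟨ Σ∀-cong q (λ S → sized-cong r S λ e → ≡.trans (∏∈-expand S (ε S))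
           (≡.trans (Σ∀-halve S (λ T → ∏∈ T (ε S)) ∏-ε-complement)
             (Σ∀-cong q λ T → ≡.cong₂ (λ l p → within T S ℤ.* (+ θ ∣ T ∣ (l ℕ.∸ ∣ T ∣) ℤ.* p)) e (∏∈-swap T S (λ v u → σ u v))))) ⟩
    Σ∀ q (λ S → sized r S ℤ.* Σ∀ q (λ T → within T S ℤ.* (θ′ T ℤ.* ∏∈ S (η T))))
      ≡⟨ Σ∀-cong q (λ S → ≡.trans (≡.sym (Σ∀-* q (sized r S) _)) (Σ∀-cong q λ T →
           solve 4 (λ s w t p → s :* (w :* (t :* p)) := t :* (s :* (w :* p))) refl (sized r S) (within T S) (θ′ T) (∏∈ S (η T)))) ⟩
    Σ∀ q (λ S → Σ∀ q (λ T → θ′ T ℤ.* weight r T (η T) S))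
      ≡⟨ Σ∀-swap q q (λ S T → θ′ T ℤ.* weight r T (η T) S) ⟩
    Σ∀ q (λ T → Σ∀ q (λ S → θ′ T ℤ.* weight r T (η T) S))
      ≡⟨ Σ∀-cong q (λ T → ≡.trans (Σ∀-* q (θ′ T) (weight r T (η T))) (≡.cong (θ′ T ℤ.*_) (gen-coefficient T (η T) r))) ⟩
    Σ∀ q (λ T → θ′ T ℤ.* gen T (η T) r) ∎
    where
    open ≡.≡-Reasoning
    θ′ : Subset q → ℤ
    θ′ T = + θ ∣ T ∣ (r ℕ.∸ ∣ T ∣)
    indicator : ∀ a b → + (2 ℕ.^ r) ℤ.* (if a ∧ b then + 1 else + 0) ≡ (if a then + 1 else + 0) ℤ.* (if b then + (2 ℕ.^ r) else + 0)
    indicator true  true  = ℤₚ.*-comm (+ (2 ℕ.^ r)) (+ 1)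
    indicator true  false = ℤₚ.*-zeroʳ (+ (2 ℕ.^ r))
    indicator false b     = ≡.trans (ℤₚ.*-zeroʳ (+ (2 ℕ.^ r))) (≡.sym (ℤₚ.*-zeroˡ (if b then + (2 ℕ.^ r) else + 0)))

  -- Each S of size r contains 2^r sets T. This total is the loss that the gain 8^h has to beat.
  unsigned-total : ∀ r → Σ∀ q (λ T → gen T (λ _ → + 1) r) ≡ + (2 ℕ.^ r ℕ.* (q C r))
  unsigned-total r = begin
    Σ∀ q (λ T → gen T (λ _ → + 1) r)
      ≡⟨ Σ∀-cong q (λ T → ≡.sym (gen-coefficient T (λ _ → + 1) r)) ⟩
    Σ∀ q (λ T → Σ∀ q (λ S → weight r T (λ _ → + 1) S))
      ≡⟨ Σ∀-swap q q (λ T S → weight r T (λ _ → + 1) S) ⟩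
    Σ∀ q (λ S → Σ∀ q (λ T → weight r T (λ _ → + 1) S))
      ≡⟨ Σ∀-cong q (λ S → ≡.trans (Σ∀-* q (sized r S) _) (sized-cong r S λ e →
           ≡.trans (Σ∀-cong q λ T → ≡.trans (≡.cong (within T S ℤ.*_) (∏∈-1 S (λ _ → refl))) (ℤₚ.*-identityʳ (within T S)))
             (≡.trans (Σ∀-within S) (≡.cong (λ l → + (2 ℕ.^ l)) e)))) ⟩
    Σ∀ q (λ S → sized r S ℤ.* + (2 ℕ.^ r))
      ≡⟨ Σ∀-cong q (λ S → ℤₚ.*-comm (sized r S) (+ (2 ℕ.^ r))) ⟩
    Σ∀ q (λ S → + (2 ℕ.^ r) ℤ.* sized r S)
      ≡⟨ Σ∀-* q (+ (2 ℕ.^ r)) (sized r) ⟩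
    + (2 ℕ.^ r) ℤ.* Σ∀ q (sized r)
      ≡⟨ ≡.cong (+ (2 ℕ.^ r) ℤ.*_) (Σ∀-sized q r) ⟩
    + (2 ℕ.^ r) ℤ.* + (q C r)
      ≡⟨ ℤₚ.pos-* (2 ℕ.^ r) (q C r) ⟨
    + (2 ℕ.^ r ℕ.* (q C r)) ∎
    where open ≡.≡-Reasoning

  ∣∅∣ : ∀ n → ∣ replicate n false ∣ ≡ 0
  ∣∅∣ zero    = refl
  ∣∅∣ (suc n) = ∣∅∣ n

  ∏∈-∅ : ∀ n f → ∏∈ (replicate n false) f ≡ + 1
  ∏∈-∅ zero    f = refl
  ∏∈-∅ (suc n) f = ∏∈-∅ n (f ∘ suc)

  within-∅ : ∀ {n} (S : Subset n) → within (replicate n false) S ≡ + 1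
  within-∅ []      = refl
  within-∅ (_ ∷ S) = within-∅ S

  gen-∅ : ∀ r → let ∅ = replicate q false in gen ∅ (η ∅) r ≡ + (q C r)
  gen-∅ r = ≡.trans (≡.sym (gen-coefficient ∅ (η ∅) r)) (≡.trans (Σ∀-cong q λ S →
      ≡.trans (≡.cong (sized r S ℤ.*_) (≡.cong₂ ℤ._*_ (within-∅ S) (∏∈-1 S (λ u → ∏∈-∅ q (σ u))))) (ℤₚ.*-identityʳ (sized r S)))
    (Σ∀-sized q r))
    where
    ∅ = replicate q false

  gen-1-nonneg : ∀ (T : Subset q) r → + 0 ℤ.≤ gen T (λ _ → + 1) r
  gen-1-nonneg T r = ≡.subst (+ 0 ℤ.≤_) (gen-coefficient T (λ _ → + 1) r) (Σ∀-bound q 0 {λ _ → + 0} λ S → nonneg S)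
    where
    within-01 : ∀ {n} (T S : Subset n) → within T S ≡ + 0 ⊎ within T S ≡ + 1
    within-01 []          []          = inj₂ refl
    within-01 (true  ∷ T) (false ∷ S) = inj₁ refl
    within-01 (true  ∷ T) (true  ∷ S) = within-01 T S
    within-01 (false ∷ T) (_     ∷ S) = within-01 T S
    nonneg : ∀ S → + 0 ℤ.≤ weight r T (λ _ → + 1) S
    nonneg S rewrite ∏∈-1 S {λ _ → + 1} (λ _ → refl) with ∣ S ∣ ≡ᵇ r | within-01 T S
    ... | true  | inj₁ e rewrite e = ℤ.+≤+ z≤n
    ... | true  | inj₂ e rewrite e = ℤ.+≤+ z≤n
    ... | false | _ = ℤ.+≤+ z≤n

  -- The empty T is the main term, and `θ` has folded T = S onto it. Any other T of nonzero weight
  -- has at most r / 2 elements, so k = r - |T| is at least h and `small-set-bias` gains at least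
  -- 8^h.
  deviation : ∀ r h → 1 ℕ.≤ r → h ℕ.+ h ℕ.≤ r → 6401 ℕ.* (r ℕ.* r) ℕ.< q →
    8 ℕ.^ h ℕ.* ℤ.∣ + (2 ℕ.^ r ℕ.* N r) ℤ.- + (2 ℕ.* (q C r)) ∣ ℕ.≤ 2 ℕ.* (2 ℕ.^ r ℕ.* (q C r))
  -- Matching r as a successor lets `θ 0 r` compute to 2, the coefficient of the main term.
  deviation r@(suc _) h 1≤r 2h≤r small = ℤₚ.drop‿+≤+ (begin
    + (8 ℕ.^ h ℕ.* ℤ.∣ + (2 ℕ.^ r ℕ.* N r) ℤ.- + (2 ℕ.* (q C r)) ∣)
      ≡⟨ ≡.cong (λ e → + (8 ℕ.^ h ℕ.* ℤ.∣ e ∣)) difference ⟩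
    + (8 ℕ.^ h ℕ.* ℤ.∣ Σ∀ q rest ∣)
      ≤⟨ Σ∀-bound q (8 ℕ.^ h) (λ T → rest-bound T) ⟩
    Σ∀ q (λ T → + 2 ℤ.* gen T (λ _ → + 1) r)
      ≡⟨ Σ∀-* q (+ 2) _ ⟩
    + 2 ℤ.* Σ∀ q (λ T → gen T (λ _ → + 1) r)
      ≡⟨ ≡.cong (+ 2 ℤ.*_) (unsigned-total r) ⟩
    + 2 ℤ.* + (2 ℕ.^ r ℕ.* (q C r))
      ≡⟨ ℤₚ.pos-* 2 (2 ℕ.^ r ℕ.* (q C r)) ⟨
    + (2 ℕ.* (2 ℕ.^ r ℕ.* (q C r))) ∎)
    where
    open ℤₚ.≤-Reasoning
    ∅ = replicate q false
    term rest : Subset q → ℤ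
    term T = + θ ∣ T ∣ (r ℕ.∸ ∣ T ∣) ℤ.* gen T (η T) r
    rest T = if ∣ T ∣ ≡ᵇ 0 then + 0 else term T
    term-∅ : term ∅ ≡ + (2 ℕ.* (q C r))
    term-∅ = ≡.trans (≡.cong₂ (λ t g → + θ t (r ℕ.∸ t) ℤ.* g) (∣∅∣ q) (gen-∅ r)) (≡.sym (ℤₚ.pos-* 2 (q C r)))
    difference : + (2 ℕ.^ r ℕ.* N r) ℤ.- + (2 ℕ.* (q C r)) ≡ Σ∀ q rest
    difference = ≡.trans (≡.cong (ℤ._- + (2 ℕ.* (q C r))) (≡.trans (main-identity r) (≡.trans (Σ∀-split-∅ q term) (≡.cong (ℤ._+ Σ∀ q rest) term-∅))))
      (cancel (+ (2 ℕ.* (q C r))) (Σ∀ q rest))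
      where
      cancel : ∀ a b → a ℤ.+ b ℤ.- a ≡ b
      cancel a b = ≡.trans (≡.cong (ℤ._- a) (ℤₚ.+-comm a b)) (≡.trans (ℤₚ.+-assoc b a (ℤ.- a))
        (≡.trans (≡.cong (λ e → b ℤ.+ e) (ℤₚ.+-inverseʳ a)) (ℤₚ.+-identityʳ b)))
    2gen≥0 : ∀ T → + 0 ℤ.≤ + 2 ℤ.* gen T (λ _ → + 1) r
    2gen≥0 T = ℤₚ.≤-trans (ℤₚ.≤-reflexive (≡.sym (ℤₚ.*-zeroʳ (+ 2)))) (ℤₚ.*-monoˡ-≤-nonNeg (+ 2) (gen-1-nonneg T r))
    zero-case : ∀ T {x} → x ≡ + 0 → + (8 ℕ.^ h ℕ.* ℤ.∣ x ∣) ℤ.≤ + 2 ℤ.* gen T (λ _ → + 1) r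
    zero-case T refl = ℤₚ.≤-trans (ℤₚ.≤-reflexive (≡.cong +_ (ℕₚ.*-zeroʳ (8 ℕ.^ h)))) (2gen≥0 T)
    rest-bound : ∀ T → + (8 ℕ.^ h ℕ.* ℤ.∣ rest T ∣) ℤ.≤ + 2 ℤ.* gen T (λ _ → + 1) r
    rest-bound T with ∣ T ∣ ≡ᵇ 0 in eq
    ... | true = zero-case T refl
    ... | false with θ-cases ∣ T ∣ (r ℕ.∸ ∣ T ∣)
    ...   | inj₁ θ≡0 = zero-case T (≡.trans (≡.cong (λ e → + e ℤ.* gen T (η T) r) θ≡0) (ℤₚ.*-zeroˡ (gen T (η T) r)))
    ...   | inj₂ t≤k = begin
      + (8 ℕ.^ h ℕ.* ℤ.∣ + θt ℤ.* X ∣)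
        ≡⟨ ≡.cong (λ e → + (8 ℕ.^ h ℕ.* e)) (ℤₚ.abs-* (+ θt) X) ⟩
      + (8 ℕ.^ h ℕ.* (θt ℕ.* ℤ.∣ X ∣))
        ≤⟨ ℤ.+≤+ (ℕₚ.*-mono-≤ (ℕₚ.^-monoʳ-≤ 8 h≤k) (ℕₚ.*-monoˡ-≤ ℤ.∣ X ∣ (θ≤2 t k))) ⟩
      + (8 ℕ.^ k ℕ.* (2 ℕ.* ℤ.∣ X ∣))
        ≡⟨ ≡.cong +_ (≡.trans (≡.sym (ℕₚ.*-assoc (8 ℕ.^ k) 2 ℤ.∣ X ∣)) (≡.trans (≡.cong (ℕ._* ℤ.∣ X ∣) (ℕₚ.*-comm (8 ℕ.^ k) 2)) (ℕₚ.*-assoc 2 (8 ℕ.^ k) ℤ.∣ X ∣))) ⟩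
      + (2 ℕ.* (8 ℕ.^ k ℕ.* ℤ.∣ X ∣))
        ≡⟨ ℤₚ.pos-* 2 (8 ℕ.^ k ℕ.* ℤ.∣ X ∣) ⟩
      + 2 ℤ.* + (8 ℕ.^ k ℕ.* ℤ.∣ X ∣)
        ≤⟨ ℤₚ.*-monoˡ-≤-nonNeg (+ 2) (≡.subst (λ l → + (8 ℕ.^ k ℕ.* ℤ.∣ gen T (η T) l ∣) ℤ.≤ gen T (λ _ → + 1) l) t+k≡r
             (small-set-bias T t≢0 k (≡.subst (λ l → 6401 ℕ.* (l ℕ.* l) ℕ.< q) (≡.sym t+k≡r) small))) ⟩
      + 2 ℤ.* gen T (λ _ → + 1) r ∎
      where
      t = ∣ T ∣
      k = r ℕ.∸ t
      θt = θ t k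
      X = gen T (η T) r
      t≢0 : t ≢ 0
      t≢0 t≡0 = contradiction (≡.trans (≡.sym eq) (≡.cong (_≡ᵇ 0) t≡0)) λ ()
      t+k≡r : t ℕ.+ k ≡ r
      t+k≡r = ℕₚ.m+[n∸m]≡n (ℕₚ.≤-trans t≤k (ℕₚ.m∸n≤m r t))
      h≤k : h ℕ.≤ k
      h≤k = ℕₚ.≮⇒≥ λ k<h → ℕₚ.<-irrefl refl (ℕₚ.<-≤-trans
        (ℕₚ.≤-<-trans (ℕₚ.≤-trans (ℕₚ.≤-reflexive (≡.sym t+k≡r)) (ℕₚ.+-monoˡ-≤ k t≤k)) (ℕₚ.+-mono-< k<h k<h)) 2h≤r)

-- From integer inequalities to the asymptotic statement.

module Rationals where

  toℚᵘ-int : ∀ i → ℚ.toℚᵘ (i ℚ./ 1) ℚᵘ.≃ ℚᵘ.mkℚᵘ i 0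
  toℚᵘ-int i = ℚₚ.toℚᵘ-fromℚᵘ (ℚᵘ.mkℚᵘ i 0)

  natural-< : ∀ m n → + m ℚ./ 1 ℚ.< ℚ.1ℚ ℚ.* (+ n ℚ./ 1) → m ℕ.< n
  natural-< m n p = ℤₚ.drop‿+<+ (≡.subst₂ ℤ._<_ (ℤₚ.*-identityʳ (+ m)) (ℤₚ.*-identityʳ (+ n))
    (ℚᵘₚ.drop-*<* (ℚᵘₚ.<-respˡ-≃ (toℚᵘ-int (+ m)) (ℚᵘₚ.<-respʳ-≃ (toℚᵘ-int (+ n))
      (ℚₚ.toℚᵘ-mono-< (≡.subst (+ m ℚ./ 1 ℚ.<_) (ℚₚ.*-identityˡ (+ n ℚ./ 1)) p))))))

  -- A positive ε is at least 1 / `↧ₙ ε`, so clearing the denominator suffices.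
  relative-bound : ∀ X Y ε → ℚ.0ℚ ℚ.< ε → ℤ.∣ + X ℤ.- + Y ∣ ℕ.* ℚ.↧ₙ ε ℕ.≤ Y →
    ℚ.∣ (+ X ℚ./ 1) ℚ.- (+ Y ℚ./ 1) ∣ ℚ.≤ ε ℚ.* (+ Y ℚ./ 1)
  relative-bound X Y ε@(ℚ.mkℚ (+ suc n) d-1 _) 0<ε le = ℚₚ.toℚᵘ-cancel-≤
    (ℚᵘₚ.≤-respˡ-≃ (ℚᵘₚ.≃-sym lhs) (ℚᵘₚ.≤-respʳ-≃ (ℚᵘₚ.≃-sym rhs) core))
    where
    D = ℤ.∣ + X ℤ.- + Y ∣
    x-c : ℚᵘ.mkℚᵘ (+ X) 0 ℚᵘ.- ℚᵘ.mkℚᵘ (+ Y) 0 ℚᵘ.≃ ℚᵘ.mkℚᵘ (+ X ℤ.- + Y) 0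
    x-c = ℚᵘ.*≡* (≡.cong (ℤ._* + 1) (≡.cong₂ ℤ._+_ (ℤₚ.*-identityʳ (+ X)) (ℤₚ.*-identityʳ (ℤ.- + Y))))
    lhs : ℚ.toℚᵘ ℚ.∣ (+ X ℚ./ 1) ℚ.- (+ Y ℚ./ 1) ∣ ℚᵘ.≃ ℚᵘ.mkℚᵘ (+ D) 0
    lhs = ℚᵘₚ.≃-trans (ℚₚ.toℚᵘ-homo-∣-∣ ((+ X ℚ./ 1) ℚ.- (+ Y ℚ./ 1))) (ℚᵘₚ.∣-∣-cong
      (ℚᵘₚ.≃-trans (ℚₚ.toℚᵘ-homo-+ (+ X ℚ./ 1) (ℚ.- (+ Y ℚ./ 1))) (ℚᵘₚ.≃-trans
        (ℚᵘₚ.+-cong (toℚᵘ-int (+ X)) (ℚᵘₚ.≃-trans (ℚₚ.toℚᵘ-homo‿- (+ Y ℚ./ 1)) (ℚᵘₚ.-‿cong (toℚᵘ-int (+ Y))))) x-c)))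
    rhs : ℚ.toℚᵘ (ε ℚ.* (+ Y ℚ./ 1)) ℚᵘ.≃ ℚᵘ.mkℚᵘ (+ suc n) d-1 ℚᵘ.* ℚᵘ.mkℚᵘ (+ Y) 0
    rhs = ℚᵘₚ.≃-trans (ℚₚ.toℚᵘ-homo-* ε (+ Y ℚ./ 1)) (ℚᵘₚ.*-congˡ {ℚᵘ.mkℚᵘ (+ suc n) d-1} (toℚᵘ-int (+ Y)))
    core : ℚᵘ.mkℚᵘ (+ D) 0 ℚᵘ.≤ ℚᵘ.mkℚᵘ (+ suc n) d-1 ℚᵘ.* ℚᵘ.mkℚᵘ (+ Y) 0
    core = ℚᵘ.*≤* (≡.subst₂ ℤ._≤_ (ℤₚ.pos-* D (suc d-1 ℕ.* 1)) (≡.trans (ℤₚ.pos-* (suc n) Y) (≡.sym (ℤₚ.*-identityʳ _)))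
      (ℤ.+≤+ (ℕₚ.≤-trans (ℕₚ.≤-reflexive (≡.cong (D ℕ.*_) (ℕₚ.*-identityʳ (suc d-1)))) (ℕₚ.≤-trans le (ℕₚ.m≤n*m Y (suc n))))))
  relative-bound X Y (ℚ.mkℚ (+ zero) d-1 _) (ℚ.*<* (ℤ.+<+ ())) le
  relative-bound X Y (ℚ.mkℚ -[1+ _ ] d-1 _) (ℚ.*<* ()) le

n<2^n : ∀ n → n ℕ.< 2 ℕ.^ n
n<2^n zero    = s≤s z≤n
n<2^n (suc n) = ℕₚ.≤-trans (ℕₚ.+-mono-≤ (ℕₚ.≤-trans (s≤s z≤n) (n<2^n n)) (n<2^n n))
  (ℕₚ.≤-reflexive (≡.cong (2 ℕ.^ n ℕ.+_) (≡.sym (ℕₚ.+-identityʳ (2 ℕ.^ n)))))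

module Asymptotics where
  open +-*-Solver using (solve; _:=_; _:+_; _:*_; con)

  8^≡ : ∀ h → 8 ℕ.^ h ≡ 2 ℕ.^ h ℕ.* (2 ℕ.^ h ℕ.* 2 ℕ.^ h)
  8^≡ zero    = refl
  8^≡ (suc h) = ≡.trans (≡.cong (8 ℕ.*_) (8^≡ h))
    (solve 1 (λ y → con 8 :* (y :* (y :* y)) := con 2 :* y :* (con 2 :* y :* (con 2 :* y))) refl (2 ℕ.^ h))

  -- From r ≥ 81 and 81² = 6561 follows 6401 r² ≤ r⁴ < q. From r ≥ 2 (d + 1) follows h = ⌊r/2⌋ > d,
  -- so 2^h exceeds the required factor 2 d.
  paley-bound : ∀ {q} → q ℕ.% 4 ≡ 1 → (F : FiniteField q) → ∀ r d → 81 ℕ.+ (suc d ℕ.+ suc d) ℕ.≤ r → r ℕ.^ 4 ℕ.< q →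
    ℤ.∣ + (2 ℕ.^ (r ℕ.∸ 1) ℕ.* Paley.N F r) ℤ.- + (q C r) ∣ ℕ.* d ℕ.≤ q C r
  paley-bound {q} q%4≡1 F r@(suc r′) d r≥ r⁴<q = from-quotient (q ℕ./ 4) refl
    where
    open ℕₚ.≤-Reasoning
    c = q C r
    x = Paley.N F r
    81≤r : 81 ℕ.≤ r
    81≤r = ℕₚ.≤-trans (ℕₚ.m≤m+n 81 _) r≥
    q≡1+4k : q ≡ suc (q ℕ./ 4 ℕ.* 4)
    q≡1+4k = ≡.trans (ℕ.m≡m%n+[m/n]*n q 4) (≡.cong (ℕ._+ q ℕ./ 4 ℕ.* 4) q%4≡1)
    small : 6401 ℕ.* (r ℕ.* r) ℕ.< q
    small = ℕₚ.≤-<-trans (begin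
      6401 ℕ.* (r ℕ.* r)       ≤⟨ ℕₚ.*-monoˡ-≤ (r ℕ.* r) (ℕₚ.≤-trans (ℕₚ.m≤m+n 6401 160) (ℕₚ.*-mono-≤ 81≤r 81≤r)) ⟩
      (r ℕ.* r) ℕ.* (r ℕ.* r)  ≡⟨ solve 1 (λ r → (r :* r) :* (r :* r) := r :* (r :* (r :* (r :* con 1)))) refl r ⟩
      r ℕ.^ 4                  ∎) r⁴<q
    h = ℕ.⌊ r /2⌋
    D = ℤ.∣ + (2 ℕ.^ r′ ℕ.* x) ℤ.- + c ∣
    2h≤r : h ℕ.+ h ℕ.≤ r
    2h≤r = ℕₚ.≤-trans (ℕₚ.+-monoʳ-≤ h (ℕₚ.⌊n/2⌋≤⌈n/2⌉ r)) (ℕₚ.≤-reflexive (ℕₚ.⌊n/2⌋+⌈n/2⌉≡n r))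
    r≤2h+1 : r ℕ.≤ suc (h ℕ.+ h)
    r≤2h+1 = ℕₚ.≤-trans (ℕₚ.≤-reflexive (≡.sym (ℕₚ.⌊n/2⌋+⌈n/2⌉≡n r)))
      (ℕₚ.≤-trans (ℕₚ.+-monoʳ-≤ h (ceil r)) (ℕₚ.≤-reflexive (ℕₚ.+-suc h h)))
      where
      ceil : ∀ n → ℕ.⌈ n /2⌉ ℕ.≤ suc ℕ.⌊ n /2⌋
      ceil zero          = z≤n
      ceil (suc zero)    = ℕₚ.≤-refl
      ceil (suc (suc n)) = s≤s (ceil n)
    d<h : suc d ℕ.≤ h
    d<h = ℕₚ.≤-trans (ℕₚ.≤-reflexive (ℕₚ.n≡⌊n+n/2⌋ (suc d))) (ℕₚ.⌊n/2⌋-mono (ℕₚ.≤-trans (ℕₚ.m≤n+m _ 81) r≥))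
    2d≤2^h : 2 ℕ.* d ℕ.≤ 2 ℕ.^ h
    2d≤2^h = ℕₚ.≤-trans (ℕₚ.*-monoʳ-≤ 2 (ℕₚ.<⇒≤ (n<2^n d))) (ℕₚ.^-monoʳ-≤ 2 d<h)
    doubled : ℤ.∣ + (2 ℕ.^ r ℕ.* x) ℤ.- + (2 ℕ.* c) ∣ ≡ 2 ℕ.* D
    doubled = ≡.trans (≡.cong ℤ.∣_∣ (≡.trans
      (≡.cong₂ ℤ._-_ (≡.trans (≡.cong +_ (ℕₚ.*-assoc 2 (2 ℕ.^ r′) x)) (ℤₚ.pos-* 2 (2 ℕ.^ r′ ℕ.* x))) (ℤₚ.pos-* 2 c))
      (≡.trans (≡.cong (λ e → + 2 ℤ.* + (2 ℕ.^ r′ ℕ.* x) ℤ.+ e) (ℤₚ.neg-distribʳ-* (+ 2) (+ c)))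
        (≡.sym (ℤₚ.*-distribˡ-+ (+ 2) (+ (2 ℕ.^ r′ ℕ.* x)) (ℤ.- + c)))))) (ℤₚ.abs-* (+ 2) (+ (2 ℕ.^ r′ ℕ.* x) ℤ.- + c))
    -- As r ≤ 2h + 1, the number 2^r is at most 2 · 4^h, and dividing 8^h by 4^h leaves the saving
    -- 2^h.
    2^h*D≤2c : 8 ℕ.^ h ℕ.* (2 ℕ.* D) ℕ.≤ 2 ℕ.* (2 ℕ.^ r ℕ.* c) → 2 ℕ.^ h ℕ.* D ℕ.≤ 2 ℕ.* c
    2^h*D≤2c le = ℕₚ.*-cancelʳ-≤ _ _ (2 ℕ.* P) {{ℕₚ.m*n≢0 2 P {{_}} {{P≢0}}}} (begin
      y ℕ.* D ℕ.* (2 ℕ.* P)       ≡⟨ solve 3 (λ y p d → y :* d :* (con 2 :* p) := y :* p :* (con 2 :* d)) refl y P D ⟩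
      y ℕ.* P ℕ.* (2 ℕ.* D)       ≡⟨ ≡.cong (ℕ._* (2 ℕ.* D)) (8^≡ h) ⟨
      8 ℕ.^ h ℕ.* (2 ℕ.* D)       ≤⟨ le ⟩
      2 ℕ.* (2 ℕ.^ r ℕ.* c)       ≤⟨ ℕₚ.*-monoʳ-≤ 2 (ℕₚ.*-monoˡ-≤ c (ℕₚ.≤-trans (ℕₚ.^-monoʳ-≤ 2 r≤2h+1)
                                       (ℕₚ.≤-reflexive (≡.cong (2 ℕ.*_) (ℕₚ.^-distribˡ-+-* 2 h h))))) ⟩
      2 ℕ.* (2 ℕ.* P ℕ.* c)       ≡⟨ solve 2 (λ p c → con 2 :* (con 2 :* p :* c) := con 2 :* c :* (con 2 :* p)) refl P c ⟩
      2 ℕ.* c ℕ.* (2 ℕ.* P)       ∎)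
      where
      y = 2 ℕ.^ h
      P = y ℕ.* y
      P≢0 : ℕ.NonZero P
      P≢0 = ℕₚ.m*n≢0 y y {{ℕₚ.m^n≢0 2 h}} {{ℕₚ.m^n≢0 2 h}}
    from-quotient : ∀ k → q ℕ./ 4 ≡ k → D ℕ.* d ℕ.≤ c
    from-quotient zero    eq = contradiction (ℕₚ.<-≤-trans small (ℕₚ.≤-reflexive (≡.trans q≡1+4k (≡.cong (λ k → suc (k ℕ.* 4)) eq))))
      λ { (s≤s ()) }
    from-quotient (suc m) eq = ℕₚ.*-cancelˡ-≤ 2 (begin
      2 ℕ.* (D ℕ.* d)  ≡⟨ solve 2 (λ a b → con 2 :* (a :* b) := con 2 :* b :* a) refl D d ⟩
      2 ℕ.* d ℕ.* D    ≤⟨ ℕₚ.*-monoˡ-≤ D 2d≤2^h ⟩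
      2 ℕ.^ h ℕ.* D    ≤⟨ 2^h*D≤2c (≡.subst (λ e → 8 ℕ.^ h ℕ.* e ℕ.≤ 2 ℕ.* (2 ℕ.^ r ℕ.* c)) doubled
                            (Counting.deviation F m q≡ r h (s≤s z≤n) 2h≤r small)) ⟩
      2 ℕ.* c          ∎)
      where
      q≡ : q ≡ suc ((suc m ℕ.+ suc m) ℕ.+ (suc m ℕ.+ suc m))
      q≡ = ≡.trans q≡1+4k (≡.cong suc (≡.trans (≡.cong (ℕ._* 4) eq)
        (solve 1 (λ m → m :* con 4 := (m :+ m) :+ (m :+ m)) refl (suc m))))

open import Data.Nat using (_≤_; _^_; _*_; _∸_; _%_)
open import Data.Rational using (ℚ; _/_; 0ℚ; ∣_∣; _-_) renaming (_*_ to _*ℚ_; _≤_ to _≤ℚ_; _<_ to _<ℚ_)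

theorem1p4 : (r : ℕ → ℕ)
    → (∀ q → PaleyOrder q → 1 ≤ r q)
    → (∀ M → ∃[ Q ] (∀ q → Q ≤ q → PaleyOrder q → M ≤ r q))
    → (∀ ε → 0ℚ <ℚ ε → ∃[ Q ] (∀ q → Q ≤ q → PaleyOrder q →
    (+ (r q ^ 4) / 1) <ℚ ε *ℚ (+ q / 1)))
    → ∀ ε → 0ℚ <ℚ ε → ∃[ Q ] (∀ q → Q ≤ q → q % 4 ≡ 1 → (F : FiniteField q) →
    ∣ (+ (2 ^ (r q ∸ 1) * Paley.N F (r q)) / 1) - (+ (q C r q) / 1) ∣
    ≤ℚ ε *ℚ (+ (q C r q) / 1))
theorem1p4 r _ r→∞ r⁴=o ε 0<ε =
  let d = ℚ.↧ₙ ε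
      (Q₁ , r-large) = r→∞ (81 ℕ.+ (suc d ℕ.+ suc d))
      -- Taking 1 for the constant gives r⁴ < q eventually, the form in which `paley-bound` takes
      -- the growth condition.
      (Q₂ , r-small) = r⁴=o ℚ.1ℚ (ℚₚ.positive⁻¹ ℚ.1ℚ)
  in Q₁ ℕ.⊔ Q₂ , λ q Q≤q q%4≡1 F →
    Rationals.relative-bound (2 ^ (r q ∸ 1) * Paley.N F (r q)) (q C r q) ε 0<ε
      (Asymptotics.paley-bound q%4≡1 F (r q) d
        (r-large q (ℕₚ.m⊔n≤o⇒m≤o Q₁ Q₂ Q≤q) (q%4≡1 , F))
        (Rationals.natural-< (r q ^ 4) q (r-small q (ℕₚ.m⊔n≤o⇒n≤o Q₁ Q₂ Q≤q) (q%4≡1 , F))))
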